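{- Suppose that no algorithm solves every Dictionary Matching instance in $o(n/\sqrt{\log n})$ time. Let $P(N)$ and $Q(N)$ denote the preprocessing time and query time of any data structure for inverse suffix array queries over a binary text of length $N$. Then no such data structure can simultaneously satisfy $P(N)=o(N/\sqrt{\log N})$ and $Q(N)=o(\sqrt{\log N})$. In particular, for the data structure that, for binary texts of length $N$, uses $O(N)$ bits, has preprocessing time $O(N/\sqrt{\log N})$ and preprocessing space $O(N)$ bits, and answers inverse suffix array queries in $O(1)$ time, the $O(N/\sqrt{\log N})$ preprocessing time cannot be improved to $o(N/\sqrt{\log N})$.
   Context: Logarithms are binary; $[a..b]=\{k\in\mathbb Z:a\le k\le b\}$; strings are indexed from $1$. Dictionary Matching problem: let $n\ge2$ and $k,m\ge1$ be integers with $k=\Theta(n/\log n)$ and $m=\Theta(\log n)$. The input consists of the packed representation of a text $T\in\{0,1\}^n$ and the packed representations of a collection $\mathcal D=\{P_1,\dots,P_k\}\subseteq\{0,1\}^m$ of patterns. The output is YES if some $P_i$ occurs in $T$ as a substring, and NO otherwise. The model is the word RAM with word size $w=c\log n$, $c\ge2$ constant (standard arithmetic and bitwise word operations take $O(1)$ time). For a text $S$ of length $N$, $\mathrm{SA}_S^{ -1}[j]$ ($j\in[1..N]$) is the lexicographic rank of the suffix $S[j..N]$ among all suffixes of $S$ (a proper prefix of a string is smaller than the string). A data structure for inverse suffix array queries is built by a preprocessing algorithm from the packed representation of a binary text $S$ of length $N$ in $P(N)$ time and, given $j\in[1..N]$, returns $\mathrm{SA}_S^{ -1}[j]$ in $Q(N)$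 time. The packed representation of a binary string with word size $w$ stores $w$ consecutive bits per word (earlier bits in lower-order positions), with unused bits of the last word set to $0$. -}

module Defs where

open import Data.Bool.Base using (Bool; true; false; if_then_else_; _∧_; _∨_; _xor_)
import Data.Bool.Base as Bool
import Data.Bool.Properties as Bool
open import Data.List.Base using (List; []; _∷_; drop; take; map; upTo; filter; length; concatMap)
open import Data.List.Relation.Binary.Infix.Heterogeneous using (Infix)
open import Data.List.Relation.Binary.Lex.Strict using (Lex-<; <-decidable)
open import Data.Nat.Base using (ℕ; zero; suc; _+_; _*_; _∸_; _^_; _/_; _%_; _⊔_; _≤_; _<_; _≡ᵇ_; _<ᵇ_)
open import Data.Product using (∃-syntax; _×_)
open import Data.Sum using (_⊎_)
open import Data.Vec.Base using (Vec; toList)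
open import Data.Vec.Relation.Unary.Any using (Any)
open import Relation.Binary.Definitions using (Decidable)
open import Relation.Binary.PropositionalEquality using (_≡_; _≢_)
open import Relation.Nullary using (¬_)

------------------------------------------------------------------------
-- Inequalities between naturals and binary logarithms.  These are exact
-- (log is the real logarithm, not rounded), for n ≥ 1.

-- a · log n ≤ b
_·log_≤_ : ℕ → ℕ → ℕ → Set
a ·log n ≤ b = n ^ a ≤ 2 ^ b

-- b ≤ a · log n
_≤_·log_ : ℕ → ℕ → ℕ → Set
b ≤ a ·log n = 2 ^ b ≤ n ^ a

-- a · √(log n) ≤ b, by squaring
_·√log_≤_ : ℕ → ℕ → ℕ → Set
a ·√log n ≤ b = (a ^ 2) ·log n ≤ (b ^ 2)

-- b ≤ √(log n), by squaring
_≤√log_ : ℕ → ℕ → Set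
b ≤√log n = (b ^ 2) ≤ 1 ·log n

Eventually : (ℕ → Set) → Set
Eventually P = ∃[ n₀ ] ∀ n → n₀ ≤ n → P n

-- In the little-o definitions the usual ε > 0 is 1/e, with e ≥ 1 arbitrary
-- (e = 0 gives a true inequality, so it need not be excluded).

o[n/√logn] : (ℕ → ℕ) → Set
o[n/√logn] f = ∀ e → Eventually λ n → (e * f n) ·√log n ≤ n

o[√logn] : (ℕ → ℕ) → Set
o[√logn] f = ∀ e → Eventually λ n → (e * f n) ≤√log n

O[n/√logn] : (ℕ → ℕ) → Set
O[n/√logn] f = ∃[ C ] Eventually λ n → f n ·√log n ≤ (C * n)

O[n] : (ℕ → ℕ) → Set
O[n] f = ∃[ C ] Eventually λ n → f n ≤ C * n

O[1] : (ℕ → ℕ) → Set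
O[1] f = ∃[ C ] Eventually λ n → f n ≤ C

-- f = Θ(n / log n) at the point (n , f), with implied constants 1/C and C.
Θ[_,n/logn] : ℕ → ℕ → ℕ → Set
Θ[ C ,n/logn] n f = (f ·log n ≤ (C * n)) × (n ≤ (C * f) ·log n)

-- f = Θ(log n) at the point (n , f), with implied constants 1/C and C.
Θ[_,logn] : ℕ → ℕ → ℕ → Set
Θ[ C ,logn] n f = (f ≤ C ·log n) × (1 ·log n ≤ (C * f))

------------------------------------------------------------------------
-- Word size

-- A real number c ≥ 2, presented as the supremum of a bounded set of
-- nonnegative fractions that contains 2; `frac p q` says that p/q is in
-- the set.  Every real c ≥ 2 arises in this way.
record Real≥2 : Set₁ where
  field
    frac    : ℕ → ℕ → Set
    has-2   : frac 2 1
    bound   : ℕ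
    bounded : ∀ p q → frac p q → p ≤ bound * q

open Real≥2

-- c · log n ≤ v
_·Log_≤_ : Real≥2 → ℕ → ℕ → Set
c ·Log n ≤ v = ∀ p q → frac c p q → p ·log n ≤ (q * v)

-- w n = ⌈ c · log n ⌉.  The values of w below 2 are irrelevant.
IsWordSize : Real≥2 → (ℕ → ℕ) → Set
IsWordSize c w = ∀ n → 2 ≤ n →
  (c ·Log n ≤ w n) × (∀ v → c ·Log n ≤ v → w n ≤ v)

------------------------------------------------------------------------
-- Operations on words.  A word of size w is a natural number below 2 ^ w.

-- Total division and remainder; the values at divisor 0 are conventions.
_div_ : ℕ → ℕ → ℕ
x div zero  = 0
x div suc y = x / suc y

_mod_ : ℕ → ℕ → ℕ
x mod zero  = 0
x mod suc y = x % suc y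

bit : Bool → ℕ
bit b = if b then 1 else 0

odd : ℕ → Bool
odd x = x % 2 ≡ᵇ 1

bitwise : (Bool → Bool → Bool) → ℕ → ℕ → ℕ → ℕ
bitwise f zero    x y = 0
bitwise f (suc w) x y = bit (f (odd x) (odd y)) + 2 * bitwise f w (x / 2) (y / 2)

data Op : Set where
  add sub mul quo rem and or xor shl shr eq lt : Op

⟦_⟧ : Op → ℕ → ℕ → ℕ → ℕ
⟦ add ⟧ w x y = (x + y) mod (2 ^ w)
⟦ sub ⟧ w x y = ((x + 2 ^ w) ∸ y) mod (2 ^ w)
⟦ mul ⟧ w x y = (x * y) mod (2 ^ w)
⟦ quo ⟧ w x y = x div y
⟦ rem ⟧ w x y = x mod y
⟦ and ⟧ w x y = bitwise _∧_ w x y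
⟦ or  ⟧ w x y = bitwise _∨_ w x y
⟦ xor ⟧ w x y = bitwise _xor_ w x y
⟦ shl ⟧ w x y = (x * 2 ^ y) mod (2 ^ w)
⟦ shr ⟧ w x y = x div (2 ^ y)
⟦ eq  ⟧ w x y = bit (x ≡ᵇ y)
⟦ lt  ⟧ w x y = bit (x <ᵇ y)

------------------------------------------------------------------------
-- The word RAM.  Registers and arrays are named by natural numbers; a
-- program mentions only finitely many of them, so it has a constant
-- number of registers and of arrays.  Each array has 2 ^ w words,
-- addressed by words.

data Expr : Set where
  const : ℕ → Expr
  reg   : ℕ → Expr
  op    : Op → Expr → Expr → Expr
  load  : (array : ℕ) (address : Expr) → Expr

infixr 4 _⨟_

data Prog : Set where
  skip  : Prog
  assign : (register : ℕ) → Expr → Prog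
  store : (array : ℕ) (address value : Expr) → Prog
  _⨟_   : Prog → Prog → Prog
  cond  : Expr → (nonzero zero : Prog) → Prog
  while : Expr → Prog → Prog

record State : Set where
  constructor state
  field
    regs : ℕ → ℕ
    mem  : ℕ → ℕ → ℕ

open State public

update : ∀ {A : Set} → ℕ → A → (ℕ → A) → ℕ → A
update i v f j = if j ≡ᵇ i then v else f j

setReg : ℕ → ℕ → State → State
setReg r v σ = state (update r v (regs σ)) (mem σ)

setMem : ℕ → ℕ → ℕ → State → State
setMem a i v σ = state (regs σ) (update a (update i v (mem σ a)) (mem σ))

eval : ℕ → State → Expr → ℕ
eval w σ (const v)  = v mod (2 ^ w)
eval w σ (reg r)    = regs σ r
eval w σ (op o d e) = ⟦ o ⟧ w (eval w σ d) (eval w σ e)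
eval w σ (load a e) = mem σ a (eval w σ e)

-- Time to evaluate an expression: one step per node.
cost : Expr → ℕ
cost (const v)  = 1
cost (reg r)    = 1
cost (op o d e) = 1 + cost d + cost e
cost (load a e) = 1 + cost e

-- Least s such that all addresses read by the evaluation are below s.
extent : ℕ → State → Expr → ℕ
extent w σ (const v)  = 0
extent w σ (reg r)    = 0
extent w σ (op o d e) = extent w σ d ⊔ extent w σ e
extent w σ (load a e) = extent w σ e ⊔ suc (eval w σ e)

-- Run w p σ τ t s: with word size w, program p started in state σ halts in
-- state τ after t steps, and s is the least number such that all addresses
-- read or written, in any array, are below s.
data Run (w : ℕ) : Prog → State → State → ℕ → ℕ → Set where
  skip : ∀ {σ} → Run w skip σ σ 1 0
  assign : ∀ {σ r e} →
    Run w (assign r e) σ (setReg r (eval w σ e) σ) (1 + cost e) (extent w σ e)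
  store : ∀ {σ a d e} →
    Run w (store a d e) σ (setMem a (eval w σ d) (eval w σ e) σ)
      (1 + cost d + cost e)
      (extent w σ d ⊔ extent w σ e ⊔ suc (eval w σ d))
  seq : ∀ {p q σ τ υ t t′ s s′} →
    Run w p σ τ t s → Run w q τ υ t′ s′ →
    Run w (p ⨟ q) σ υ (t + t′) (s ⊔ s′)
  cond-nonzero : ∀ {e p q σ τ t s} → eval w σ e ≢ 0 → Run w p σ τ t s →
    Run w (cond e p q) σ τ (1 + cost e + t) (extent w σ e ⊔ s)
  cond-zero : ∀ {e p q σ τ t s} → eval w σ e ≡ 0 → Run w q σ τ t s →
    Run w (cond e p q) σ τ (1 + cost e + t) (extent w σ e ⊔ s)
  while-stop : ∀ {e p σ} → eval w σ e ≡ 0 →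
    Run w (while e p) σ σ (1 + cost e) (extent w σ e)
  while-step : ∀ {e p σ τ υ t t′ s s′} → eval w σ e ≢ 0 →
    Run w p σ τ t s → Run w (while e p) τ υ t′ s′ →
    Run w (while e p) σ υ (1 + cost e + t + t′) (extent w σ e ⊔ s ⊔ s′)

------------------------------------------------------------------------
-- Packed strings and input conventions

fromBits : List Bool → ℕ
fromBits []       = 0
fromBits (b ∷ bs) = bit b + 2 * fromBits bs

-- ⌈ l / w ⌉
packedLength : ℕ → ℕ → ℕ
packedLength w l = (l + (w ∸ 1)) div w

packed : ℕ → List Bool → List ℕ
packed w S = map (λ i → fromBits (take w (drop (i * w) S))) (upTo (packedLength w (length S)))

-- The list from position 0 on, followed by zeros.
padded : List ℕ → ℕ → ℕ
padded []       i       = 0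
padded (x ∷ xs) zero    = x
padded (x ∷ xs) (suc i) = padded xs i

-- The given lists occupy the first registers and the beginnings of the first
-- arrays; everything else is 0.
initial : List ℕ → List (List ℕ) → State
initial rs []         = state (padded rs) (λ _ _ → 0)
initial rs (xs ∷ xss) = state (padded rs) λ where
  zero    → padded xs
  (suc a) → mem (initial rs xss) a

------------------------------------------------------------------------
-- Dictionary Matching

-- The implied constants are κ for k = Θ(n / log n) and μ for m = Θ(log n).
-- The last two fields only say that the input can be represented at all on a
-- machine with words of size w n; for fixed κ and μ they are automatic for all
-- sufficiently large n.
record Instance (w : ℕ → ℕ) (κ μ n : ℕ) : Set where
  field
    2≤n        : 2 ≤ n
    k m        : ℕ
    1≤k        : 1 ≤ k
    1≤m        : 1 ≤ m
    k-Θ        : Θ[ κ ,n/logn] n k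
    m-Θ        : Θ[ μ ,logn] n m
    text       : Vec Bool n
    patterns   : Vec (Vec Bool m) k
    m-fits     : m < 2 ^ w n
    words-fit  : k * packedLength (w n) m < 2 ^ w n

  -- Array 0 holds the text; array 1 holds the patterns one after another, each
  -- starting at a new word.
  input : State
  input = initial (n ∷ w n ∷ k ∷ m ∷ [])
    (packed (w n) (toList text) ∷
     concatMap (λ P → packed (w n) (toList P)) (toList patterns) ∷ [])

  IsYes : Set
  IsYes = Any (λ P → Infix _≡_ (toList P) (toList text)) patterns

-- The answer is left in register 0 (1 for YES, 0 for NO).
SolvesDictionaryMatching : (w : ℕ → ℕ) (κ μ : ℕ) → Prog → (t : ℕ → ℕ) → Set
SolvesDictionaryMatching w κ μ p t =
  ∀ n (I : Instance w κ μ n) → let open Instance I in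
  ∃[ τ ] ∃[ t′ ] ∃[ s ]
    Run (w n) p input τ t′ s ×
    t′ ≤ t n ×
    ((regs τ 0 ≡ 1 × IsYes) ⊎ (regs τ 0 ≡ 0 × ¬ IsYes))

------------------------------------------------------------------------
-- Inverse suffix arrays

-- S[j..N]
suffix : List Bool → ℕ → List Bool
suffix S j = drop (j ∸ 1) S

-- In this strict order a proper prefix of a string is smaller than the string.
_<lex_ : List Bool → List Bool → Set
_<lex_ = Lex-< _≡_ Bool._<_

_<lex?_ : Decidable _<lex_
_<lex?_ = <-decidable Bool._≟_ Bool._<?_

-- Ranks and positions are counted from 1.
SA⁻¹ : List Bool → ℕ → ℕ
SA⁻¹ S j = suc (length (filter (λ i → suffix S i <lex? suffix S j) (map suc (upTo (length S)))))

record Structure : Set where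
  field
    preprocess : Prog
    query      : Prog

module _ (w : ℕ → ℕ) (D : Structure) {N : ℕ} (S : Vec Bool N) where
  open Structure D

  textInput : State
  textInput = initial (N ∷ w N ∷ []) (packed (w N) (toList S) ∷ [])

  -- The states of the machine after preprocessing and any number of queries.
  -- The query position is passed in register 0.
  data Reachable : State → Set where
    prepared : ∀ {σ t s} → Run (w N) preprocess textInput σ t s → Reachable σ
    queried  : ∀ {σ τ j t s} → Reachable σ → 1 ≤ j → j ≤ N →
      Run (w N) query (setReg 0 j σ) τ t s → Reachable τ

-- P and Q bound the preprocessing time and the query time.  The answer to a
-- query is left in register 0.
record AnswersSA⁻¹ (w : ℕ → ℕ) (D : Structure) (P Q : ℕ → ℕ) : Set where
  open Structure D
  field
    preprocess-correct : ∀ N → 2 ≤ N → (S : Vec Bool N) →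
      ∃[ σ ] ∃[ t ] ∃[ s ] Run (w N) preprocess (textInput w D S) σ t s × t ≤ P N
    query-correct : ∀ N → 2 ≤ N → (S : Vec Bool N) →
      ∀ σ → Reachable w D S σ → ∀ j → 1 ≤ j → j ≤ N →
      ∃[ τ ] ∃[ t ] ∃[ s ]
        Run (w N) query (setReg 0 j σ) τ t s × t ≤ Q N × regs τ 0 ≡ SA⁻¹ (toList S) j

-- Space is measured in words per array.  Since the number of arrays is constant,
-- a space bound of s words per array means O(w · s) bits.

PreprocessSpace : (w : ℕ → ℕ) → Structure → (ℕ → ℕ) → Set
PreprocessSpace w D f = ∀ N → 2 ≤ N → (S : Vec Bool N) → ∀ {σ t s} →
  Run (w N) (Structure.preprocess D) (textInput w D S) σ t s → s ≤ f N

-- The structure itself consists of the part of memory that queries access.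
StructureSpace : (w : ℕ → ℕ) → Structure → (ℕ → ℕ) → Set
StructureSpace w D f = ∀ N → 2 ≤ N → (S : Vec Bool N) →
  ∀ {σ} → Reachable w D S σ → ∀ {j τ t s} → 1 ≤ j → j ≤ N →
  Run (w N) (Structure.query D) (setReg 0 j σ) τ t s → s ≤ f N

{-# OPTIONS --safe #-}
module Submission where

-- A structure that is built and queried too fast would solve Dictionary Matching.  Every string S
-- handed to it has length exactly n, so that the word size is w n throughout; since the text alone
-- fills n bits, the text is cut into O(1) chunks and the dictionary into O(1) groups, and each pair
-- of a chunk and a group is served by copies of the structure with registers and arrays of their own.
--
-- For a chunk X let S = X C, where C consists of the words of the text that follow X, of two
-- separators, and of P 0^N and P 1^N for every pattern P of the group, all aligned to words.  If no
-- run of equal bits is too long, then the suffixes of S that start in X and lie between the two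
-- suffixes at P 0^N and P 1^N are exactly the occurrences of P in X.  The suffixes that start in C
-- are counted as well, but they contribute the same to the ranks in Z C, where Z = b^|X|; and P does
-- not occur in Z if its first bit is not b.  So P occurs in X as soon as the difference of the ranks
-- of the two suffixes is larger in X C than in Z C, and the converse holds for one of the two b.
--
-- Long runs are removed beforehand: deleting a word that is preceded by more than R = ⌈m / w⌉ copies
-- of itself does not change the set of substrings of length m.  The number of possible positions of
-- a pattern need not be a multiple of w, so the text is also read from a position at which it ends
-- with a whole word of such positions.  Inputs of bounded length are answered by a decision tree.

open import Defs
open import Data.Bool.Base using (Bool; true; false; if_then_else_; not; T)
import Data.Bool.Base as Bool
open import Data.Bool.Properties using (¬-not)
import Data.Bool.Properties as Bool
open import Data.Empty using (⊥-elim)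
open import Data.List.Base using (List; []; _∷_; _++_; drop; take; map; upTo; applyUpTo; filter; length; concatMap; concat; replicate; _∷ʳ_; cartesianProduct)
open import Data.List.Properties using (length-++; length-map; length-drop; length-replicate; ++-assoc; ++-identityʳ; map-++; concat-++; take++drop≡id; drop-drop; map-upTo; ≡-dec; ∷-injective; length-upTo; take-[]; length-filter; drop-[]; drop-all; ∷ʳ-++)
open import Data.List.Relation.Binary.Infix.Heterogeneous using (Infix; here; there)
open import Data.List.Relation.Binary.Infix.Heterogeneous.Properties using (infix?)
open import Data.List.Relation.Binary.Prefix.Heterogeneous using (Prefix; []; _∷_)
open import Data.List.Relation.Binary.Lex.Core using (halt; this; next)
open import Data.List.Relation.Binary.Lex.Strict using (<-transitive)
open import Data.List.Membership.Propositional using (_∈_)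
open import Data.List.Membership.Propositional.Properties using (∈-cartesianProduct⁺; ∈-cartesianProduct⁻; ∈-upTo⁺; ∈-upTo⁻)
open import Data.List.Relation.Unary.All using (All; []; _∷_)
import Data.List.Relation.Unary.All as All
open import Data.List.Relation.Unary.All.Properties using (map⁺; ++⁺)
open import Data.List.Relation.Unary.Any using (here; there)
open import Data.Nat.Base
open import Data.Nat.DivMod using (m%n<n; m≡m%n+[m/n]*n; m<n⇒m%n≡m; m<n⇒m/n≡0; [m+kn]%n≡m%n; +-distrib-/; m*n/n≡m; m/n*n≤m; m*n%n≡0)
open import Data.Nat.Properties
open import Data.Nat.Tactic.RingSolver using (solve-∀)
open import Data.Product using (∃-syntax; _×_; _,_; proj₁; proj₂)
open import Data.Sum using (_⊎_; inj₁; inj₂)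
open import Data.Unit.Base using (tt)
open import Data.Vec.Base using (Vec; []; _∷_; toList; fromList)
import Data.Vec.Base as Vec
open import Data.Vec.Properties using (length-toList; toList∘fromList)
open import Data.Vec.Relation.Unary.Any using (Any; here; there)
open import Function.Base using (_∘_; _$_; case_of_; id)
open import Relation.Binary.PropositionalEquality
open import Relation.Nullary using (¬_; Dec; yes; no; does; contradiction)
open import Relation.Nullary.Decidable using (dec-true; dec-false)

open State

-- Word arithmetic

-- The budget is o(n/√log n). Each of the Θ(n/log n) patterns costs a constant number of queries,
-- which Q = o(√log n) makes affordable; reading and writing by whole words costs O(n/log n), and a
-- constant number of strings of length n is preprocessed. All this requires the two extensions of a
-- pattern to fill only O(1) words, so that a constant fraction of all patterns fits into n bits.
-- This is the obstacle. A binary alphabet has no extra letters, smaller and larger than all others,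
-- to close a pattern with. 0^N and 1^N can replace them only if N exceeds every run that follows an
-- occurrence, but a run of the text may have n bits. Hence runs are shortened, and by whole words,
-- so that this takes constant time per word. The difference of the two ranks in X C says nothing by
-- itself: C contains suffixes between the two extensions, such as P 0^N itself and those due to
-- other patterns that contain P. Counting them would be a dictionary problem again; the same
-- queries to the structure for Z C make them cancel.

mod-small : ∀ {x y} → x < y → x mod y ≡ x
mod-small {y = suc y} x<y = m<n⇒m%n≡m x<y

mod-< : ∀ x {y} → 0 < y → x mod y < y
mod-< x {suc y} _ = m%n<n x (suc y)

mod-+* : ∀ x z y → (x + z * y) mod y ≡ x mod y
mod-+* x z zero    = refl
mod-+* x z (suc y) = [m+kn]%n≡m%n x z (suc y)

2^>0 : ∀ w → 0 < 2 ^ w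
2^>0 w = m^n>0 2 w

n<2^n : ∀ n → n < 2 ^ n
n<2^n zero    = s≤s z≤n
n<2^n (suc n) = ≤-trans (+-mono-≤ (2^>0 n) (n<2^n n)) (≤-reflexive (cong (2 ^ n +_) (sym (+-identityʳ (2 ^ n)))))

bit<2 : ∀ b → bit b < 2
bit<2 true  = s≤s (s≤s z≤n)
bit<2 false = s≤s z≤n

≡ᵇ-refl : ∀ m → (m ≡ᵇ m) ≡ true
≡ᵇ-refl zero    = refl
≡ᵇ-refl (suc m) = ≡ᵇ-refl m

≢⇒≡ᵇ : ∀ {m n} → m ≢ n → (m ≡ᵇ n) ≡ false
≢⇒≡ᵇ {m} {n} m≢n with m ≡ᵇ n in e
... | false = refl
... | true  = contradiction (≡ᵇ⇒≡ m n (subst T (sym e) tt)) m≢n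

<⇒<ᵇ≡true : ∀ {m n} → m < n → (m <ᵇ n) ≡ true
<⇒<ᵇ≡true {m} {n} m<n with m <ᵇ n in e
... | true  = refl
... | false = ⊥-elim (subst T e (<⇒<ᵇ m<n))

≮⇒<ᵇ≡false : ∀ {m n} → ¬ m < n → (m <ᵇ n) ≡ false
≮⇒<ᵇ≡false {m} {n} m≮n with m <ᵇ n in e
... | false = refl
... | true  = contradiction (<ᵇ⇒< m n (subst T (sym e) tt)) m≮n

module _ {A : Set} {i : ℕ} {v : A} {f : ℕ → A} where

  update-≡ : update i v f i ≡ v
  update-≡ rewrite ≡ᵇ-refl i = refl

  update-≢ : ∀ {j} → j ≢ i → update i v f j ≡ f j
  update-≢ j≢i rewrite ≢⇒≡ᵇ j≢i = refl

module Arithmetic (w : ℕ) where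

  mod-+ : ∀ {X Y x y} → X ≡ x → Y ≡ y → x + y < 2 ^ w → (X + Y) mod (2 ^ w) ≡ x + y
  mod-+ refl refl = mod-small

  mod-* : ∀ {X Y x y} → X ≡ x → Y ≡ y → x * y < 2 ^ w → (X * Y) mod (2 ^ w) ≡ x * y
  mod-* refl refl = mod-small

  mod-∸ : ∀ {X Y x y} → X ≡ x → Y ≡ y → y ≤ x → x < 2 ^ w →
    (X + 2 ^ w ∸ Y) mod (2 ^ w) ≡ x ∸ y
  mod-∸ {x = x} {y} refl refl y≤x x<2^w = begin
    (x + 2 ^ w ∸ y) mod (2 ^ w) ≡⟨ cong (λ z → (z ∸ y) mod (2 ^ w)) (+-comm x (2 ^ w)) ⟩
    (2 ^ w + x ∸ y) mod (2 ^ w) ≡⟨ cong (_mod (2 ^ w)) (+-∸-assoc (2 ^ w) y≤x) ⟩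
    (2 ^ w + (x ∸ y)) mod (2 ^ w) ≡⟨ cong (_mod (2 ^ w)) (+-comm (2 ^ w) (x ∸ y)) ⟩
    ((x ∸ y) + 2 ^ w) mod (2 ^ w) ≡⟨ cong (λ z → ((x ∸ y) + z) mod (2 ^ w)) (sym (+-identityʳ (2 ^ w))) ⟩
    ((x ∸ y) + 1 * 2 ^ w) mod (2 ^ w) ≡⟨ mod-+* (x ∸ y) 1 (2 ^ w) ⟩
    (x ∸ y) mod (2 ^ w) ≡⟨ mod-small (≤-<-trans (m∸n≤m x y) x<2^w) ⟩
    x ∸ y ∎
    where open ≡-Reasoning

bit-≡ : ∀ {X Y} → X ≡ Y → bit (X ≡ᵇ Y) ≢ 0
bit-≡ {X} refl rewrite ≡ᵇ-refl X = λ ()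

bit-≢ : ∀ {X Y} → X ≢ Y → bit (X ≡ᵇ Y) ≡ 0
bit-≢ X≢Y rewrite ≢⇒≡ᵇ X≢Y = refl

bit-< : ∀ {X Y} → X < Y → bit (X <ᵇ Y) ≢ 0
bit-< X<Y rewrite <⇒<ᵇ≡true X<Y = λ ()

bit-≮ : ∀ {X Y} → ¬ X < Y → bit (X <ᵇ Y) ≡ 0
bit-≮ X≮Y rewrite ≮⇒<ᵇ≡false X≮Y = refl

-- Total correctness with a time bound

Exec : ℕ → Prog → State → ℕ → (State → Set) → Set
Exec w p σ T Post = ∃[ τ ] ∃[ t ] ∃[ s ] (Run w p σ τ t s × t ≤ T × Post τ)

module _ {w : ℕ} where

  exec-assign : ∀ {σ r e v} {Post : State → Set} → eval w σ e ≡ v →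
    Post (setReg r v σ) → Exec w (assign r e) σ (1 + cost e) Post
  exec-assign refl post = _ , _ , _ , assign , ≤-refl , post

  exec-store : ∀ {σ a d e i v} {Post : State → Set} → eval w σ d ≡ i → eval w σ e ≡ v →
    Post (setMem a i v σ) → Exec w (store a d e) σ (1 + cost d + cost e) Post
  exec-store refl refl post = _ , _ , _ , store , ≤-refl , post

  exec-skip : ∀ {σ} {Post : State → Set} → Post σ → Exec w skip σ 1 Post
  exec-skip post = _ , _ , _ , skip , ≤-refl , post

  exec-seq : ∀ {p q σ T₁ T₂} {Mid Post : State → Set} → Exec w p σ T₁ Mid →
    (∀ τ → Mid τ → Exec w q τ T₂ Post) → Exec w (p ⨟ q) σ (T₁ + T₂) Post
  exec-seq (τ , _ , _ , run , t≤ , mid) k with k τ mid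
  ... | υ , _ , _ , run′ , t′≤ , post = υ , _ , _ , seq run run′ , +-mono-≤ t≤ t′≤ , post

  exec-weaken : ∀ {p σ T T′} {Post Post′ : State → Set} → T ≤ T′ →
    (∀ τ → Post τ → Post′ τ) → Exec w p σ T Post → Exec w p σ T′ Post′
  exec-weaken T≤ f (τ , _ , _ , run , t≤ , post) = τ , _ , _ , run , ≤-trans t≤ T≤ , f τ post

  exec-≤ : ∀ {p σ T T′} {Post : State → Set} → T ≤ T′ → Exec w p σ T Post → Exec w p σ T′ Post
  exec-≤ T≤ = exec-weaken T≤ (λ _ h → h)

  exec-map : ∀ {p σ T} {Post Post′ : State → Set} → (∀ τ → Post τ → Post′ τ) → Exec w p σ T Post → Exec w p σ T Post′
  exec-map = exec-weaken ≤-refl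

  exec-cond-nonzero : ∀ {e p q σ T} {Post : State → Set} → eval w σ e ≢ 0 →
    Exec w p σ T Post → Exec w (cond e p q) σ (1 + cost e + T) Post
  exec-cond-nonzero {e} nz (τ , _ , _ , run , t≤ , post) =
    τ , _ , _ , cond-nonzero nz run , +-monoʳ-≤ (1 + cost e) t≤ , post

  exec-cond-zero : ∀ {e p q σ T} {Post : State → Set} → eval w σ e ≡ 0 →
    Exec w q σ T Post → Exec w (cond e p q) σ (1 + cost e + T) Post
  exec-cond-zero {e} z (τ , _ , _ , run , t≤ , post) =
    τ , _ , _ , cond-zero z run , +-monoʳ-≤ (1 + cost e) t≤ , post

  -- The intermediate assertion is that the rest of the program runs correctly from the state
  -- reached. Straight-line code is thus verified instruction by instruction, with nothing to be
  -- stated in between.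
  assigned : ∀ {r e q σ v T} {Post : State → Set} → eval w σ e ≡ v →
    Exec w q (setReg r v σ) T Post → Exec w (assign r e ⨟ q) σ (1 + cost e + T) Post
  assigned {q = q} {T = T} {Post} e≡v rest =
    exec-seq {Mid = λ τ → Exec w q τ T Post} (exec-assign e≡v rest) (λ _ x → x)

  stored : ∀ {a d e q σ i v T} {Post : State → Set} → eval w σ d ≡ i → eval w σ e ≡ v →
    Exec w q (setMem a i v σ) T Post → Exec w (store a d e ⨟ q) σ (1 + cost d + cost e + T) Post
  stored {q = q} {T = T} {Post} d≡i e≡v rest =
    exec-seq {Mid = λ τ → Exec w q τ T Post} (exec-store d≡i e≡v rest) (λ _ x → x)

increment : ℕ → Prog
increment r = assign r (op add (reg r) (const 1))

forUpTo : (counter end : ℕ) → Prog → Prog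
forUpTo i e body = while (op lt (reg i) (reg e)) (body ⨟ increment i)

module Loop {w : ℕ} (i e : ℕ) {b : ℕ} (b<2^w : b < 2 ^ w) (1<2^w : 1 < 2 ^ w)
  (body : Prog) (T : ℕ) (Inv : ℕ → State → Set)
  (counter : ∀ {j σ} → Inv j σ → regs σ i ≡ j)
  (end : ∀ {j σ} → Inv j σ → regs σ e ≡ b)
  where
  open Arithmetic w

  -- The summand 8 pays for the loop test and the increment, 4 each, and the last 4 for the test
  -- that fails. As `b` fits in a word, the counter never wraps around.
  exec-forUpTo : ∀ a {σ} → a ≤ b → Inv a σ →
    (∀ {j σ} → a ≤ j → j < b → Inv j σ →
      Exec w body σ T (λ τ → regs τ i ≡ j × Inv (suc j) (setReg i (suc j) τ))) →
    Exec w (forUpTo i e body) σ ((b ∸ a) * (T + 8) + 4) (Inv b)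
  exec-forUpTo a {σ} a≤b inv step = subst (λ z → Exec w (forUpTo i e body) σ ((b ∸ a) * (T + 8) + 4) (Inv z))
      (trans (+-comm (b ∸ a) a) (m+[n∸m]≡n a≤b))
      (go (b ∸ a) a ≤-refl (trans (+-comm (b ∸ a) a) (m+[n∸m]≡n a≤b)) inv)
    where
    go : ∀ d j → a ≤ j → d + j ≡ b → ∀ {σ} → Inv j σ →
      Exec w (forUpTo i e body) σ (d * (T + 8) + 4) (Inv (d + j))
    go zero j _ j≡b {σ} inv =
      σ , _ , _ , while-stop (bit-≮ (<-irrefl (trans (counter inv) (trans j≡b (sym (end inv))))))
      , ≤-refl , inv
    go (suc d) j a≤j d+j≡b {σ} inv with step a≤j j<b inv
      where j<b : j < b
            j<b = subst (suc j ≤_) d+j≡b (s≤s (m≤n+m j d))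
    ... | τ , t , s , run , t≤T , (τi , inv′)
      with go d (suc j) (m≤n⇒m≤1+n a≤j) (trans (+-suc d j) d+j≡b) inv′
    ... | υ , t′ , s′ , run′ , t′≤ , inv″ =
      υ , _ , _
      , while-step (bit-< (subst₂ _<_ (sym (counter inv)) (sym (end inv)) j<b))
          (seq run (subst (λ v → Run w (increment i) τ (setReg i v τ) 4 _) inc assign)) run′
      , time
      , subst (λ z → Inv z υ) (+-suc d j) inv″
      where
      j<b : j < b
      j<b = subst (suc j ≤_) d+j≡b (s≤s (m≤n+m j d))
      inc : eval w τ (op add (reg i) (const 1)) ≡ suc j
      inc = trans (mod-+ τi (mod-small 1<2^w) (subst (_< 2 ^ w) (+-comm 1 j) (≤-<-trans j<b b<2^w)))
                  (+-comm j 1)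
      time : 4 + (t + 4) + t′ ≤ suc d * (T + 8) + 4
      time = begin
        4 + (t + 4) + t′ ≤⟨ +-mono-≤ (+-monoʳ-≤ 4 (+-monoˡ-≤ 4 t≤T)) t′≤ ⟩
        4 + (T + 4) + (d * (T + 8) + 4) ≡⟨ sym (+-assoc (4 + (T + 4)) (d * (T + 8)) 4) ⟩
        4 + (T + 4) + d * (T + 8) + 4 ≡⟨ cong (λ z → z + d * (T + 8) + 4) (trans (+-comm 4 (T + 4)) (+-assoc T 4 4)) ⟩
        suc d * (T + 8) + 4 ∎
        where open ≤-Reasoning

-- Renaming the registers and arrays of a program

renameExpr : (ℕ → ℕ) → Expr → Expr
renameExpr ι (const v)  = const v
renameExpr ι (reg r)    = reg (ι r)
renameExpr ι (op o d e) = op o (renameExpr ι d) (renameExpr ι e)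
renameExpr ι (load a e) = load (ι a) (renameExpr ι e)

rename : (ℕ → ℕ) → Prog → Prog
rename ι skip          = skip
rename ι (assign r e)  = assign (ι r) (renameExpr ι e)
rename ι (store a d e) = store (ι a) (renameExpr ι d) (renameExpr ι e)
rename ι (p ⨟ q)       = rename ι p ⨟ rename ι q
rename ι (cond e p q)  = cond (renameExpr ι e) (rename ι p) (rename ι q)
rename ι (while e p)   = while (renameExpr ι e) (rename ι p)

-- `σ` is a state of the whole machine, and `τ` the state of one copy as if it ran alone. Agreement
-- is pointwise because states contain functions, whose pointwise agreement does not yield equality.
record Sim (ι : ℕ → ℕ) (σ τ : State) : Set where
  constructor _,_
  field
    regs-≡ : ∀ r → regs σ (ι r) ≡ regs τ r
    mem-≡  : ∀ a j → mem σ (ι a) j ≡ mem τ a j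

open Sim

infix 4 _≈_
_≈_ : State → State → Set
_≈_ = Sim id

Sim-≈ : ∀ {ι σ τ τ′} → Sim ι σ τ → τ ≈ τ′ → Sim ι σ τ′
Sim-≈ (p , q) (p′ , q′) = (λ r → trans (p r) (p′ r)) , (λ a j → trans (q a j) (q′ a j))

_∉_ : ℕ → (ℕ → ℕ) → Set
y ∉ ι = ∀ x → y ≢ ι x

record Frame (ι : ℕ → ℕ) (σ σ′ : State) : Set where
  constructor _,_
  field
    regs-frame : ∀ {y} → y ∉ ι → regs σ′ y ≡ regs σ y
    mem-frame  : ∀ {y} → y ∉ ι → ∀ j → mem σ′ y j ≡ mem σ y j

open Frame

Frame-refl : ∀ {ι σ} → Frame ι σ σ
Frame-refl = (λ _ → refl) , λ _ _ → refl

Frame-trans : ∀ {ι σ τ υ} → Frame ι σ τ → Frame ι τ υ → Frame ι σ υ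
Frame-trans (p , q) (p′ , q′) =
  (λ y∉ → trans (p′ y∉) (p y∉)) , λ y∉ j → trans (q′ y∉ j) (q y∉ j)

Sim-Frame : ∀ {ι ι′ σ σ′ τ} → (∀ x → ι x ∉ ι′) → Sim ι σ τ → Frame ι′ σ σ′ → Sim ι σ′ τ
Sim-Frame dis (p , q) (p′ , q′) = (λ r → trans (p′ (dis r)) (p r)) , λ a j → trans (q′ (dis a) j) (q a j)

Sim-setReg-∉ : ∀ {ι σ τ y v} → y ∉ ι → Sim ι σ τ → Sim ι (setReg y v σ) τ
Sim-setReg-∉ {σ = σ} y∉ (p , q) = (λ r → trans (update-≢ {f = regs σ} (λ e → y∉ r (sym e))) (p r)) , q

module _ {ι : ℕ → ℕ} (ι-injective : ∀ {x y} → ι x ≡ ι y → x ≡ y) where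

  ≡ᵇ-ι : ∀ x y → (ι x ≡ᵇ ι y) ≡ (x ≡ᵇ y)
  ≡ᵇ-ι x y with x ≟ y
  ... | yes refl = trans (≡ᵇ-refl (ι x)) (sym (≡ᵇ-refl x))
  ... | no x≢y   = trans (≢⇒≡ᵇ (x≢y ∘ ι-injective)) (sym (≢⇒≡ᵇ x≢y))

  Sim-setReg : ∀ {σ τ} r v → Sim ι σ τ → Sim ι (setReg (ι r) v σ) (setReg r v τ)
  Sim-setReg {σ} {τ} r v (p , q) = lem , q
    where
    lem : ∀ x → regs (setReg (ι r) v σ) (ι x) ≡ regs (setReg r v τ) x
    lem x rewrite ≡ᵇ-ι x r with x ≡ᵇ r
    ... | true  = refl
    ... | false = p x

  Sim-setMem : ∀ {σ τ} a i v → Sim ι σ τ → Sim ι (setMem (ι a) i v σ) (setMem a i v τ)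
  Sim-setMem {σ} {τ} a i v (p , q) = p , lem
    where
    lem : ∀ x j → mem (setMem (ι a) i v σ) (ι x) j ≡ mem (setMem a i v τ) x j
    lem x j rewrite ≡ᵇ-ι x a with x ≡ᵇ a
    ... | false = q x j
    ... | true with j ≡ᵇ i
    ...   | true  = refl
    ...   | false = q a j

  Frame-setReg : ∀ {σ} r v → Frame ι σ (setReg (ι r) v σ)
  Frame-setReg {σ} r v = (λ y∉ → update-≢ {f = regs σ} (y∉ r)) , λ _ _ → refl

  Frame-setMem : ∀ {σ} a i v → Frame ι σ (setMem (ι a) i v σ)
  Frame-setMem {σ} a i v = (λ _ → refl) , lem
    where
    lem : ∀ {y} → y ∉ ι → ∀ j → mem (setMem (ι a) i v σ) y j ≡ mem σ y j
    lem y∉ j rewrite ≢⇒≡ᵇ (y∉ a) = refl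

  module _ {w : ℕ} where

    cost-rename : ∀ e → cost (renameExpr ι e) ≡ cost e
    cost-rename (const v)  = refl
    cost-rename (reg r)    = refl
    cost-rename (op o d e) = cong₂ (λ x y → suc (x + y)) (cost-rename d) (cost-rename e)
    cost-rename (load a e) = cong suc (cost-rename e)

    eval-rename : ∀ {σ τ} e → Sim ι σ τ → eval w σ (renameExpr ι e) ≡ eval w τ e
    eval-rename (const v)  sim = refl
    eval-rename (reg r)    sim = regs-≡ sim r
    eval-rename (op o d e) sim = cong₂ (⟦ o ⟧ w) (eval-rename d sim) (eval-rename e sim)
    eval-rename {σ} (load a e) sim = trans (cong (mem σ (ι a)) (eval-rename e sim)) (mem-≡ sim a _)

    -- Only names change, not the addresses inside an array, so every step has a counterpart of
    -- equal cost. Injectivity keeps distinct names of the copy apart, and the frame is what lets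
    -- other copies survive the run.
    run-rename : ∀ {p τ τ′ t s σ} → Run w p τ τ′ t s → Sim ι σ τ →
      ∃[ σ′ ] ∃[ t′ ] ∃[ s′ ] (Run w (rename ι p) σ σ′ t′ s′ × t′ ≡ t × Sim ι σ′ τ′ × Frame ι σ σ′)
    run-rename skip sim = _ , _ , _ , skip , refl , sim , Frame-refl
    run-rename {τ = τ} {σ = σ} (assign {r = r} {e}) sim =
      _ , _ , _ , assign , cong suc (cost-rename e)
      , subst (λ v → Sim ι (setReg (ι r) v σ) (setReg r (eval w τ e) τ)) (sym (eval-rename e sim)) (Sim-setReg r (eval w τ e) sim)
      , Frame-setReg r _
    run-rename {τ = τ} {σ = σ} (store {a = a} {d} {e}) sim =
      _ , _ , _ , store , cong₂ (λ x y → suc (x + y)) (cost-rename d) (cost-rename e)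
      , subst₂ (λ i v → Sim ι (setMem (ι a) i v σ) (setMem a (eval w τ d) (eval w τ e) τ)) (sym (eval-rename d sim)) (sym (eval-rename e sim)) (Sim-setMem a (eval w τ d) (eval w τ e) sim)
      , Frame-setMem a _ _
    run-rename (seq r₁ r₂) sim with run-rename r₁ sim
    ... | _ , _ , _ , r₁′ , refl , sim₁ , f₁ with run-rename r₂ sim₁
    ... | _ , _ , _ , r₂′ , refl , sim₂ , f₂ = _ , _ , _ , seq r₁′ r₂′ , refl , sim₂ , Frame-trans f₁ f₂
    run-rename (cond-nonzero {e = e} nz r) sim with run-rename r sim
    ... | _ , _ , _ , r′ , refl , sim′ , f =
      _ , _ , _ , cond-nonzero (nz ∘ trans (sym (eval-rename e sim))) r′ , cong (λ x → suc (x + _)) (cost-rename e) , sim′ , f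
    run-rename (cond-zero {e = e} z r) sim with run-rename r sim
    ... | _ , _ , _ , r′ , refl , sim′ , f =
      _ , _ , _ , cond-zero (trans (eval-rename e sim) z) r′ , cong (λ x → suc (x + _)) (cost-rename e) , sim′ , f
    run-rename (while-stop {e = e} z) sim =
      _ , _ , _ , while-stop (trans (eval-rename e sim) z) , cong suc (cost-rename e) , sim , Frame-refl
    run-rename (while-step {e = e} nz r₁ r₂) sim with run-rename r₁ sim
    ... | _ , _ , _ , r₁′ , refl , sim₁ , f₁ with run-rename r₂ sim₁
    ... | _ , _ , _ , r₂′ , refl , sim₂ , f₂ =
      _ , _ , _ , while-step (nz ∘ trans (sym (eval-rename e sim))) r₁′ r₂′
      , cong (λ x → suc (x + _ + _)) (cost-rename e) , sim₂ , Frame-trans f₁ f₂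

-- Bit strings as words

fromBits-++ : ∀ xs ys → fromBits (xs ++ ys) ≡ fromBits xs + 2 ^ length xs * fromBits ys
fromBits-++ []       ys = sym (*-identityˡ (fromBits ys))
fromBits-++ (x ∷ xs) ys = begin
  bit x + 2 * fromBits (xs ++ ys) ≡⟨ cong (λ z → bit x + 2 * z) (fromBits-++ xs ys) ⟩
  bit x + 2 * (fromBits xs + 2 ^ length xs * fromBits ys) ≡⟨ cong (bit x +_) (*-distribˡ-+ 2 (fromBits xs) _) ⟩
  bit x + (2 * fromBits xs + 2 * (2 ^ length xs * fromBits ys)) ≡⟨ sym (+-assoc (bit x) _ _) ⟩
  bit x + 2 * fromBits xs + 2 * (2 ^ length xs * fromBits ys) ≡⟨ cong (bit x + 2 * fromBits xs +_) (sym (*-assoc 2 (2 ^ length xs) _)) ⟩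
  bit x + 2 * fromBits xs + 2 ^ length (x ∷ xs) * fromBits ys ∎
  where open ≡-Reasoning

fromBits-< : ∀ xs → fromBits xs < 2 ^ length xs
fromBits-< []       = s≤s z≤n
fromBits-< (x ∷ xs) = begin
  suc (bit x + 2 * fromBits xs) ≤⟨ +-monoˡ-≤ (2 * fromBits xs) (bit<2 x) ⟩
  2 + 2 * fromBits xs ≡⟨ sym (*-suc 2 (fromBits xs)) ⟩
  2 * suc (fromBits xs) ≤⟨ *-monoʳ-≤ 2 (fromBits-< xs) ⟩
  2 * 2 ^ length xs ∎
  where open ≤-Reasoning

fromBits-injective : ∀ xs ys → length xs ≡ length ys → fromBits xs ≡ fromBits ys → xs ≡ ys
fromBits-injective []           []           _ _ = refl
fromBits-injective (true ∷ xs)  (true ∷ ys)  l e =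
  cong (true ∷_) (fromBits-injective xs ys (suc-injective l) (*-cancelˡ-≡ _ _ 2 (suc-injective e)))
fromBits-injective (false ∷ xs) (false ∷ ys) l e =
  cong (false ∷_) (fromBits-injective xs ys (suc-injective l) (*-cancelˡ-≡ _ _ 2 e))
fromBits-injective (true ∷ xs)  (false ∷ ys) l e = contradiction (sym e) (even≢odd (fromBits ys) (fromBits xs))
fromBits-injective (false ∷ xs) (true ∷ ys)  l e = contradiction e (even≢odd (fromBits xs) (fromBits ys))

fromBits-false : ∀ n → fromBits (replicate n false) ≡ 0
fromBits-false zero    = refl
fromBits-false (suc n) = cong (2 *_) (fromBits-false n)

fromBits-true : ∀ n → fromBits (replicate n true) ≡ 2 ^ n ∸ 1
fromBits-true n = cong (_∸ 1) (lem n)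
  where
  lem : ∀ n → suc (fromBits (replicate n true)) ≡ 2 ^ n
  lem zero    = refl
  lem (suc n) = trans (sym (*-suc 2 (fromBits (replicate n true)))) (cong (2 *_) (lem n))

replicate-+ : ∀ {A : Set} a b (x : A) → replicate (a + b) x ≡ replicate a x ++ replicate b x
replicate-+ zero    b x = refl
replicate-+ (suc a) b x = cong (x ∷_) (replicate-+ a b x)

drop-++ : ∀ {A : Set} o (xs ys : List A) → drop (length xs + o) (xs ++ ys) ≡ drop o ys
drop-++ o []       ys = refl
drop-++ o (x ∷ xs) ys = drop-++ o xs ys

drop-++ˡ : ∀ {A : Set} o (xs ys : List A) → o ≤ length xs → drop o (xs ++ ys) ≡ drop o xs ++ ys
drop-++ˡ zero    xs       ys _       = refl
drop-++ˡ (suc o) (x ∷ xs) ys (s≤s h) = drop-++ˡ o xs ys h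

take-++ˡ : ∀ {A : Set} m (xs ys : List A) → m ≤ length xs → take m (xs ++ ys) ≡ take m xs
take-++ˡ zero    xs       ys _       = refl
take-++ˡ (suc m) (x ∷ xs) ys (s≤s h) = cong (x ∷_) (take-++ˡ m xs ys h)

take-length-++ : ∀ {A : Set} (xs ys : List A) → take (length xs) (xs ++ ys) ≡ xs
take-length-++ []       ys = refl
take-length-++ (x ∷ xs) ys = cong (x ∷_) (take-length-++ xs ys)

drop-length-++ : ∀ {A : Set} (xs ys : List A) → drop (length xs) (xs ++ ys) ≡ ys
drop-length-++ []       ys = refl
drop-length-++ (x ∷ xs) ys = drop-length-++ xs ys

-- Segments of infinite bit sequences

seg : (ℕ → Bool) → ℕ → ℕ → List Bool
seg f i zero    = []
seg f i (suc l) = f i ∷ seg f (suc i) l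

length-seg : ∀ f i l → length (seg f i l) ≡ l
length-seg f i zero    = refl
length-seg f i (suc l) = cong suc (length-seg f (suc i) l)

seg-+ : ∀ f i a b → seg f i (a + b) ≡ seg f i a ++ seg f (i + a) b
seg-+ f i zero    b = cong (λ z → seg f z b) (sym (+-identityʳ i))
seg-+ f i (suc a) b = cong (f i ∷_) (trans (seg-+ f (suc i) a b)
  (cong (λ z → seg f (suc i) a ++ seg f z b) (sym (+-suc i a))))

take-drop-seg : ∀ f i l o m → o + m ≤ l → take m (drop o (seg f i l)) ≡ seg f (i + o) m
take-drop-seg f i l o m h = begin
  take m (drop o (seg f i l)) ≡⟨ cong (λ z → take m (drop o (seg f i z))) (sym (m+[n∸m]≡n h)) ⟩
  take m (drop o (seg f i (o + m + z))) ≡⟨ cong (λ v → take m (drop o (seg f i v))) (+-assoc o m z) ⟩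
  take m (drop o (seg f i (o + (m + z)))) ≡⟨ cong (take m ∘ drop o) (seg-+ f i o (m + z)) ⟩
  take m (drop o (seg f i o ++ seg f (i + o) (m + z))) ≡⟨ cong (λ v → take m (drop v (seg f i o ++ seg f (i + o) (m + z)))) (sym (length-seg f i o)) ⟩
  take m (drop (length (seg f i o)) (seg f i o ++ seg f (i + o) (m + z))) ≡⟨ cong (take m) (drop-length-++ (seg f i o) _) ⟩
  take m (seg f (i + o) (m + z)) ≡⟨ cong (take m) (seg-+ f (i + o) m z) ⟩
  take m (seg f (i + o) m ++ rest) ≡⟨ cong (λ v → take v (seg f (i + o) m ++ rest)) (sym (length-seg f (i + o) m)) ⟩
  take (length (seg f (i + o) m)) (seg f (i + o) m ++ rest) ≡⟨ take-length-++ (seg f (i + o) m) rest ⟩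
  seg f (i + o) m ∎
  where
  open ≡-Reasoning
  z = l ∸ (o + m)
  rest = seg f (i + o + m) z

bitAt : List Bool → ℕ → Bool
bitAt []       i       = false
bitAt (x ∷ xs) zero    = x
bitAt (x ∷ xs) (suc i) = bitAt xs i

seg-bitAt-∷ : ∀ x xs i l → seg (bitAt (x ∷ xs)) (suc i) l ≡ seg (bitAt xs) i l
seg-bitAt-∷ x xs i zero    = refl
seg-bitAt-∷ x xs i (suc l) = cong (bitAt xs i ∷_) (seg-bitAt-∷ x xs (suc i) l)

seg-bitAt-[] : ∀ i l → seg (bitAt []) i l ≡ replicate l false
seg-bitAt-[] i zero    = refl
seg-bitAt-[] i (suc l) = cong (false ∷_) (seg-bitAt-[] (suc i) l)

seg-bitAt : ∀ S i l → i + l ≤ length S → seg (bitAt S) i l ≡ take l (drop i S)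
seg-bitAt S        i       zero    _       = refl
seg-bitAt (x ∷ xs) zero    (suc l) (s≤s h) = cong (x ∷_) (trans (seg-bitAt-∷ x xs 0 l) (seg-bitAt xs 0 l h))
seg-bitAt (x ∷ xs) (suc i) (suc l) (s≤s h) = trans (seg-bitAt-∷ x xs i (suc l)) (seg-bitAt xs i (suc l) h)
seg-bitAt []       (suc i) (suc l) ()

seg-bitAt-all : ∀ S → seg (bitAt S) 0 (length S) ≡ S
seg-bitAt-all S = trans (seg-bitAt S 0 (length S) ≤-refl) (trans (cong (take (length S)) (sym (++-identityʳ S))) (take-length-++ S []))

seg-bitAt-past : ∀ S i l → length S ≤ i → seg (bitAt S) i l ≡ replicate l false
seg-bitAt-past []       i       l _       = seg-bitAt-[] i l
seg-bitAt-past (x ∷ xs) (suc i) l (s≤s h) = trans (seg-bitAt-∷ x xs i l) (seg-bitAt-past xs i l h)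

fromBits-take-drop : ∀ S i l → fromBits (take l (drop i S)) ≡ fromBits (seg (bitAt S) i l)
fromBits-take-drop S        i       zero    = refl
fromBits-take-drop []       i       (suc l) rewrite drop-[] {A = Bool} i | seg-bitAt-[] (suc i) l = cong (2 *_) (sym (fromBits-false l))
fromBits-take-drop (x ∷ xs) zero    (suc l) rewrite seg-bitAt-∷ x xs 0 l = cong (λ z → bit x + 2 * z) (fromBits-take-drop xs 0 l)
fromBits-take-drop (x ∷ xs) (suc i) (suc l) rewrite seg-bitAt-∷ x xs (suc i) l = fromBits-take-drop xs i (suc l)

div-+* : ∀ x b {y} → x < y → (x + y * b) div y ≡ b
div-+* x b {suc y} x<y = begin
  (x + suc y * b) / suc y ≡⟨ +-distrib-/ x (suc y * b) (subst (_< suc y) (sym (cong₂ _+_ (m<n⇒m%n≡m x<y) mult)) (subst (_< suc y) (sym (+-identityʳ x)) x<y)) ⟩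
  x / suc y + (suc y * b) / suc y ≡⟨ cong₂ _+_ (m<n⇒m/n≡0 x<y) (trans (cong (_/ suc y) (*-comm (suc y) b)) (m*n/n≡m b (suc y))) ⟩
  b ∎
  where
  open ≡-Reasoning
  mult : (suc y * b) % suc y ≡ 0
  mult = trans (cong (_% suc y) (*-comm (suc y) b)) (m*n%n≡0 b (suc y))

*-mod-2^ : ∀ c e r d → c < 2 ^ r → ((c + 2 ^ r * e) * 2 ^ d) mod (2 ^ (r + d)) ≡ 2 ^ d * c
*-mod-2^ c e r d c<2^r = begin
  ((c + 2 ^ r * e) * 2 ^ d) mod P ≡⟨ cong (_mod P) expand ⟩
  (2 ^ d * c + e * P) mod P ≡⟨ mod-+* (2 ^ d * c) e P ⟩
  (2 ^ d * c) mod P ≡⟨ mod-small (subst₂ _<_ (*-comm c (2 ^ d)) (sym (^-distribˡ-+-* 2 r d)) (*-monoˡ-< (2 ^ d) {{>-nonZero (2^>0 d)}} c<2^r)) ⟩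
  2 ^ d * c ∎
  where
  open ≡-Reasoning
  P = 2 ^ (r + d)
  expand : (c + 2 ^ r * e) * 2 ^ d ≡ 2 ^ d * c + e * P
  expand = begin
    (c + 2 ^ r * e) * 2 ^ d ≡⟨ *-distribʳ-+ (2 ^ d) c (2 ^ r * e) ⟩
    c * 2 ^ d + 2 ^ r * e * 2 ^ d ≡⟨ cong₂ _+_ (*-comm c (2 ^ d)) (trans (cong (_* 2 ^ d) (*-comm (2 ^ r) e)) (*-assoc e (2 ^ r) (2 ^ d))) ⟩
    2 ^ d * c + e * (2 ^ r * 2 ^ d) ≡⟨ cong (λ z → 2 ^ d * c + e * z) (sym (^-distribˡ-+-* 2 r d)) ⟩
    2 ^ d * c + e * P ∎

-- The right shift leaves the upper `W ∸ r` bits of one word, and the left shift moves the lower `r`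
-- bits of the next word above them. The two parts occupy disjoint bits, so their sum is their
-- concatenation. For `r = 0` the left shift by `W` leaves nothing.
fromBits-seg-shift : ∀ f i W r → r ≤ W →
  fromBits (seg f i W) div (2 ^ r) + (fromBits (seg f (i + W) W) * 2 ^ (W ∸ r)) mod (2 ^ W)
    ≡ fromBits (seg f (i + r) W)
fromBits-seg-shift f i W r r≤W = subst Claim (m+[n∸m]≡n r≤W) claim
  where
  d = W ∸ r
  Claim : ℕ → Set
  Claim V = fromBits (seg f i V) div (2 ^ r) + (fromBits (seg f (i + V) V) * 2 ^ d) mod (2 ^ V)
    ≡ fromBits (seg f (i + r) V)
  A = seg f i r
  B = seg f (i + r) d
  C = seg f (i + (r + d)) r
  D = seg f (i + (r + d) + r) d
  split : ∀ j → fromBits (seg f j (r + d)) ≡ fromBits (seg f j r) + 2 ^ r * fromBits (seg f (j + r) d)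
  split j = trans (cong fromBits (seg-+ f j r d))
    (trans (fromBits-++ (seg f j r) _) (cong (λ z → fromBits (seg f j r) + 2 ^ z * fromBits (seg f (j + r) d)) (length-seg f j r)))
  small : ∀ j → fromBits (seg f j r) < 2 ^ r
  small j = subst (λ z → fromBits (seg f j r) < 2 ^ z) (length-seg f j r) (fromBits-< (seg f j r))
  claim : Claim (r + d)
  claim = begin
    fromBits (seg f i (r + d)) div (2 ^ r) + (fromBits (seg f (i + (r + d)) (r + d)) * 2 ^ d) mod (2 ^ (r + d))
      ≡⟨ cong₂ (λ x y → x div (2 ^ r) + (y * 2 ^ d) mod (2 ^ (r + d))) (split i) (split (i + (r + d))) ⟩
    (fromBits A + 2 ^ r * fromBits B) div (2 ^ r) + ((fromBits C + 2 ^ r * fromBits D) * 2 ^ d) mod (2 ^ (r + d))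
      ≡⟨ cong₂ _+_ (div-+* (fromBits A) (fromBits B) (small i)) (*-mod-2^ (fromBits C) (fromBits D) r d (small (i + (r + d)))) ⟩
    fromBits B + 2 ^ d * fromBits C
      ≡⟨ cong (λ z → fromBits B + 2 ^ z * fromBits C) (sym (length-seg f (i + r) d)) ⟩
    fromBits B + 2 ^ length B * fromBits C
      ≡⟨ sym (fromBits-++ B C) ⟩
    fromBits (B ++ C)
      ≡⟨ cong (λ z → fromBits (B ++ seg f z r)) (sym (+-assoc i r d)) ⟩
    fromBits (B ++ seg f (i + r + d) r)
      ≡⟨ cong fromBits (sym (seg-+ f (i + r) d r)) ⟩
    fromBits (seg f (i + r) (d + r))
      ≡⟨ cong (λ z → fromBits (seg f (i + r) z)) (+-comm d r) ⟩
    fromBits (seg f (i + r) (r + d)) ∎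
    where open ≡-Reasoning

fromBits-seg-fill : ∀ P s ℓ W b → length P ≡ s + ℓ → ℓ ≤ W →
  fromBits (seg (bitAt P) s W) + (fromBits (replicate W b) * 2 ^ ℓ) mod (2 ^ W)
    ≡ fromBits (seg (bitAt P) s ℓ ++ replicate (W ∸ ℓ) b)
fromBits-seg-fill P s ℓ W b len ℓ≤W = subst Claim (m∸n+n≡m ℓ≤W) claim
  where
  d = W ∸ ℓ
  g = bitAt P
  A = seg g s ℓ
  Claim : ℕ → Set
  Claim V = fromBits (seg g s V) + (fromBits (replicate V b) * 2 ^ ℓ) mod (2 ^ V) ≡ fromBits (A ++ replicate d b)
  open ≡-Reasoning
  first : fromBits (seg g s (d + ℓ)) ≡ fromBits A
  first = begin
    fromBits (seg g s (d + ℓ)) ≡⟨ cong (λ z → fromBits (seg g s z)) (+-comm d ℓ) ⟩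
    fromBits (seg g s (ℓ + d)) ≡⟨ cong fromBits (seg-+ g s ℓ d) ⟩
    fromBits (A ++ seg g (s + ℓ) d) ≡⟨ cong (λ z → fromBits (A ++ z)) (seg-bitAt-past P (s + ℓ) d (≤-reflexive len)) ⟩
    fromBits (A ++ replicate d false) ≡⟨ fromBits-++ A _ ⟩
    fromBits A + 2 ^ length A * fromBits (replicate d false) ≡⟨ cong (λ z → fromBits A + 2 ^ length A * z) (fromBits-false d) ⟩
    fromBits A + 2 ^ length A * 0 ≡⟨ cong (fromBits A +_) (*-zeroʳ (2 ^ length A)) ⟩
    fromBits A + 0 ≡⟨ +-identityʳ _ ⟩
    fromBits A ∎
  b<2^ : fromBits (replicate d b) < 2 ^ d
  b<2^ = subst (λ z → fromBits (replicate d b) < 2 ^ z) (length-replicate d) (fromBits-< (replicate d b))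
  second : (fromBits (replicate (d + ℓ) b) * 2 ^ ℓ) mod (2 ^ (d + ℓ)) ≡ 2 ^ ℓ * fromBits (replicate d b)
  second = begin
    (fromBits (replicate (d + ℓ) b) * 2 ^ ℓ) mod (2 ^ (d + ℓ))
      ≡⟨ cong (λ z → (fromBits z * 2 ^ ℓ) mod (2 ^ (d + ℓ))) (replicate-+ d ℓ b) ⟩
    (fromBits (replicate d b ++ replicate ℓ b) * 2 ^ ℓ) mod (2 ^ (d + ℓ))
      ≡⟨ cong (λ z → (z * 2 ^ ℓ) mod (2 ^ (d + ℓ))) (trans (fromBits-++ (replicate d b) _) (cong (λ z → fromBits (replicate d b) + 2 ^ z * fromBits (replicate ℓ b)) (length-replicate d))) ⟩
    ((fromBits (replicate d b) + 2 ^ d * fromBits (replicate ℓ b)) * 2 ^ ℓ) mod (2 ^ (d + ℓ))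
      ≡⟨ *-mod-2^ (fromBits (replicate d b)) (fromBits (replicate ℓ b)) d ℓ b<2^ ⟩
    2 ^ ℓ * fromBits (replicate d b) ∎
  claim : Claim (d + ℓ)
  claim = begin
    fromBits (seg g s (d + ℓ)) + (fromBits (replicate (d + ℓ) b) * 2 ^ ℓ) mod (2 ^ (d + ℓ))
      ≡⟨ cong₂ _+_ first second ⟩
    fromBits A + 2 ^ ℓ * fromBits (replicate d b)
      ≡⟨ cong (λ z → fromBits A + 2 ^ z * fromBits (replicate d b)) (sym (length-seg g s ℓ)) ⟩
    fromBits A + 2 ^ length A * fromBits (replicate d b)
      ≡⟨ sym (fromBits-++ A _) ⟩
    fromBits (A ++ replicate d b) ∎

-- Packed strings

padded-applyUpTo-< : ∀ (g : ℕ → ℕ) {n i} → i < n → padded (applyUpTo g n) i ≡ g i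
padded-applyUpTo-< g {suc n} {zero}  _       = refl
padded-applyUpTo-< g {suc n} {suc i} (s≤s h) = padded-applyUpTo-< (g ∘ suc) h

padded-≥ : ∀ xs {i} → length xs ≤ i → padded xs i ≡ 0
padded-≥ []       _       = refl
padded-≥ (x ∷ xs) (s≤s h) = padded-≥ xs h

packedLength-≥ : ∀ W l → 1 ≤ W → l ≤ packedLength W l * W
packedLength-≥ (suc w) l _ = +-cancelˡ-≤ w l _ (s≤s⁻¹ (begin
  suc (w + l) ≡⟨ cong suc (+-comm w l) ⟩
  suc (l + w) ≡⟨ cong suc (m≡m%n+[m/n]*n (l + w) (suc w)) ⟩
  suc ((l + w) % suc w + q * suc w) ≤⟨ +-monoˡ-≤ (q * suc w) (m%n<n (l + w) (suc w)) ⟩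
  suc w + q * suc w ∎))
  where
  open ≤-Reasoning
  q = (l + w) / suc w

length-packed : ∀ W S → length (packed W S) ≡ packedLength W (length S)
length-packed W S = trans (length-map _ (upTo (packedLength W (length S)))) (length-upTo _)

padded-packed : ∀ W S i → 1 ≤ W → padded (packed W S) i ≡ fromBits (take W (drop (i * W) S))
padded-packed W S i 1≤W with i <? packedLength W (length S)
... | yes i<L = trans (cong (λ z → padded z i) (map-upTo g L)) (padded-applyUpTo-< g i<L)
  where
  g = λ i → fromBits (take W (drop (i * W) S))
  L = packedLength W (length S)
... | no i≮L = trans (padded-≥ (packed W S) (subst (_≤ i) (sym (length-packed W S)) (≮⇒≥ i≮L)))
    (sym (trans (cong (λ z → fromBits (take W z)) (drop-all (i * W) S
      (≤-trans (packedLength-≥ W (length S) 1≤W) (*-monoˡ-≤ W (≮⇒≥ i≮L)))))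
        (cong fromBits (take-[] W))))

padded-packed-seg : ∀ W S i → 1 ≤ W → padded (packed W S) i ≡ fromBits (seg (bitAt S) (i * W) W)
padded-packed-seg W S i 1≤W = trans (padded-packed W S i 1≤W) (fromBits-take-drop S (i * W) W)

padded-∷ʳ : ∀ xs v j → padded (xs ∷ʳ v) j ≡ update (length xs) v (padded xs) j
padded-∷ʳ []       v zero    = refl
padded-∷ʳ []       v (suc j) = refl
padded-∷ʳ (x ∷ xs) v zero    = refl
padded-∷ʳ (x ∷ xs) v (suc j) = padded-∷ʳ xs v j

padded-++ˡ : ∀ xs ys {i} → i < length xs → padded (xs ++ ys) i ≡ padded xs i
padded-++ˡ (x ∷ xs) ys {zero}  _       = refl
padded-++ˡ (x ∷ xs) ys {suc i} (s≤s h) = padded-++ˡ xs ys h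

padded-++ʳ : ∀ xs ys i → padded (xs ++ ys) (length xs + i) ≡ padded ys i
padded-++ʳ []       ys i = refl
padded-++ʳ (x ∷ xs) ys i = padded-++ʳ xs ys i

nth : {A : Set} → A → List A → ℕ → A
nth d []       i       = d
nth d (x ∷ xs) zero    = x
nth d (x ∷ xs) (suc i) = nth d xs i

padded-concatMap : ∀ {A : Set} (g : A → List ℕ) R (d : A) → (∀ x → length (g x) ≡ R) →
  ∀ xs i t → i < length xs → t < R → padded (concatMap g xs) (i * R + t) ≡ padded (g (nth d xs i)) t
padded-concatMap g R d len (x ∷ xs) zero    t _       t<R = padded-++ˡ (g x) _ (subst (t <_) (sym (len x)) t<R)
padded-concatMap g R d len (x ∷ xs) (suc i) t (s≤s h) t<R = begin
  padded (g x ++ concatMap g xs) (R + i * R + t) ≡⟨ cong (padded (g x ++ concatMap g xs)) (trans (+-assoc R (i * R) t) (cong (_+ (i * R + t)) (sym (len x)))) ⟩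
  padded (g x ++ concatMap g xs) (length (g x) + (i * R + t)) ≡⟨ padded-++ʳ (g x) _ (i * R + t) ⟩
  padded (concatMap g xs) (i * R + t) ≡⟨ padded-concatMap g R d len xs i t h t<R ⟩
  padded (g (nth d xs i)) t ∎
  where open ≡-Reasoning

-- Concatenations of blocks of length W

Blocks : ℕ → List (List Bool) → Set
Blocks W = All (λ b → length b ≡ W)

length-concat-Blocks : ∀ {W bs} → Blocks W bs → length (concat bs) ≡ length bs * W
length-concat-Blocks []                        = refl
length-concat-Blocks {bs = b ∷ bs} (l ∷ ls) = trans (length-++ b) (cong₂ _+_ l (length-concat-Blocks ls))

take-drop-replicate : ∀ l i z → fromBits (take l (drop i (replicate z false))) ≡ 0
take-drop-replicate zero    i       z       = refl
take-drop-replicate (suc l) i       zero    = cong fromBits (cong (take (suc l)) (drop-[] i))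
take-drop-replicate (suc l) zero    (suc z) = cong (2 *_) (take-drop-replicate l zero z)
take-drop-replicate (suc l) (suc i) (suc z) = take-drop-replicate (suc l) i z

-- Memory behind the written words is 0, so any number `z` of zero bits may be regarded as part of
-- the string. This extends a string of whole words to length exactly `n`, which need not be a
-- multiple of `W`.
padded-Blocks : ∀ {W bs} → Blocks W bs → ∀ i z →
  padded (map fromBits bs) i ≡ fromBits (take W (drop (i * W) (concat bs ++ replicate z false)))
padded-Blocks {W} [] i z = sym (take-drop-replicate W (i * W) z)
padded-Blocks {bs = b ∷ bs} (refl ∷ ls) zero z = cong fromBits (sym (begin
  take (length b) ((b ++ concat bs) ++ replicate z false) ≡⟨ cong (take (length b)) (++-assoc b (concat bs) _) ⟩
  take (length b) (b ++ concat bs ++ replicate z false) ≡⟨ take-length-++ b _ ⟩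
  b ∎))
  where open ≡-Reasoning
padded-Blocks {bs = b ∷ bs} (refl ∷ ls) (suc i) z = trans (padded-Blocks ls i z) (cong (fromBits ∘ take (length b)) (sym (begin
  drop (length b + i * length b) ((b ++ concat bs) ++ replicate z false) ≡⟨ cong (drop (length b + i * length b)) (++-assoc b (concat bs) _) ⟩
  drop (length b + i * length b) (b ++ concat bs ++ replicate z false) ≡⟨ drop-++ (i * length b) b _ ⟩
  drop (i * length b) (concat bs ++ replicate z false) ∎)))
  where open ≡-Reasoning

-- Ranks

-- The continuation `C` is a separate argument so that suffixes starting in it are left out: their
-- share of a rank does not depend on `U` and cancels when two choices of `U` are compared.
below : List Bool → List Bool → List Bool → ℕ
below []      C v = 0
below (x ∷ U) C v = bit (does (((x ∷ U) ++ C) <lex? v)) + below U C v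

below-++ : ∀ U C v → below (U ++ C) [] v ≡ below U C v + below C [] v
below-++ []      C v = refl
below-++ (x ∷ U) C v = begin
  bit (does (((x ∷ U ++ C) ++ []) <lex? v)) + below (U ++ C) [] v
    ≡⟨ cong₂ (λ z y → bit (does (z <lex? v)) + y) (++-identityʳ (x ∷ U ++ C)) (below-++ U C v) ⟩
  bit (does ((x ∷ U ++ C) <lex? v)) + (below U C v + below C [] v)
    ≡⟨ sym (+-assoc (bit (does ((x ∷ U ++ C) <lex? v))) (below U C v) (below C [] v)) ⟩
  bit (does ((x ∷ U ++ C) <lex? v)) + below U C v + below C [] v ∎
  where open ≡-Reasoning

SA⁻¹-below : ∀ S j → SA⁻¹ S j ≡ suc (below S [] (suffix S j))
SA⁻¹-below S j = cong suc (trans (cong (λ z → length (filter P? z)) (map-upTo suc (length S)))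
    (lem S suc (λ i → refl)))
  where
  v = suffix S j
  P? = λ i → suffix S i <lex? v
  lem : ∀ R g → (∀ i → suffix S (g i) ≡ drop i R) → length (filter P? (applyUpTo g (length R))) ≡ below R [] v
  lem []      g h = refl
  lem (x ∷ R) g h with suffix S (g 0) <lex? v
  ... | yes p = cong₂ (λ z y → bit z + y)
          (sym (dec-true ((x ∷ R ++ []) <lex? v) (subst (_<lex v) (trans (h 0) (sym (++-identityʳ (x ∷ R)))) p)))
          (lem R (g ∘ suc) (h ∘ suc))
  ... | no ¬p = cong₂ (λ z y → bit z + y)
          (sym (dec-false ((x ∷ R ++ []) <lex? v) (λ q → ¬p (subst (_<lex v) (sym (trans (h 0) (sym (++-identityʳ (x ∷ R))))) q))))
          (lem R (g ∘ suc) (h ∘ suc))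

<lex-trans : ∀ {x y z} → x <lex y → y <lex z → x <lex z
<lex-trans = <-transitive isEquivalence ((λ { refl p → p }) , (λ { refl p → p })) Bool.<-trans

Between : (U C lo hi : List Bool) → Set
Between U C lo hi = ∃[ o ] (o < length U × ¬ (drop o (U ++ C) <lex lo) × drop o (U ++ C) <lex hi)

module _ {lo hi : List Bool} (lo<hi : lo <lex hi) (C : List Bool) where

  below-mono : ∀ U → below U C lo ≤ below U C hi
  below-mono []      = z≤n
  below-mono (x ∷ U) with ((x ∷ U) ++ C) <lex? lo | ((x ∷ U) ++ C) <lex? hi
  ... | yes p | yes _ = s≤s (below-mono U)
  ... | yes p | no ¬q = contradiction (<lex-trans p lo<hi) ¬q
  ... | no _  | yes _ = m≤n⇒m≤1+n (below-mono U)
  ... | no _  | no _  = below-mono U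

  below-< : ∀ U → Between U C lo hi → below U C lo < below U C hi
  below-< (x ∷ U) (zero , _ , ¬p , q)
    rewrite dec-false (((x ∷ U) ++ C) <lex? lo) ¬p | dec-true (((x ∷ U) ++ C) <lex? hi) q = s≤s (below-mono U)
  below-< (x ∷ U) (suc o , s≤s o< , b) with ((x ∷ U) ++ C) <lex? lo | ((x ∷ U) ++ C) <lex? hi
  ... | yes p | yes _ = s≤s (below-< U (o , o< , b))
  ... | yes p | no ¬q = contradiction (<lex-trans p lo<hi) ¬q
  ... | no _  | yes _ = m≤n⇒m≤1+n (below-< U (o , o< , b))
  ... | no _  | no _  = below-< U (o , o< , b)

  below-<⁻¹ : ∀ U → below U C lo < below U C hi → Between U C lo hi
  below-<⁻¹ (x ∷ U) h with ((x ∷ U) ++ C) <lex? lo | ((x ∷ U) ++ C) <lex? hi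
  ... | no ¬p | yes q = 0 , s≤s z≤n , ¬p , q
  ... | yes p | no ¬q = contradiction (<lex-trans p lo<hi) ¬q
  below-<⁻¹ (x ∷ U) (s≤s h) | yes _ | yes _ with below-<⁻¹ U h
  ... | o , o< , b = suc o , s≤s o< , b
  below-<⁻¹ (x ∷ U) h | no _ | no _ with below-<⁻¹ U h
  ... | o , o< , b = suc o , s≤s o< , b

-- Suffixes between two extensions of a pattern

data Breaks (b : Bool) : ℕ → List Bool → Set where
  stop : ∀ {n v} → Breaks b (suc n) (not b ∷ v)
  go   : ∀ {n v} → Breaks b n v → Breaks b (suc n) (b ∷ v)

-- The strings that begin with `P` form an interval of the lexicographic order, and both bounds
-- belong to it.
between-prefix : ∀ P {a c} v → ¬ (v <lex (P ++ a)) → v <lex (P ++ c) → take (length P) v ≡ P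
between-prefix []      v       ¬p q           = refl
between-prefix (x ∷ P) []      ¬p q           = contradiction halt ¬p
between-prefix (x ∷ P) (y ∷ v) ¬p (this y<x)  = contradiction (this y<x) ¬p
between-prefix (x ∷ P) (x ∷ v) ¬p (next refl q) = cong (x ∷_) (between-prefix P v (¬p ∘ next refl) q)

<lex-++⁺ : ∀ P {v w} → v <lex w → (P ++ v) <lex (P ++ w)
<lex-++⁺ []      h = h
<lex-++⁺ (x ∷ P) h = next refl (<lex-++⁺ P h)

<lex-++⁻ : ∀ P {v w} → (P ++ v) <lex (P ++ w) → v <lex w
<lex-++⁻ []          h               = h
<lex-++⁻ (true ∷ P)  (this ())
<lex-++⁻ (false ∷ P) (this ())
<lex-++⁻ (x ∷ P)     (next _ h)      = <lex-++⁻ P h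

-- The first bit of `v` that differs from `false` stands opposite to one of the `N` zeros and
-- decides the comparison there; what follows on either side is irrelevant. The next lemma is the
-- mirror image.
Breaks-false : ∀ {N v a} → Breaks false N v → ¬ (v <lex (replicate N false ++ a))
Breaks-false stop   (this ())
Breaks-false stop   (next () _)
Breaks-false (go b) (this ())
Breaks-false (go b) (next _ h) = Breaks-false b h

Breaks-true : ∀ {N v a} → Breaks true N v → v <lex (replicate N true ++ a)
Breaks-true stop   = this Bool.f<t
Breaks-true (go b) = next refl (Breaks-true b)

Breaks-mono : ∀ {b n v} k → Breaks b n v → Breaks b (n + k) v
Breaks-mono k stop   = stop
Breaks-mono k (go h) = go (Breaks-mono k h)

Breaks-++ : ∀ {b n v} B → Breaks b n v → Breaks b (length B + n) (B ++ v)
Breaks-++ []      h = h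
Breaks-++ {b} (x ∷ B) h with x Bool.≟ b
... | yes refl = go (Breaks-++ B h)
... | no x≢b   = subst (λ y → Breaks b _ (y ∷ _)) (sym (¬-not x≢b)) stop

Breaks-block : ∀ {b v} B → B ≢ replicate (length B) b → Breaks b (length B) (B ++ v)
Breaks-block []      h = contradiction refl h
Breaks-block {b} (x ∷ B) h with x Bool.≟ b
... | yes refl = go (Breaks-block B (h ∘ cong (b ∷_)))
... | no x≢b   = subst (λ y → Breaks b _ (y ∷ _)) (sym (¬-not x≢b)) stop

Occurs : List Bool → List Bool → List Bool → Set
Occurs P U C = ∃[ o ] (o < length U × take (length P) (drop o (U ++ C)) ≡ P)

module _ (P : List Bool) {N : ℕ} (1≤N : 1 ≤ N) (a c C : List Bool) where

  private
    lo = P ++ replicate N false ++ a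
    hi = P ++ replicate N true ++ c

    lo<hi : lo <lex hi
    lo<hi = <lex-++⁺ P (lem 1≤N)
      where
      lem : ∀ {N} → 1 ≤ N → (replicate N false ++ a) <lex (replicate N true ++ c)
      lem (s≤s _) = this Bool.f<t

  -- On the side of `Z` the count can only grow from `lo` to `hi`. If it grows more on the side of
  -- `U`, it grows there at all, and the suffix responsible begins with `P`.
  below-sound : ∀ U Z → below Z C hi + below U C lo < below U C hi + below Z C lo → Occurs P U C
  below-sound U Z h with below-<⁻¹ lo<hi C U (+-cancelˡ-< (below Z C lo) _ _
      (≤-<-trans (+-monoˡ-≤ (below U C lo) (below-mono lo<hi C Z)) (subst (below Z C hi + below U C lo <_) (+-comm (below U C hi) (below Z C lo)) h)))
  ... | o , o< , ¬p , q = o , o< , between-prefix P (drop o (U ++ C)) ¬p q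

  -- An occurrence followed by both bits within `N` positions lies above `P 0^N` and below `P 1^N`,
  -- so the count of `U` grows strictly. The count of `Z` is constant, since any growth would
  -- exhibit an occurrence in `Z`.
  below-complete : ∀ U Z o → o < length U → take (length P) (drop o (U ++ C)) ≡ P →
    (∀ b → Breaks b N (drop (o + length P) (U ++ C))) → ¬ Occurs P Z C →
    below Z C hi + below U C lo < below U C hi + below Z C lo
  below-complete U Z o o< pre br ¬occ = subst (below Z C hi + below U C lo <_) (+-comm (below Z C lo) (below U C hi))
      (+-mono-≤-< noneZ (below-< lo<hi C U (o , o< , (λ h → Breaks-false (br false) (<lex-++⁻ P (subst (_<lex lo) eq′ h)))
        , subst (_<lex hi) (sym eq′) (<lex-++⁺ P (Breaks-true (br true))))))
    where
    noneZ : below Z C hi ≤ below Z C lo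
    noneZ = ≮⇒≥ λ h → case below-<⁻¹ lo<hi C Z h of λ where
      (o′ , o′< , ¬p , q) → ¬occ (o′ , o′< , between-prefix P _ ¬p q)
    eq′ : drop o (U ++ C) ≡ P ++ drop (o + length P) (U ++ C)
    eq′ = trans (sym (take++drop≡id (length P) (drop o (U ++ C)))) (cong₂ _++_ pre (drop-drop o (length P) (U ++ C)))

-- Shortening runs of equal blocks

take-drop-local : ∀ m o (A B B′ : List Bool) → o + m ≤ length A →
  take m (drop o (A ++ B)) ≡ take m (drop o (A ++ B′))
take-drop-local m o A B B′ h = trans (lem B) (sym (lem B′))
  where
  lem : ∀ B → take m (drop o (A ++ B)) ≡ take m (drop o A)
  lem B = trans (cong (take m) (drop-++ˡ o A B (≤-trans (m≤m+n o m) h)))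
    (take-++ˡ m (drop o A) B (subst (m ≤_) (sym (length-drop o A)) (m+n≤o⇒m≤o∸n m (subst (_≤ length A) (+-comm o m) h))))

++-assoc₃ : ∀ (A B C D : List Bool) → (A ++ B ++ C) ++ D ≡ (A ++ B) ++ C ++ D
++-assoc₃ A B C D = trans (cong (_++ D) (sym (++-assoc A B C))) (++-assoc (A ++ B) C D)

-- An occurrence of P that starts before the end of E ++ D lies within E ++ run, and since run
-- commutes with D, any later one can be moved by the length of D.
module _ (P E run D B C : List Bool) (comm : run ++ D ≡ D ++ run) (long : length P + length D ≤ length run) where

  private
    m = length P

    front : ∀ {o} → o < length E + length D → o + m ≤ length (E ++ run)
    front {o} h = begin
      o + m ≤⟨ +-monoˡ-≤ m (<⇒≤ h) ⟩
      length E + length D + m ≡⟨ +-assoc (length E) (length D) m ⟩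
      length E + (length D + m) ≡⟨ cong (length E +_) (+-comm (length D) m) ⟩
      length E + (m + length D) ≤⟨ +-monoʳ-≤ (length E) long ⟩
      length E + length run ≡⟨ sym (length-++ E) ⟩
      length (E ++ run) ∎
      where open ≤-Reasoning

    split₁ : (E ++ run ++ D ++ B) ++ C ≡ (E ++ run) ++ (D ++ B) ++ C
    split₁ = ++-assoc₃ E run (D ++ B) C
    split₂ : (E ++ run ++ B) ++ C ≡ (E ++ run) ++ B ++ C
    split₂ = ++-assoc₃ E run B C

    moved : (E ++ run ++ D ++ B) ++ C ≡ E ++ D ++ run ++ B ++ C
    moved = begin
      (E ++ run ++ D ++ B) ++ C ≡⟨ ++-assoc E (run ++ D ++ B) C ⟩
      E ++ (run ++ D ++ B) ++ C ≡⟨ cong (λ z → E ++ z ++ C) (sym (++-assoc run D B)) ⟩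
      E ++ ((run ++ D) ++ B) ++ C ≡⟨ cong (λ z → E ++ (z ++ B) ++ C) comm ⟩
      E ++ ((D ++ run) ++ B) ++ C ≡⟨ cong (E ++_) (++-assoc (D ++ run) B C) ⟩
      E ++ (D ++ run) ++ B ++ C ≡⟨ cong (E ++_) (++-assoc D run (B ++ C)) ⟩
      E ++ D ++ run ++ B ++ C ∎
      where open ≡-Reasoning

    kept : (E ++ run ++ B) ++ C ≡ E ++ run ++ B ++ C
    kept = trans (++-assoc E (run ++ B) C) (cong (E ++_) (++-assoc run B C))

    len₁ : length (E ++ run ++ D ++ B) ≡ length E + (length D + (length run + length B))
    len₁ = trans (length-++ E) (cong (length E +_) (begin
      length (run ++ D ++ B) ≡⟨ cong length (sym (++-assoc run D B)) ⟩
      length ((run ++ D) ++ B) ≡⟨ cong (λ z → length (z ++ B)) comm ⟩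
      length ((D ++ run) ++ B) ≡⟨ cong length (++-assoc D run B) ⟩
      length (D ++ run ++ B) ≡⟨ trans (length-++ D) (cong (length D +_) (length-++ run)) ⟩
      length D + (length run + length B) ∎))
      where open ≡-Reasoning

    len₂ : length (E ++ run ++ B) ≡ length E + (length run + length B)
    len₂ = trans (length-++ E) (cong (length E +_) (length-++ run))

    drop₁ : ∀ o → drop (length E + (length D + o)) ((E ++ run ++ D ++ B) ++ C) ≡ drop o (run ++ B ++ C)
    drop₁ o = trans (cong (drop (length E + (length D + o))) moved) (trans (drop-++ (length D + o) E _) (drop-++ o D _))

    drop₂ : ∀ o → drop (length E + o) ((E ++ run ++ B) ++ C) ≡ drop o (run ++ B ++ C)
    drop₂ o = trans (cong (drop (length E + o)) kept) (drop-++ o E _)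

    same : ∀ {o} → o < length E + length D →
      take m (drop o ((E ++ run ++ D ++ B) ++ C)) ≡ take m (drop o ((E ++ run ++ B) ++ C))
    same {o} h = trans (cong (take m ∘ drop o) split₁)
      (trans (take-drop-local m o (E ++ run) _ _ (front h)) (cong (take m ∘ drop o) (sym split₂)))

  Occurs-shorten : Occurs P (E ++ run ++ D ++ B) C → Occurs P (E ++ run ++ B) C
  Occurs-shorten (o , o< , occ) with o <? length E + length D
  ... | yes h = o , subst (o <_) (sym len₂) (<-≤-trans h (+-monoʳ-≤ (length E)
                  (≤-trans (m≤n+m (length D) m) (≤-trans long (m≤m+n (length run) (length B))))))
              , trans (sym (same h)) occ
  ... | no ¬h with m≤n⇒∃[o]m+o≡n (≮⇒≥ ¬h)
  ... | o′ , refl = length E + o′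
      , subst (length E + o′ <_) (sym len₂) (+-monoʳ-< (length E) (+-cancelˡ-< (length D) _ _ (+-cancelˡ-< (length E) _ _ (subst₂ _<_ (+-assoc (length E) (length D) o′) len₁ o<))))
      , trans (cong (take m) (trans (drop₂ o′) (sym (trans (cong (λ z → drop z ((E ++ run ++ D ++ B) ++ C)) (+-assoc (length E) (length D) o′)) (drop₁ o′))))) occ

  Occurs-lengthen : Occurs P (E ++ run ++ B) C → Occurs P (E ++ run ++ D ++ B) C
  Occurs-lengthen (o , o< , occ) with o <? length E
  ... | yes h = o , subst (o <_) (sym len₁) (<-≤-trans h (m≤m+n (length E) _))
              , trans (same (<-≤-trans h (m≤m+n (length E) (length D)))) occ
  ... | no ¬h with m≤n⇒∃[o]m+o≡n (≮⇒≥ ¬h)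
  ... | o′ , refl = length E + (length D + o′)
      , subst (length E + (length D + o′) <_) (sym len₁) (+-monoʳ-< (length E) (+-monoʳ-< (length D) (+-cancelˡ-< (length E) _ _ (subst (length E + o′ <_) len₂ o<))))
      , trans (cong (take m) (trans (drop₁ o′) (sym (drop₂ o′)))) occ

nextCount : ℕ → List Bool → List Bool → ℕ
nextCount cnt prev y = if fromBits y ≡ᵇ fromBits prev then suc cnt else 1

-- keeps at most K consecutive copies of a block; cnt copies of prev precede
dedupe : ℕ → List Bool → ℕ → List (List Bool) → List (List Bool)
dedupe K prev cnt []       = []
dedupe K prev cnt (y ∷ ys) = if K <ᵇ nextCount cnt prev y
  then dedupe K y (nextCount cnt prev y) ys
  else y ∷ dedupe K y (nextCount cnt prev y) ys

replicate-∷ʳ : ∀ {A : Set} n (x : A) → replicate n x ∷ʳ x ≡ replicate (suc n) x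
replicate-∷ʳ zero    x = refl
replicate-∷ʳ (suc n) x = cong (x ∷_) (replicate-∷ʳ n x)

-- The machine compares words as numbers; on blocks of one common length this is equality of blocks.
-- The three cases of the recursion are isolated because two unrelated invariants, on occurrences
-- and on runs, are proved along it.
module DedupeInduction {W R : ℕ} (Q : List Bool → ℕ → List (List Bool) → List (List Bool) → Set)
  (nil : ∀ prev cnt → Q prev cnt [] [])
  (skip-block : ∀ {prev cnt ys out} → suc R ≤ cnt → length prev ≡ W → Q prev (suc cnt) ys out → Q prev cnt (prev ∷ ys) out)
  (same-block : ∀ {prev cnt ys out} → cnt ≤ R → Q prev (suc cnt) ys out → Q prev cnt (prev ∷ ys) (prev ∷ out))
  (new-block  : ∀ {prev cnt y ys out} → y ≢ prev → Q y 1 ys out → Q prev cnt (y ∷ ys) (y ∷ out))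
  where

  dedupe-ind : ∀ ys prev cnt → Blocks W ys → length prev ≡ W → Q prev cnt ys (dedupe (suc R) prev cnt ys)
  dedupe-ind [] prev cnt _ _ = nil prev cnt
  dedupe-ind (y ∷ ys) prev cnt (ly ∷ lys) lp with fromBits y ≡ᵇ fromBits prev in e
  ... | false = new-block (λ { refl → case trans (sym e) (≡ᵇ-refl (fromBits y)) of λ () }) (dedupe-ind ys y 1 lys ly)
  ... | true with fromBits-injective y prev (trans ly (sym lp)) (≡ᵇ⇒≡ _ _ (subst T (sym e) tt))
  ... | refl with R <ᵇ cnt in e′
  ...   | true  = skip-block (<ᵇ⇒< R cnt (subst T (sym e′) tt)) ly (dedupe-ind ys y (suc cnt) lys ly)
  ...   | false = same-block (≮⇒≥ λ h → case trans (sym e′) (<⇒<ᵇ≡true h) of λ ()) (dedupe-ind ys y (suc cnt) lys ly)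

length-concat-replicate : ∀ n (B : List Bool) → length (concat (replicate n B)) ≡ n * length B
length-concat-replicate zero    B = refl
length-concat-replicate (suc n) B = trans (length-++ B) (cong (length B +_) (length-concat-replicate n B))

concat-∷ʳ : ∀ (xs : List (List Bool)) x → concat (xs ∷ʳ x) ≡ concat xs ++ x
concat-∷ʳ xs x = trans (sym (concat-++ xs (x ∷ []))) (cong (concat xs ++_) (++-identityʳ x))

infix 2 _⇔_
_⇔_ : Set → Set → Set
A ⇔ B = (A → B) × (B → A)

module _ (W R : ℕ) (P C : List Bool) (short : length P ≤ R * W) where

  private
    -- `acc` is the output so far. It ends with at most `suc R` copies of `prev`, although `cnt`
    -- also counts deleted ones, hence the minimum. A run of `suc R` words is as long as the
    -- shortening step demands: `R` words for the pattern and one for the deleted word. With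
    -- `cnt = 0` nothing is claimed about the initial `prev`.
    Q : List Bool → ℕ → List (List Bool) → List (List Bool) → Set
    Q prev cnt ys out = ∀ E {acc} → acc ≡ E ++ replicate (cnt ⊓ suc R) prev →
      Occurs P (concat (acc ++ ys)) C ⇔ Occurs P (concat (acc ++ out)) C

    skip-block : ∀ {prev cnt ys out} → suc R ≤ cnt → length prev ≡ W → Q prev (suc cnt) ys out → Q prev cnt (prev ∷ ys) out
    skip-block {prev} {cnt} {ys} {out} R<cnt l ih E {acc} tail = (λ h → proj₁ ih′ (to h)) , (λ h → from (proj₂ ih′ h))
      where
      run = replicate (suc R) prev
      acc≡ : acc ≡ E ++ run
      acc≡ = trans tail (cong (λ z → E ++ replicate z prev) (m≥n⇒m⊓n≡n R<cnt))
      ih′ = ih E {acc} (trans acc≡ (cong (λ z → E ++ replicate z prev) (sym (m≥n⇒m⊓n≡n (m≤n⇒m≤1+n R<cnt)))))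
      concat₃ : ∀ zs → concat (acc ++ zs) ≡ concat E ++ concat run ++ concat zs
      concat₃ zs = begin
        concat (acc ++ zs) ≡⟨ cong (λ z → concat (z ++ zs)) acc≡ ⟩
        concat ((E ++ run) ++ zs) ≡⟨ cong concat (++-assoc E run zs) ⟩
        concat (E ++ run ++ zs) ≡⟨ sym (concat-++ E (run ++ zs)) ⟩
        concat E ++ concat (run ++ zs) ≡⟨ cong (concat E ++_) (sym (concat-++ run zs)) ⟩
        concat E ++ concat run ++ concat zs ∎
        where open ≡-Reasoning
      comm : concat run ++ prev ≡ prev ++ concat run
      comm = trans (sym (concat-∷ʳ run prev)) (cong concat (replicate-∷ʳ (suc R) prev))
      long : length P + length prev ≤ length (concat run)
      long = subst₂ _≤_ (cong (length P +_) (sym l)) (sym (length-concat-replicate (suc R) prev))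
        (subst (λ z → length P + W ≤ suc R * z) (sym l) (subst (length P + W ≤_) (+-comm (R * W) W) (+-monoˡ-≤ W short)))
      to : Occurs P (concat (acc ++ prev ∷ ys)) C → Occurs P (concat (acc ++ ys)) C
      to h = subst (λ z → Occurs P z C) (sym (concat₃ ys))
        (Occurs-shorten P (concat E) (concat run) prev (concat ys) C comm long (subst (λ z → Occurs P z C) (concat₃ (prev ∷ ys)) h))
      from : Occurs P (concat (acc ++ ys)) C → Occurs P (concat (acc ++ prev ∷ ys)) C
      from h = subst (λ z → Occurs P z C) (sym (concat₃ (prev ∷ ys)))
        (Occurs-lengthen P (concat E) (concat run) prev (concat ys) C comm long (subst (λ z → Occurs P z C) (concat₃ ys) h))

    move : ∀ acc y ys out →
      (Occurs P (concat ((acc ∷ʳ y) ++ ys)) C ⇔ Occurs P (concat ((acc ∷ʳ y) ++ out)) C) →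
      Occurs P (concat (acc ++ y ∷ ys)) C ⇔ Occurs P (concat (acc ++ y ∷ out)) C
    move acc y ys out = subst₂ (λ a b → Occurs P (concat a) C ⇔ Occurs P (concat b) C) (∷ʳ-++ acc y ys) (∷ʳ-++ acc y out)

    same-block : ∀ {prev cnt ys out} → cnt ≤ R → Q prev (suc cnt) ys out → Q prev cnt (prev ∷ ys) (prev ∷ out)
    same-block {prev} {cnt} {ys} {out} cnt≤R ih E {acc} tail = move acc prev ys out (ih E (begin
      acc ∷ʳ prev ≡⟨ cong (_∷ʳ prev) tail ⟩
      (E ++ replicate (cnt ⊓ suc R) prev) ∷ʳ prev ≡⟨ ++-assoc E _ _ ⟩
      E ++ (replicate (cnt ⊓ suc R) prev ∷ʳ prev) ≡⟨ cong (E ++_) (replicate-∷ʳ (cnt ⊓ suc R) prev) ⟩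
      E ++ replicate (suc (cnt ⊓ suc R)) prev ≡⟨ cong (λ z → E ++ replicate (suc z) prev) (trans (m≤n⇒m⊓n≡m (m≤n⇒m≤1+n cnt≤R)) (sym (m≤n⇒m⊓n≡m cnt≤R))) ⟩
      E ++ replicate (suc cnt ⊓ suc R) prev ∎))
      where open ≡-Reasoning

    new-block : ∀ {prev cnt y ys out} → y ≢ prev → Q y 1 ys out → Q prev cnt (y ∷ ys) (y ∷ out)
    new-block {y = y} {ys} {out} _ ih E {acc} tail = move acc y ys out (ih acc refl)

  Occurs-dedupe : ∀ ys prev → Blocks W ys → length prev ≡ W →
    Occurs P (concat ys) C ⇔ Occurs P (concat (dedupe (suc R) prev 0 ys)) C
  Occurs-dedupe ys prev bs l =
    DedupeInduction.dedupe-ind Q (λ _ _ _ _ → (λ h → h) , (λ h → h)) (λ {a b c d} → skip-block {a} {b} {c} {d}) (λ {a b c d} → same-block {a} {b} {c} {d}) (λ {a b c d e} → new-block {a} {b} {c} {d} {e}) ys prev 0 bs l [] refl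

data Broken (W : ℕ) (b : Bool) : ℕ → List (List Bool) → Set where
  stop : ∀ {n B bs} → B ≢ replicate W b → Broken W b (suc n) (B ∷ bs)
  go   : ∀ {n B bs} → Broken W b n bs → Broken W b (suc n) (B ∷ bs)

module _ {W : ℕ} {b : Bool} where

  Broken-mono : ∀ {m n bs} → m ≤ n → Broken W b m bs → Broken W b n bs
  Broken-mono (s≤s m≤n) (stop h) = stop h
  Broken-mono (s≤s m≤n) (go h)   = go (Broken-mono m≤n h)

  Broken-++ : ∀ {n bs} A → Broken W b n bs → Broken W b (length A + n) (A ++ bs)
  Broken-++ []      h = h
  Broken-++ (_ ∷ A) h = go (Broken-++ A h)

  Broken⇒Breaks : ∀ {n bs V} → Blocks W bs → Broken W b n bs → Breaks b (n * W) (concat bs ++ V)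
  Broken⇒Breaks {suc n} {B ∷ bs} {V} (refl ∷ _)  (stop h) = Breaks-mono (n * W)
    (subst (Breaks b W) (sym (++-assoc B (concat bs) V)) (Breaks-block B h))
  Broken⇒Breaks {suc n} {B ∷ bs} {V} (refl ∷ ls) (go h)   =
    subst (Breaks b (W + n * W)) (sym (++-assoc B (concat bs) V)) (Breaks-++ B (Broken⇒Breaks ls h))

  -- From a position inside a block at most `W` bits remain up to the next boundary, and the `n`
  -- blocks after that boundary contain a break; `suc n` blocks cover both.
  Breaks-drop : ∀ {n V} bs S p → Blocks W bs → S ≤ length bs → (∀ s → s ≤ S → Broken W b n (drop s bs)) → p ≤ S * W →
    Breaks b (suc n * W) (drop p (concat bs ++ V))
  Breaks-drop {n} {V} bs S zero ls S≤ br _ = subst (λ z → Breaks b z (concat bs ++ V)) (+-comm (n * W) W)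
    (Breaks-mono W (Broken⇒Breaks ls (br 0 z≤n)))
  Breaks-drop {n} {V} (B ∷ bs) (suc S) p@(suc _) (refl ∷ ls) (s≤s S≤) br p≤ with p ≤? W
  ... | yes p≤W = subst (Breaks b (W + n * W)) (sym (trans (cong (drop p) (++-assoc B (concat bs) V)) (drop-++ˡ p B _ p≤W)))
        (Breaks-shorter (subst (_≤ W) (sym (length-drop p B)) (m∸n≤m W p))
          (Breaks-++ (drop p B) (Broken⇒Breaks ls (br 1 (s≤s z≤n)))))
    where
    Breaks-shorter : ∀ {l v} → l ≤ W → Breaks b (l + n * W) v → Breaks b (W + n * W) v
    Breaks-shorter {l} {v} l≤W h = subst (λ z → Breaks b z v) (begin
        l + n * W + (W ∸ l) ≡⟨ +-assoc l (n * W) (W ∸ l) ⟩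
        l + (n * W + (W ∸ l)) ≡⟨ cong (l +_) (+-comm (n * W) (W ∸ l)) ⟩
        l + ((W ∸ l) + n * W) ≡⟨ sym (+-assoc l (W ∸ l) (n * W)) ⟩
        l + (W ∸ l) + n * W ≡⟨ cong (_+ n * W) (m+[n∸m]≡n l≤W) ⟩
        W + n * W ∎) (Breaks-mono (W ∸ l) h)
      where open ≡-Reasoning
  ... | no p≰W with m≤n⇒∃[o]m+o≡n (<⇒≤ (≰⇒> p≰W))
  ... | p′ , W+p′≡p = subst (Breaks b (W + n * W)) (sym (begin
        drop p ((B ++ concat bs) ++ V) ≡⟨ cong₂ drop (sym W+p′≡p) (++-assoc B (concat bs) V) ⟩
        drop (W + p′) (B ++ concat bs ++ V) ≡⟨ drop-++ p′ B _ ⟩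
        drop p′ (concat bs ++ V) ∎))
      (Breaks-drop bs S p′ ls S≤ (λ s s≤ → br (suc s) (s≤s s≤)) (+-cancelˡ-≤ W _ _ (subst (_≤ W + S * W) (sym W+p′≡p) p≤)))
    where open ≡-Reasoning

  module _ (R : ℕ) {n : ℕ} {V : List (List Bool)} (brV : Broken W b (suc n) V) where

    private
      blk = replicate W b

      -- While `prev` is the block of `b`, only `suc R ∸ cnt` further copies can be kept, so the
      -- break is that much nearer. This second half drives the induction for the first, which
      -- allows every offset `s` in the output.
      Q : List Bool → ℕ → List (List Bool) → List (List Bool) → Set
      Q prev cnt ys out = (∀ s → Broken W b (suc R + suc n) (drop s out ++ V))
        × (prev ≡ blk → Broken W b ((suc R ∸ cnt) + suc n) (out ++ V))

      nil : ∀ prev cnt → Q prev cnt [] []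
      nil prev cnt = (λ s → subst (λ z → Broken W b (suc R + suc n) (z ++ V)) (sym (drop-[] s)) (Broken-mono (m≤n+m (suc n) (suc R)) brV))
        , λ _ → Broken-mono (m≤n+m (suc n) (suc R ∸ cnt)) brV

      skip-block : ∀ {prev cnt ys out} → suc R ≤ cnt → length prev ≡ W → Q prev (suc cnt) ys out → Q prev cnt (prev ∷ ys) out
      skip-block {cnt = cnt} {out = out} h _ (p , q) = p , λ e → Broken-mono (+-monoˡ-≤ (suc n) (∸-monoʳ-≤ (suc R) (n≤1+n cnt))) (q e)

      same-block : ∀ {prev cnt ys out} → cnt ≤ R → Q prev (suc cnt) ys out → Q prev cnt (prev ∷ ys) (prev ∷ out)
      same-block {prev} {cnt} {ys} {out} cnt≤R (p , q) = first , second
        where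
        second : prev ≡ blk → Broken W b ((suc R ∸ cnt) + suc n) (prev ∷ out ++ V)
        second e = subst (λ z → Broken W b (z + suc n) (prev ∷ out ++ V)) (sym (+-∸-assoc 1 cnt≤R)) (go (q e))
        first : ∀ s → Broken W b (suc R + suc n) (drop s (prev ∷ out) ++ V)
        first (suc s) = p s
        first zero with ≡-dec Bool._≟_ prev blk
        ... | yes e = Broken-mono (+-monoˡ-≤ (suc n) (m∸n≤m (suc R) cnt)) (second e)
        ... | no e  = stop e

      new-block : ∀ {prev cnt y ys out} → y ≢ prev → Q y 1 ys out → Q prev cnt (y ∷ ys) (y ∷ out)
      new-block {prev} {cnt} {y} {ys} {out} y≢prev (p , q) = first
        , λ { refl → subst (λ z → Broken W b z (y ∷ out ++ V)) (sym (+-suc (suc R ∸ cnt) n)) (stop y≢prev) }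
        where
        first : ∀ s → Broken W b (suc R + suc n) (drop s (y ∷ out) ++ V)
        first (suc s) = p s
        first zero with ≡-dec Bool._≟_ y blk
        ... | yes e = go (q e)
        ... | no e  = stop e

    Broken-dedupe : ∀ ys prev → Blocks W ys → length prev ≡ W → ∀ s →
      Broken W b (suc R + suc n) (drop s (dedupe (suc R) prev 0 ys) ++ V)
    Broken-dedupe ys prev bs l = proj₁ (DedupeInduction.dedupe-ind Q nil (λ {a b c d} → skip-block {a} {b} {c} {d}) (λ {a b c d} → same-block {a} {b} {c} {d}) (λ {a b c d e} → new-block {a} {b} {c} {d} {e}) ys prev 0 bs l)

-- Ranks in two strings with a common end

SA⁻¹-++ : ∀ U C o → SA⁻¹ (U ++ C) (suc (length U + o)) ≡ suc (below U C (drop o C) + below C [] (drop o C))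
SA⁻¹-++ U C o = trans (SA⁻¹-below (U ++ C) (suc (length U + o))) (cong suc (trans (cong (below (U ++ C) []) (drop-++ o U C)) (below-++ U C _)))

module _ (U Z C : List Bool) (lengths : length Z ≡ length U) (l h : ℕ) where

  private
    loU = SA⁻¹ (U ++ C) (suc (length U + l))
    hiU = SA⁻¹ (U ++ C) (suc (length U + h))
    loZ = SA⁻¹ (Z ++ C) (suc (length U + l))
    hiZ = SA⁻¹ (Z ++ C) (suc (length U + h))
    lo = drop l C
    hi = drop h C
    -- The part common to both sides of the test: 2 because ranks start from 1, and the shares of
    -- the suffixes that start in `C`. The test adds across instead of subtracting, so no truncation
    -- can occur.
    k = 2 + below C [] lo + below C [] hi

    regroup : ∀ a b c d → suc (a + b) + suc (c + d) ≡ (a + c) + (2 + d + b)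
    regroup = solve-∀

    SAZ : ∀ o → SA⁻¹ (Z ++ C) (suc (length U + o)) ≡ suc (below Z C (drop o C) + below C [] (drop o C))
    SAZ o = trans (cong (λ z → SA⁻¹ (Z ++ C) (suc (z + o))) (sym lengths)) (SA⁻¹-++ Z C o)

    left : hiZ + loU ≡ (below Z C hi + below U C lo) + k
    left = trans (cong₂ _+_ (SAZ h) (SA⁻¹-++ U C l)) (regroup (below Z C hi) _ (below U C lo) _)

    right : hiU + loZ ≡ (below U C hi + below Z C lo) + k
    right = trans (cong₂ _+_ (SA⁻¹-++ U C h) (SAZ l)) (regroup (below U C hi) _ (below Z C lo) _)

  rank-test⁻ : hiZ + loU < hiU + loZ → below Z C hi + below U C lo < below U C hi + below Z C lo
  rank-test⁻ t = +-cancelʳ-< k _ _ (subst₂ _<_ left right t)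

  rank-test⁺ : below Z C hi + below U C lo < below U C hi + below Z C lo → hiZ + loU < hiU + loZ
  rank-test⁺ t = subst₂ _<_ (sym left) (sym right) (+-monoˡ-< k t)

Blocks-++ : ∀ {W as bs} → Blocks W as → Blocks W bs → Blocks W (as ++ bs)
Blocks-++ []       q = q
Blocks-++ (l ∷ ls) q = l ∷ Blocks-++ ls q

Blocks-dedupe : ∀ {W} K prev cnt ys → Blocks W ys → Blocks W (dedupe K prev cnt ys)
Blocks-dedupe K prev cnt []       []       = []
Blocks-dedupe K prev cnt (y ∷ ys) (l ∷ ls) with K <ᵇ nextCount cnt prev y
... | true  = Blocks-dedupe K y _ ys ls
... | false = l ∷ Blocks-dedupe K y _ ys ls

length-dedupe : ∀ K prev cnt ys → length (dedupe K prev cnt ys) ≤ length ys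
length-dedupe K prev cnt []       = z≤n
length-dedupe K prev cnt (y ∷ ys) with K <ᵇ nextCount cnt prev y
... | true  = m≤n⇒m≤1+n (length-dedupe K y _ ys)
... | false = s≤s (length-dedupe K y _ ys)

-- Detecting the occurrences that start in a chunk

module Matching (W R : ℕ) (1≤W : 1 ≤ W) (Xs Ys : List (List Bool)) (bX : Blocks W Xs) (bY : Blocks W Ys) (lenY : length Ys ≡ R) where

  zeroBlock oneBlock : List Bool
  zeroBlock = replicate W false
  oneBlock  = replicate W true

  -- Each of the two words ends a run of the other bit, so no run of equal bits extends past both,
  -- even if all words before them are equal.
  separators : List (List Bool)
  separators = oneBlock ∷ zeroBlock ∷ []

  shortened : List (List Bool)
  shortened = dedupe (suc R) zeroBlock 0 Xs

  private
    bS : Blocks W separators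
    bS = length-replicate W ∷ length-replicate W ∷ []

    one≢zero : oneBlock ≢ zeroBlock
    one≢zero = lem 1≤W
      where
      lem : ∀ {W} → 1 ≤ W → replicate W true ≢ replicate W false
      lem (s≤s _) ()

    broken-separators : ∀ b → Broken W b 2 separators
    broken-separators false = stop one≢zero
    broken-separators true  = go (stop (λ e → one≢zero (sym e)))

    tail = Ys ++ separators

    broken-tail : ∀ b s → s ≤ length Ys → Broken W b (suc (suc R)) (drop s tail)
    broken-tail b s s≤ = subst (Broken W b (suc (suc R))) (sym (drop-++ˡ s Ys separators s≤))
        (Broken-mono (subst (_≤ suc (suc R)) (+-comm 2 (length (drop s Ys))) (s≤s (s≤s (subst (_≤ R) (sym (length-drop s Ys))
          (≤-trans (m∸n≤m (length Ys) s) (≤-reflexive lenY))))))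
          (Broken-++ (drop s Ys) (broken-separators b)))

    blocks = shortened ++ tail

    bBlocks : Blocks W blocks
    bBlocks = Blocks-++ (Blocks-dedupe (suc R) zeroBlock 0 Xs bX) (Blocks-++ bY bS)

    broken : ∀ b s → s ≤ length shortened + R → Broken W b (suc R + suc (suc R)) (drop s blocks)
    broken b s s≤ with s ≤? length shortened
    ... | yes h = subst (Broken W b _) (sym (drop-++ˡ s shortened tail h))
          (Broken-dedupe R (broken-tail b 0 z≤n) Xs zeroBlock bX (length-replicate W) s)
    ... | no ¬h with m≤n⇒∃[o]m+o≡n (<⇒≤ (≰⇒> ¬h))
    ... | s′ , refl = subst (Broken W b _) (sym (drop-++ s′ shortened tail))
          (Broken-mono (m≤n+m (suc (suc R)) (suc R)) (broken-tail b s′ (subst (s′ ≤_) (sym lenY) (+-cancelˡ-≤ (length shortened) s′ R s≤))))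

  module _ (V : List Bool) where

    U C : List Bool
    U = concat shortened
    C = concat tail ++ V

    private
      UC : U ++ C ≡ concat blocks ++ V
      UC = trans (sym (++-assoc U (concat tail) V)) (cong (_++ V) (concat-++ shortened tail))

      -- An occurrence that starts in `U` ends at most `R` words behind it, which gives the range of
      -- `p`. From a word boundary in that range `2 * R + 3` words suffice to break a run: `suc R`
      -- kept in the chunk and `R + 2` of `tail`. One more word accounts for positions inside a
      -- word.
      breaks : ∀ b p → p ≤ length U + R * W → Breaks b ((2 * R + 4) * W) (drop p (U ++ C))
      breaks b p p≤ = subst₂ (Breaks b) (cong (_* W) (arith R)) (cong (drop p) (sym UC))
        (Breaks-drop blocks (length shortened + R) p bBlocks
          (subst (length shortened + R ≤_) (sym (length-++ shortened)) (+-monoʳ-≤ (length shortened)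
            (subst (R ≤_) (sym (length-++ Ys)) (subst (_≤ length Ys + 2) lenY (m≤m+n (length Ys) 2)))))
          (broken b)
          (subst (p ≤_) (trans (cong (_+ R * W) (length-concat-Blocks (Blocks-dedupe (suc R) zeroBlock 0 Xs bX))) (sym (*-distribʳ-+ W (length shortened) R))) p≤))
        where
        arith : ∀ R → suc (suc R + suc (suc R)) ≡ 2 * R + 4
        arith = solve-∀

      -- A pattern has at most `R` words, so an occurrence that starts in `Xs` ends within `Ys`.
      -- Hence the separators and the dictionary behind `Ys` neither create nor destroy occurrences.
      local : ∀ (P : List Bool) o (B : List Bool) → length P ≤ R * W → o < length (concat Xs) →
        take (length P) (drop o (concat Xs ++ (concat Ys ++ B))) ≡ take (length P) (drop o (concat Xs ++ concat Ys))
      local P o B short o< = trans (cong (take (length P) ∘ drop o) (sym (++-assoc (concat Xs) (concat Ys) B)))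
        (trans (take-drop-local (length P) o (concat Xs ++ concat Ys) B [] (subst (o + length P ≤_) (sym (length-++ (concat Xs)))
          (+-mono-≤ (<⇒≤ o<) (subst (length P ≤_) (sym (trans (length-concat-Blocks bY) (cong (_* W) lenY))) short))))
          (cong (take (length P) ∘ drop o) (++-identityʳ (concat Xs ++ concat Ys))))

      C≡ : C ≡ concat Ys ++ (concat separators ++ V)
      C≡ = trans (cong (_++ V) (sym (concat-++ Ys separators))) (++-assoc (concat Ys) (concat separators) V)

    module _ (P : List Bool) (short : length P ≤ R * W) (N l h : ℕ) (a c : List Bool)
      (longN : (2 * R + 4) * W ≤ N)
      (lo≡ : drop l C ≡ P ++ replicate N false ++ a) (hi≡ : drop h C ≡ P ++ replicate N true ++ c)
      (Z : List Bool) (lengths : length Z ≡ length U)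
      where

      private
        loU = SA⁻¹ (U ++ C) (suc (length U + l))
        hiU = SA⁻¹ (U ++ C) (suc (length U + h))
        loZ = SA⁻¹ (Z ++ C) (suc (length U + l))
        hiZ = SA⁻¹ (Z ++ C) (suc (length U + h))

        1≤N : 1 ≤ N
        1≤N = ≤-trans (≤-trans 1≤W (subst (λ z → W ≤ z * W) (+-comm 4 (2 * R)) (m≤m+n W ((3 + 2 * R) * W)))) longN

        Test : List Bool → List Bool → Set
        Test lo hi = below Z C hi + below U C lo < below U C hi + below Z C lo

      detect-sound : hiZ + loU < hiU + loZ → Occurs P (concat Xs) (concat Ys)
      detect-sound t with proj₂ (Occurs-dedupe W R P C short Xs zeroBlock bX (length-replicate W))
          (below-sound P 1≤N a c C U Z (subst₂ Test lo≡ hi≡ (rank-test⁻ U Z C lengths l h t)))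
      ... | o , o< , occ = o , o< , trans (sym (trans (cong (λ z → take (length P) (drop o (concat Xs ++ z))) C≡) (local P o _ short o<))) occ

      detect-complete : ¬ Occurs P Z C → Occurs P (concat Xs) (concat Ys) → hiZ + loU < hiU + loZ
      detect-complete ¬occ (o , o< , occ) with proj₁ (Occurs-dedupe W R P C short Xs zeroBlock bX (length-replicate W))
          (o , o< , trans (trans (cong (λ z → take (length P) (drop o (concat Xs ++ z))) C≡) (local P o _ short o<)) occ)
      ... | o′ , o′< , occ′ = rank-test⁺ U Z C lengths l h (subst₂ Test (sym lo≡) (sym hi≡)
          (below-complete P 1≤N a c C U Z o′ o′< occ′
            (λ b → subst (λ n → Breaks b n (drop (o′ + length P) (U ++ C))) (m+[n∸m]≡n longN)
              (Breaks-mono (N ∸ (2 * R + 4) * W) (breaks b (o′ + length P) (+-mono-≤ (<⇒≤ o′<) short)))) ¬occ))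

¬Occurs-replicate : ∀ p P n C → ¬ Occurs (p ∷ P) (replicate n (not p)) C
¬Occurs-replicate p P (suc n) C (zero , _ , h)       = lem p h
  where
  lem : ∀ p {xs ys : List Bool} → not p ∷ xs ≢ p ∷ ys
  lem true  ()
  lem false ()
¬Occurs-replicate p P (suc n) C (suc o , s≤s o< , h) = ¬Occurs-replicate p P n C (o , o< , h)

-- Copies of the structure.  The reduction itself uses the names of registers and arrays below 40.

tag : ℕ → ℕ → ℕ
tag zero    x = 2 * x
tag (suc c) x = suc (2 * tag c x)

-- In binary, `tag c x` is `x` followed by a 0 and `c` ones, so `c` is read off from the low-order
-- bits and `x` from the others.
tag-injective : ∀ c d {x y} → tag c x ≡ tag d y → c ≡ d × x ≡ y
tag-injective zero    zero    e = refl , *-cancelˡ-≡ _ _ 2 e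
tag-injective zero    (suc d) {x} {y} e = contradiction e (even≢odd x (tag d y))
tag-injective (suc c) zero    {x} {y} e = contradiction (sym e) (even≢odd y (tag c x))
tag-injective (suc c) (suc d) e with tag-injective c d (*-cancelˡ-≡ _ _ 2 (suc-injective e))
... | refl , refl = refl , refl

copy : ℕ → ℕ → ℕ
copy c x = 40 + tag c x

copy-injective : ∀ c {x y} → copy c x ≡ copy c y → x ≡ y
copy-injective c e = proj₂ (tag-injective c c (+-cancelˡ-≡ 40 _ _ e))

copy-disjoint : ∀ {c d} → c ≢ d → ∀ x → copy c x ∉ copy d
copy-disjoint c≢d x y e = c≢d (proj₁ (tag-injective _ _ (+-cancelˡ-≡ 40 _ _ e)))

<40-∉ : ∀ c {y} → y < 40 → y ∉ copy c
<40-∉ c y<40 x refl = <⇒≱ y<40 (m≤m+n 40 (tag c x))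

zeroState : State
zeroState = initial [] []

textState : List ℕ → State
textState xs = initial [] (xs ∷ [])

textState-[] : zeroState ≈ textState []
textState-[] = (λ _ → refl) , λ { zero _ → refl ; (suc a) _ → refl }

textState-∷ʳ : ∀ xs v → setMem 0 (length xs) v (textState xs) ≈ textState (xs ∷ʳ v)
textState-∷ʳ xs v = (λ _ → refl) , λ { zero j → sym (padded-∷ʳ xs v j) ; (suc a) j → refl }

Same : ℕ → State → State → Set
Same N σ τ = ∀ {r} → r < N → regs τ r ≡ regs σ r

Same-trans : ∀ {N σ τ υ} → Same N σ τ → Same N τ υ → Same N σ υ
Same-trans s t r< = trans (t r<) (s r<)

Same-setReg : ∀ {N σ} r {v} → N ≤ r → Same N σ (setReg r v σ)
Same-setReg {σ = σ} r N≤r r′< = update-≢ {f = regs σ} (<⇒≢ (<-≤-trans r′< N≤r))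

Same-Frame : ∀ {c σ τ} → Frame (copy c) σ τ → Same 40 σ τ
Same-Frame {c} f r< = Frame.regs-frame f (<40-∉ c r<)

≤! : ∀ {m n} {_ : T (m ≤ᵇ n)} → m ≤ n
≤! {m} {n} {p} = ≤ᵇ⇒≤ m n p

-- Registers 0–12 hold parameters of the reduction that never change.
module Worlds (consts textMem patMem : ℕ → ℕ) (later : ℕ → Set) where

  -- Only two copies are in use at a time. Copies of earlier jobs are forgotten, whereas those in
  -- `later` must still be blank, because preprocessing is specified from a memory that is 0 apart
  -- from its input.
  record World (X Z : ℕ) (τX τZ σ : State) : Set where
    field
      consts-≡ : ∀ {r} → r < 13 → regs σ r ≡ consts r
      text-≡   : ∀ j → mem σ 0 j ≡ textMem j
      pat-≡    : ∀ j → mem σ 1 j ≡ patMem j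
      simX     : Sim (copy X) σ τX
      simZ     : Sim (copy Z) σ τZ
      untouched : ∀ {c} → later c → Sim (copy c) σ zeroState

  open World public

  World-swap : ∀ {X Z τX τZ σ} → World X Z τX τZ σ → World Z X τZ τX σ
  World-swap wd = record { consts-≡ = consts-≡ wd ; text-≡ = text-≡ wd ; pat-≡ = pat-≡ wd
    ; simX = simZ wd ; simZ = simX wd ; untouched = untouched wd }

  World-setReg : ∀ {X Z τX τZ σ} r {v} → 13 ≤ r → r < 40 → World X Z τX τZ σ → World X Z τX τZ (setReg r v σ)
  World-setReg {X} {Z} {σ = σ} r 13≤r r<40 wd = record
    { consts-≡ = λ r′< → trans (Same-setReg {σ = σ} r 13≤r r′<) (consts-≡ wd r′<)
    ; text-≡ = text-≡ wd ; pat-≡ = pat-≡ wd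
    ; simX = Sim-setReg-∉ (<40-∉ X r<40) (simX wd)
    ; simZ = Sim-setReg-∉ (<40-∉ Z r<40) (simZ wd)
    ; untouched = λ {c} l → Sim-setReg-∉ (<40-∉ c r<40) (untouched wd l) }

  module Copies {X Z : ℕ} (X≢Z : X ≢ Z) (X-early : ∀ c → later c → c ≢ X) where

    World-Frame : ∀ {τX τX′ τZ σ σ′} → Frame (copy X) σ σ′ → Sim (copy X) σ′ τX′ →
      World X Z τX τZ σ → World X Z τX′ τZ σ′
    World-Frame f s wd = record
      { consts-≡ = λ r< → trans (Frame.regs-frame f (<40-∉ X (≤-trans r< ≤!))) (consts-≡ wd r<)
      ; text-≡ = λ j → trans (Frame.mem-frame f (<40-∉ X {0} ≤!) j) (text-≡ wd j)
      ; pat-≡ = λ j → trans (Frame.mem-frame f (<40-∉ X {1} ≤!) j) (pat-≡ wd j)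
      ; simX = s
      ; simZ = Sim-Frame (copy-disjoint (λ e → X≢Z (sym e))) (simZ wd) f
      ; untouched = λ {c} l → Sim-Frame (copy-disjoint (X-early c l)) (untouched wd l) f }

    World-store : ∀ {τX τZ σ} a i v → World X Z τX τZ σ → World X Z (setMem a i v τX) τZ (setMem (copy X a) i v σ)
    World-store a i v wd = World-Frame (Frame-setMem (copy-injective X) a i v) (Sim-setMem (copy-injective X) a i v (simX wd)) wd

    World-setCopyReg : ∀ {τX τZ σ} r v → World X Z τX τZ σ → World X Z (setReg r v τX) τZ (setReg (copy X r) v σ)
    World-setCopyReg r v wd = World-Frame (Frame-setReg (copy-injective X) r v) (Sim-setReg (copy-injective X) r v (simX wd)) wd

    World-≈ : ∀ {τX τX′ τZ σ} → τX ≈ τX′ → World X Z τX τZ σ → World X Z τX′ τZ σ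
    World-≈ e wd = record { consts-≡ = consts-≡ wd ; text-≡ = text-≡ wd ; pat-≡ = pat-≡ wd
      ; simX = Sim-≈ (simX wd) e ; simZ = simZ wd ; untouched = untouched wd }

    exec-copy : ∀ {w p τX τX′ τZ σ t s} → Run w p τX τX′ t s → World X Z τX τZ σ →
      Exec w (rename (copy X) p) σ t (λ σ′ → World X Z τX′ τZ σ′ × Same 40 σ σ′)
    exec-copy run wd with run-rename (copy-injective X) run (simX wd)
    ... | _ , _ , _ , run′ , refl , s , f = _ , _ , _ , run′ , ≤-refl , World-Frame f s wd , Same-Frame {X} f

-- Blocks written by a loop

list : {A : Set} → (ℕ → A) → ℕ → ℕ → List A
list B a zero    = []
list B a (suc d) = B a ∷ list B (suc a) d

length-list : ∀ {A : Set} (B : ℕ → A) a d → length (list B a d) ≡ d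
length-list B a zero    = refl
length-list B a (suc d) = cong suc (length-list B (suc a) d)

Blocks-list : ∀ {W} (B : ℕ → List Bool) → (∀ j → length (B j) ≡ W) → ∀ a d → Blocks W (list B a d)
Blocks-list B l a zero    = []
Blocks-list B l a (suc d) = l a ∷ Blocks-list B l (suc a) d

length-∷ʳ : ∀ {A : Set} (xs : List A) x → length (xs ∷ʳ x) ≡ suc (length xs)
length-∷ʳ xs x = trans (length-++ xs) (+-comm (length xs) 1)

-- Registers of the reduction: 13 the answer so far, 14 a query position, 15 and 16 the bounds of the
-- group, 17 the first position at which the text is read, 18 the word that Z consists of, 19 the
-- current pattern, 20 the word that pads it, 21 and 22 the bounds of loops over words (later ranks),
-- 23 and 24 the last word of the chunk and the length of its run, 26 and 27 the words to be appended
-- to the strings of X and Z, 28 their length in words.  Inner programs use higher registers, so that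
-- they leave all registers below some bound unchanged.

emit : (X Z : ℕ) → Prog
emit X Z = store (copy X 0) (reg 28) (reg 26) ⨟ store (copy Z 0) (reg 28) (reg 27) ⨟ increment 28

emitBoth : (X Z : ℕ) → Expr → Prog
emitBoth X Z e = assign 26 e ⨟ assign 27 (reg 26) ⨟ emit X Z

shiftedWord : Expr
shiftedWord = op add (op shr (load 0 (reg 21)) (reg 17))
  (op shl (load 0 (op add (reg 21) (const 1))) (op sub (reg 1) (reg 17)))

emitText : (X Z : ℕ) → Prog
emitText X Z =
  assign 26 shiftedWord ⨟
  cond (op eq (reg 26) (reg 23)) (increment 24) (assign 24 (const 1)) ⨟
  assign 23 (reg 26) ⨟
  cond (op lt (op add (reg 4) (const 1)) (reg 24)) skip (assign 27 (reg 18) ⨟ emit X Z)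

module Emission (w : ℕ) (1<2^w : 1 < 2 ^ w) (consts textMem patMem : ℕ → ℕ) (later : ℕ → Set)
  {X Z : ℕ} (X≢Z : X ≢ Z) (X-early : ∀ c → later c → c ≢ X) (Z-early : ∀ c → later c → c ≢ Z) where

  open Arithmetic w
  open Worlds consts textMem patMem later public
  module CX = Copies X≢Z X-early
  module CZ = Copies (λ e → X≢Z (sym e)) Z-early

  record Building (bx bz : List (List Bool)) (σ : State) : Set where
    constructor building
    field
      world   : World X Z (textState (map fromBits bx)) (textState (map fromBits bz)) σ
      pointer : regs σ 28 ≡ length bx
      lengths : length bz ≡ length bx

  open Building public

  Building-setReg : ∀ {bx bz σ} r {v} → 13 ≤ r → r < 28 → Building bx bz σ → Building bx bz (setReg r v σ)
  Building-setReg {σ = σ} r 13≤r r<28 (building wd p q) =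
    building (World-setReg r 13≤r (<-≤-trans r<28 ≤!) wd) (trans (update-≢ {f = regs σ} (λ e → <⇒≢ r<28 (sym e))) p) q

  private
    textState-map-∷ʳ : ∀ bx B {l} → l ≡ length bx →
      setMem 0 l (fromBits B) (textState (map fromBits bx)) ≈ textState (map fromBits (bx ∷ʳ B))
    textState-map-∷ʳ bx B refl = subst₂ (λ l t → setMem 0 l (fromBits B) (textState (map fromBits bx)) ≈ textState t)
      (length-map fromBits bx) (sym (map-++ fromBits bx (B ∷ []))) (textState-∷ʳ (map fromBits bx) (fromBits B))

  exec-emit : ∀ {bx bz σ} B B′ → Building bx bz σ → regs σ 26 ≡ fromBits B → regs σ 27 ≡ fromBits B′ →
    suc (length bx) < 2 ^ w →
    Exec w (emit X Z) σ 10 (λ τ → Building (bx ∷ʳ B) (bz ∷ʳ B′) τ × Same 28 σ τ)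
  exec-emit {bx} {bz} {σ} B B′ (building wd p q) x≡ z≡ room =
    stored {d = reg 28} {reg 26} p x≡ (stored {d = reg 28} {reg 27} p z≡
      (exec-assign (trans (mod-+ p (mod-small 1<2^w) (subst (_< 2 ^ w) (+-comm 1 (length bx)) room)) (+-comm (length bx) 1))
        ( building (World-setReg 28 ≤! ≤! (World-swap (CZ.World-≈ (textState-map-∷ʳ bz B′ (sym q)) (CZ.World-store 0 (length bx) (fromBits B′)
            (World-swap (CX.World-≈ (textState-map-∷ʳ bx B refl) (CX.World-store 0 (length bx) (fromBits B) wd)))))))
            (sym (length-∷ʳ bx B)) (trans (length-∷ʳ bz B′) (trans (cong suc q) (sym (length-∷ʳ bx B))))
        , Same-setReg {σ = σ} 28 ≤-refl)))

  exec-emitBoth : ∀ {bx bz σ e} B → Building bx bz σ → eval w σ e ≡ fromBits B → suc (length bx) < 2 ^ w →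
    Exec w (emitBoth X Z e) σ (1 + cost e + 12) (λ τ → Building (bx ∷ʳ B) (bz ∷ʳ B) τ × Same 26 σ τ)
  exec-emitBoth {σ = σ} {e} B bd e≡ room = assigned e≡ (assigned refl
    (exec-map (λ τ (bd′ , s) → bd′ , λ r< → trans (s (<-≤-trans r< ≤!))
        (trans (Same-setReg {σ = setReg 26 _ σ} 27 ≤! r<) (Same-setReg {σ = σ} 26 ≤-refl r<)))
      (exec-emit B B (Building-setReg 27 ≤! ≤! (Building-setReg 26 ≤! ≤! bd)) refl refl room)))

  module _ (e : Expr) (B : ℕ → List Bool) {a b : ℕ} {σ₀ : State} {bx bz : List (List Bool)}
    (a≤b : a ≤ b) (b<2^w : b < 2 ^ w) (bd₀ : Building bx bz σ₀) (start : regs σ₀ 21 ≡ a) (end : regs σ₀ 22 ≡ b)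
    (room : length bx + (b ∸ a) < 2 ^ w)
    (e≡ : ∀ {j σ τX τZ} → a ≤ j → j < b → World X Z τX τZ σ → Same 21 σ₀ σ → regs σ 21 ≡ j → eval w σ e ≡ fromBits (B j))
    where

    private
      record Inv (j : ℕ) (σ : State) : Set where
        field
          {xs zs} : List (List Bool)
          bd      : Building xs zs σ
          -- The output so far, followed by what is still to come, stays constant: one step only
          -- moves a block from the second part to the first.
          xs-≡    : xs ++ list B j (b ∸ j) ≡ bx ++ list B a (b ∸ a)
          zs-≡    : zs ++ list B j (b ∸ j) ≡ bz ++ list B a (b ∸ a)
          counter : regs σ 21 ≡ j
          last    : regs σ 22 ≡ b
          same    : Same 21 σ₀ σ

      step : ∀ {j σ} → a ≤ j → j < b → Inv j σ →
        Exec w (emitBoth X Z e) σ (1 + cost e + 12) (λ τ → regs τ 21 ≡ j × Inv (suc j) (setReg 21 (suc j) τ))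
      step {j} {σ} a≤j j<b I = exec-map post (exec-emitBoth (B j) bd (e≡ a≤j j<b (world bd) same counter) room′)
        where
        open Inv I
        rest : list B j (b ∸ j) ≡ B j ∷ list B (suc j) (b ∸ suc j)
        rest = cong (list B j) (+-∸-assoc 1 j<b)
        moved : ∀ {ys ws : List (List Bool)} → ys ++ list B j (b ∸ j) ≡ ws → (ys ∷ʳ B j) ++ list B (suc j) (b ∸ suc j) ≡ ws
        moved {ys} h = trans (∷ʳ-++ ys (B j) _) (trans (cong (ys ++_) (sym rest)) h)
        room′ : suc (length xs) < 2 ^ w
        room′ = ≤-<-trans (subst₂ _≤_ (length-∷ʳ xs (B j)) (trans (sym (length-++ (xs ∷ʳ B j))) (trans (cong length (moved xs-≡))
          (trans (length-++ bx) (cong (length bx +_) (length-list B a (b ∸ a)))))) (m≤m+n (length (xs ∷ʳ B j)) _)) room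
        post : ∀ τ → Building (xs ∷ʳ B j) (zs ∷ʳ B j) τ × Same 26 σ τ → regs τ 21 ≡ j × Inv (suc j) (setReg 21 (suc j) τ)
        post τ (bd′ , s) = trans (s ≤!) counter , record
          { bd = Building-setReg 21 ≤! ≤! bd′ ; xs-≡ = moved xs-≡ ; zs-≡ = moved zs-≡ ; counter = refl ; last = trans (s ≤!) last
          ; same = λ r< → trans (Same-setReg {σ = τ} 21 ≤-refl r<) (trans (s (<-≤-trans r< ≤!)) (same r<)) }

    exec-emitLoop : Exec w (forUpTo 21 22 (emitBoth X Z e)) σ₀ ((b ∸ a) * (1 + cost e + 12 + 8) + 4)
      (λ τ → Building (bx ++ list B a (b ∸ a)) (bz ++ list B a (b ∸ a)) τ × Same 21 σ₀ τ × regs τ 21 ≡ b)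
    exec-emitLoop = exec-map (λ τ I → let open Inv I in
          subst₂ (λ x z → Building x z τ) (done xs-≡) (done zs-≡) bd , same , counter)
        (Loop.exec-forUpTo 21 22 b<2^w 1<2^w (emitBoth X Z e) (1 + cost e + 12) Inv Inv.counter Inv.last a a≤b
          (record { bd = bd₀ ; xs-≡ = refl ; zs-≡ = refl ; counter = start ; last = end ; same = λ _ → refl }) step)
      where
      done : ∀ {ys ws : List (List Bool)} → ys ++ list B b (b ∸ b) ≡ ws → ys ≡ ws
      done {ys} h = trans (sym (++-identityʳ ys)) (trans (cong (λ z → ys ++ list B b z) (sym (n∸n≡0 b))) h)

  module _ (R : ℕ) (f : ℕ → Bool) (text-seg : ∀ j → textMem j ≡ fromBits (seg f (j * w) w))
    (consts-w : consts 1 ≡ w) (consts-R : consts 4 ≡ R) where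

    eval-shiftedWord : ∀ {j r σ τX τZ} → World X Z τX τZ σ → regs σ 21 ≡ j → regs σ 17 ≡ r → r < w → suc j < 2 ^ w →
      eval w σ shiftedWord ≡ fromBits (seg f (j * w + r) w)
    eval-shiftedWord {j} {r} {σ} wd j≡ r≡ r<w room = trans
        (mod-+ (cong₂ (λ x y → x div (2 ^ y)) word r≡) (cong₂ (λ x y → (x * 2 ^ y) mod (2 ^ w)) next-word shift)
          (subst (_< 2 ^ w) (sym value) (subst (λ z → fromBits (seg f (j * w + r) w) < 2 ^ z) (length-seg f _ w) (fromBits-< (seg f (j * w + r) w)))))
        value
      where
      word : mem σ 0 (regs σ 21) ≡ fromBits (seg f (j * w) w)
      word = trans (cong (mem σ 0) j≡) (trans (text-≡ wd j) (text-seg j))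
      next-word : mem σ 0 ((regs σ 21 + 1 mod (2 ^ w)) mod (2 ^ w)) ≡ fromBits (seg f (j * w + w) w)
      next-word = trans (cong (mem σ 0) (trans (mod-+ j≡ (mod-small 1<2^w) (subst (_< 2 ^ w) (+-comm 1 j) room)) (+-comm j 1)))
        (trans (text-≡ wd (suc j)) (trans (text-seg (suc j)) (cong (λ z → fromBits (seg f z w)) (+-comm w (j * w)))))
      shift : (regs σ 1 + 2 ^ w ∸ regs σ 17) mod (2 ^ w) ≡ w ∸ r
      shift = mod-∸ (trans (consts-≡ wd ≤!) consts-w) r≡ (<⇒≤ r<w) (n<2^n w)
      value = fromBits-seg-shift f (j * w) w r (<⇒≤ r<w)

    textBlock : ℕ → ℕ → List Bool
    textBlock r j = seg f (j * w + r) w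

    module _ {r a b : ℕ} {σ₀ : State} (zb : List Bool) (a≤b : a ≤ b) (r<w : r < w)
      (bd₀ : Building [] [] σ₀) (start : regs σ₀ 21 ≡ a) (end : regs σ₀ 22 ≡ b)
      (prev₀ : regs σ₀ 23 ≡ 0) (count₀ : regs σ₀ 24 ≡ 0)
      (shift₀ : regs σ₀ 17 ≡ r) (fill₀ : regs σ₀ 18 ≡ fromBits zb)
      (room : suc b < 2 ^ w) (room′ : suc R < 2 ^ w) where

      private
        zero-block = replicate w false
        B = textBlock r

        record Inv (j : ℕ) (σ : State) : Set where
          field
            {acc}   : List (List Bool)
            {prev}  : List Bool
            {cnt}   : ℕ
            bd      : Building acc (replicate (length acc) zb) σ
            spec    : acc ++ dedupe (suc R) prev cnt (list B j (b ∸ j)) ≡ dedupe (suc R) zero-block 0 (list B a (b ∸ a))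
            prev-≡  : regs σ 23 ≡ fromBits prev
            cnt-≡   : regs σ 24 ≡ cnt
            cnt≤    : cnt ≤ j
            acc≤    : length acc ≤ j
            counter : regs σ 21 ≡ j
            last    : regs σ 22 ≡ b
            same    : Same 21 σ₀ σ

        nextCount-≤ : ∀ {cnt j} prev y → cnt ≤ j → nextCount cnt prev y ≤ suc j
        nextCount-≤ prev y cnt≤j with fromBits y ≡ᵇ fromBits prev
        ... | true  = s≤s cnt≤j
        ... | false = s≤s z≤n

        step : ∀ {j σ} → a ≤ j → j < b → Inv j σ →
          Exec w (emitText X Z) σ 42 (λ τ → regs τ 21 ≡ j × Inv (suc j) (setReg 21 (suc j) τ))
        step {j} {σ} a≤j j<b I = assigned {T = 28}
            (eval-shiftedWord (world bd) counter (trans (same ≤!) shift₀) r<w (≤-<-trans j<b (<-trans (n<1+n b) room)))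
            (exec-seq {T₁ = 8} {T₂ = 20} count (λ { _ refl → assigned {T = 18} refl test }))
          where
          open Inv I
          y  = B j
          c  = nextCount cnt prev y
          σ₁ = setReg 26 (fromBits y) σ
          σ₂ = setReg 24 c σ₁
          σ₃ = setReg 23 (fromBits y) σ₂

          count : Exec w (cond (op eq (reg 26) (reg 23)) (increment 24) (assign 24 (const 1))) σ₁ 8 (_≡ σ₂)
          count with fromBits y ≡ᵇ fromBits prev in e
          ... | true  = exec-cond-nonzero {T = 4} (bit-≡ (trans (≡ᵇ⇒≡ (fromBits y) (fromBits prev) (subst T (sym e) tt)) (sym prev-≡)))
              (exec-assign (trans (mod-+ cnt-≡ (mod-small 1<2^w) (subst (_< 2 ^ w) (+-comm 1 cnt) (≤-<-trans (s≤s cnt≤) (≤-<-trans j<b (<-trans (n<1+n b) room)))))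
                (+-comm cnt 1)) refl)
          ... | false = exec-cond-zero {T = 4} (bit-≢ (λ h → subst T (trans (sym (≡⇒≡ᵇ′ {fromBits y} {fromBits prev} (trans h prev-≡))) e) tt))
              (exec-≤ ≤! (exec-assign (mod-small 1<2^w) refl))
            where
            ≡⇒≡ᵇ′ : ∀ {m n} → m ≡ n → (m ≡ᵇ n) ≡ true
            ≡⇒≡ᵇ′ {m} refl = ≡ᵇ-refl m

          rest : list B j (b ∸ j) ≡ y ∷ list B (suc j) (b ∸ suc j)
          rest = cong (list B j) (+-∸-assoc 1 j<b)

          spec′ : acc ++ dedupe (suc R) prev cnt (y ∷ list B (suc j) (b ∸ suc j)) ≡ dedupe (suc R) zero-block 0 (list B a (b ∸ a))
          spec′ = trans (cong (λ z → acc ++ dedupe (suc R) prev cnt z) (sym rest)) spec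

          bd₃ : Building acc (replicate (length acc) zb) σ₃
          bd₃ = Building-setReg 23 ≤! ≤! (Building-setReg 24 ≤! ≤! (Building-setReg 26 ≤! ≤! bd))

          same₃ : Same 21 σ₀ σ₃
          same₃ r< = trans (Same-setReg {σ = σ₂} 23 ≤! r<) (trans (Same-setReg {σ = σ₁} 24 ≤! r<) (trans (Same-setReg {σ = σ} 26 ≤! r<) (same r<)))

          R+1≡ : (regs σ 4 + 1 mod (2 ^ w)) mod (2 ^ w) ≡ suc R
          R+1≡ = trans (mod-+ (trans (consts-≡ (world bd) ≤!) consts-R) (mod-small 1<2^w) (subst (_< 2 ^ w) (+-comm 1 R) room′)) (+-comm R 1)

          test : Exec w (cond (op lt (op add (reg 4) (const 1)) (reg 24)) skip (assign 27 (reg 18) ⨟ emit X Z)) σ₃ 18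
            (λ τ → regs τ 21 ≡ j × Inv (suc j) (setReg 21 (suc j) τ))
          test with suc R <ᵇ c in e
          ... | true = exec-cond-nonzero {T = 12}
              (bit-< (subst (_< c) (sym R+1≡) (<ᵇ⇒< (suc R) c (subst T (sym e) tt))))
              (exec-≤ ≤! (exec-skip (counter , record
                { bd = Building-setReg 21 ≤! ≤! bd₃
                ; spec = trans (cong (λ z → acc ++ (if z then dedupe (suc R) y c (list B (suc j) (b ∸ suc j)) else y ∷ dedupe (suc R) y c (list B (suc j) (b ∸ suc j)))) (sym e)) spec′
                ; prev-≡ = refl ; cnt-≡ = refl ; cnt≤ = nextCount-≤ prev y cnt≤ ; acc≤ = m≤n⇒m≤1+n acc≤
                ; counter = refl ; last = last
                ; same = λ r< → trans (Same-setReg {σ = σ₃} 21 ≤-refl r<) (same₃ r<) })))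
          ... | false = exec-cond-zero {T = 12}
              (bit-≮ (λ h → subst T (trans (sym (<⇒<ᵇ≡true (subst (_< c) R+1≡ h))) e) tt))
              (assigned {T = 10} (trans (same ≤!) fill₀) (exec-map post
                (exec-emit y zb (Building-setReg 27 ≤! ≤! bd₃) refl refl (≤-<-trans (s≤s acc≤) (≤-<-trans j<b (<-trans (n<1+n b) room))))))
            where
            post : ∀ τ → Building (acc ∷ʳ y) (replicate (length acc) zb ∷ʳ zb) τ × Same 28 (setReg 27 (fromBits zb) σ₃) τ →
              regs τ 21 ≡ j × Inv (suc j) (setReg 21 (suc j) τ)
            post τ (bd′ , s) = trans (s ≤!) counter , record
              { bd = Building-setReg 21 ≤! ≤! (subst (λ z → Building (acc ∷ʳ y) z τ)
                  (trans (replicate-∷ʳ (length acc) zb) (cong (λ z → replicate z zb) (sym (length-∷ʳ acc y)))) bd′)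
              ; spec = trans (∷ʳ-++ acc y _) (trans (cong (λ z → acc ++ (if z then dedupe (suc R) y c (list B (suc j) (b ∸ suc j)) else y ∷ dedupe (suc R) y c (list B (suc j) (b ∸ suc j)))) (sym e)) spec′)
              ; prev-≡ = s ≤! ; cnt-≡ = s ≤! ; cnt≤ = nextCount-≤ prev y cnt≤ ; acc≤ = subst (_≤ suc j) (sym (length-∷ʳ acc y)) (s≤s acc≤)
              ; counter = refl ; last = trans (s ≤!) last
              ; same = λ r< → trans (Same-setReg {σ = τ} 21 ≤-refl r<) (trans (s (<-≤-trans r< ≤!)) (trans (Same-setReg {σ = σ₃} 27 ≤! r<) (same₃ r<))) }

      exec-emitText : let bx = dedupe (suc R) zero-block 0 (list B a (b ∸ a)) in
        Exec w (forUpTo 21 22 (emitText X Z)) σ₀ ((b ∸ a) * 50 + 4)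
          (λ τ → Building bx (replicate (length bx) zb) τ × Same 21 σ₀ τ × regs τ 21 ≡ b)
      exec-emitText = exec-map (λ τ I → let open Inv I in
            subst (λ x → Building x (replicate (length x) zb) τ) (done I) bd , same , counter)
          (Loop.exec-forUpTo 21 22 (<-trans (n<1+n b) room) 1<2^w (emitText X Z) 42 Inv Inv.counter Inv.last a a≤b
            -- With count 0 the first word gets count 1 whether or not it equals `prev`; the block
            -- of zeros is chosen because its code is the initial content 0 of register 23.
            (record { acc = [] ; prev = zero-block ; cnt = 0 ; bd = bd₀ ; spec = refl
              ; prev-≡ = trans prev₀ (sym (fromBits-false w)) ; cnt-≡ = count₀ ; cnt≤ = z≤n ; acc≤ = z≤n
              ; counter = start ; last = end ; same = λ _ → refl }) step)
        where
        done : ∀ {τ} (I : Inv b τ) → Inv.acc I ≡ dedupe (suc R) zero-block 0 (list B a (b ∸ a))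
        done I = trans (sym (++-identityʳ acc)) (trans (cong (λ z → acc ++ dedupe (suc R) prev cnt (list B b z)) (sym (n∸n≡0 b))) spec)
          where open Inv I

-- The parameters of the reduction for one instance.  The text is f restricted to [0, n), a pattern
-- fills R words of which the last one contains ℓ bits, a chunk has L words, a group has G patterns,
-- and q w + r₁ is the number of possible positions of a pattern.  A run of equal words has at most
-- R + 1 words in the shortened chunk, R words after it, and one separator; M exceeds their sum by
-- two because a run of bits may start and end inside a word.
record Setting (w n : ℕ) : Set where
  field
    k m R′ q r₁ L G ℓ M : ℕ
    f               : ℕ → Bool
    pat             : ℕ → List Bool
    textMem patMem  : ℕ → ℕ

  R : ℕ
  R = suc R′

  -- Register 9 holds the word of ones. Register 12 holds the number of bits of one extended
  -- pattern, which is the distance between consecutive query positions.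
  consts : ℕ → ℕ
  consts = padded (n ∷ w ∷ k ∷ m ∷ R ∷ q ∷ r₁ ∷ L ∷ G ∷ (2 ^ w ∸ 1) ∷ ℓ ∷ M ∷ ((R + M) * w) ∷ [])

  field
    text-seg   : ∀ j → textMem j ≡ fromBits (seg f (j * w) w)
    pat-seg    : ∀ i t → i < k → t < R → patMem (i * R + t) ≡ fromBits (seg (bitAt (pat i)) (t * w) w)
    pat-length : ∀ i → length (pat i) ≡ m
    1≤w        : 1 ≤ w
    1≤m        : 1 ≤ m
    2≤n        : 2 ≤ n
    room       : 2 * n + 2 < 2 ^ w
    k≤n        : k ≤ n
    k-room     : k * R < 2 ^ w
    m≡         : m ≡ R′ * w + ℓ
    ℓ≤w        : ℓ ≤ w
    M≡         : M ≡ 2 * R + 4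
    r₁<w       : r₁ < w
    positions  : q * w + r₁ ≡ suc n ∸ m
    m≤n        : m ≤ n
    1≤q        : 1 ≤ q
    capacity   : (L + (R + 2) + G * (2 * (R + M))) * w ≤ n

  <2^w : ∀ {x} → x ≤ 2 * n + 2 → x < 2 ^ w
  <2^w h = ≤-<-trans h room

  n≤ : ∀ {x} → x ≤ n → x ≤ 2 * n + 2
  n≤ h = ≤-trans h (≤-trans (m≤m+n n (n + 0)) (m≤m+n (2 * n) 2))

  1+n≤ : suc n ≤ 2 * n + 2
  1+n≤ = subst (suc n ≤_) (+-comm 2 (2 * n)) (s≤s (≤-trans (m≤m+n n (n + 0)) (n≤1+n _)))

  1<2^w : 1 < 2 ^ w
  1<2^w = <2^w (≤-trans ≤! (m≤n+m 2 (2 * n)))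

  2<2^w : 2 < 2 ^ w
  2<2^w = <2^w (m≤n+m 2 (2 * n))

-- Writing the two extensions of every pattern

blockProg : (X Z : ℕ) → Prog
blockProg X Z =
  assign 21 (op mul (reg 19) (reg 4)) ⨟
  assign 22 (op sub (op add (reg 21) (reg 4)) (const 1)) ⨟
  forUpTo 21 22 (emitBoth X Z (load 1 (reg 21))) ⨟
  -- The loop stops before the last word of the pattern, to which register 21 now points. Its bits
  -- from `ℓ` on are 0 and receive the padding.
  emitBoth X Z (op add (load 1 (reg 21)) (op shl (reg 20) (reg 10))) ⨟
  assign 21 (const 0) ⨟
  assign 22 (reg 11) ⨟
  forUpTo 21 22 (emitBoth X Z (reg 20))

patternsProg : (X Z : ℕ) → Prog
patternsProg X Z = forUpTo 19 16
  (assign 20 (const 0) ⨟ blockProg X Z ⨟ assign 20 (reg 9) ⨟ blockProg X Z)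

module Phases {w n : ℕ} (𝒮 : Setting w n) (later : ℕ → Set)
  {X Z : ℕ} (X≢Z : X ≢ Z) (X-early : ∀ c → later c → c ≢ X) (Z-early : ∀ c → later c → c ≢ Z) where

  open Setting 𝒮
  open Arithmetic w
  open Emission w 1<2^w consts textMem patMem later X≢Z X-early Z-early public

  exec-separators : ∀ {bx bz σ} → Building bx bz σ → suc (suc (length bx)) < 2 ^ w →
    Exec w (emitBoth X Z (reg 9) ⨟ emitBoth X Z (const 0)) σ 28
      (λ τ → Building (bx ++ replicate w true ∷ replicate w false ∷ []) (bz ++ replicate w true ∷ replicate w false ∷ []) τ × Same 26 σ τ)
  exec-separators {bx} {bz} {σ} bd room′ = exec-seq {T₁ = 14} {T₂ = 14}
    (exec-emitBoth (replicate w true) bd (trans (consts-≡ (world bd) ≤!) (sym (fromBits-true w))) (<-trans (n<1+n _) room′))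
    (λ τ (bd′ , s) → exec-map (λ υ (bd″ , s′) → subst₂ (λ x z → Building x z υ) (∷ʳ-++ bx _ _) (∷ʳ-++ bz _ _) bd″ , Same-trans {26} {σ} {τ} {υ} s s′)
      (exec-emitBoth (replicate w false) bd′ (trans (mod-small (2^>0 w)) (sym (fromBits-false w)))
        (subst (λ z → suc z < 2 ^ w) (sym (length-∷ʳ bx _)) room′)))

  patternWord : ℕ → ℕ → List Bool
  patternWord i j = seg (bitAt (pat i)) ((j ∸ i * R) * w) w

  lastWord : Bool → ℕ → List Bool
  lastWord b i = seg (bitAt (pat i)) (R′ * w) ℓ ++ replicate (w ∸ ℓ) b

  patternBlocks : Bool → ℕ → List (List Bool)
  patternBlocks b i = list (patternWord i) (i * R) R′ ++ lastWord b i ∷ list (λ _ → replicate w b) 0 M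

  length-patternBlocks : ∀ b i → length (patternBlocks b i) ≡ R + M
  length-patternBlocks b i = trans (length-++ (list (patternWord i) (i * R) R′))
    (trans (cong₂ (λ x y → x + suc y) (length-list (patternWord i) (i * R) R′) (length-list (λ _ → replicate w b) 0 M)) (+-suc R′ M))

  length-lastWord : ∀ b i → length (lastWord b i) ≡ w
  length-lastWord b i = trans (length-++ (seg (bitAt (pat i)) (R′ * w) ℓ))
    (trans (cong₂ _+_ (length-seg _ _ ℓ) (length-replicate (w ∸ ℓ))) (m+[n∸m]≡n ℓ≤w))

  Blocks-patternBlocks : ∀ b i → Blocks w (patternBlocks b i)
  Blocks-patternBlocks b i = Blocks-++ (Blocks-list (patternWord i) (λ j → length-seg _ ((j ∸ i * R) * w) w) (i * R) R′)
    (length-lastWord b i ∷ Blocks-list (λ _ → replicate w b) (λ _ → length-replicate w) 0 M)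

  blockTime : ℕ
  blockTime = 4 + (6 + (R′ * 23 + 4 + (19 + (2 + (2 + (M * 22 + 4))))))

  exec-block : ∀ b {i bx bz σ} → i < k → Building bx bz σ → regs σ 19 ≡ i → regs σ 20 ≡ fromBits (replicate w b) →
    length bx + (R + M) < 2 ^ w →
    Exec w (blockProg X Z) σ blockTime
      (λ τ → Building (bx ++ patternBlocks b i) (bz ++ patternBlocks b i) τ × Same 21 σ τ)
  exec-block b {i} {bx} {bz} {σ} i<k bd i≡ fill≡ room′ =
    exec-≤ (≤-reflexive (cong (λ z → 4 + (6 + (z * 23 + 4 + (19 + (2 + (2 + (M * 22 + 4))))))) d≡)) $
    assigned (mod-* i≡ R≡ (≤-<-trans (m≤m+n (i * R) R) iR+R<)) $
    assigned
      (trans (mod-∸ (mod-+ refl R≡ iR+R<) (mod-small 1<2^w) (≤-trans (s≤s z≤n) (m≤n+m R (i * R))) iR+R<) (+-∸-assoc (i * R) {R} {1} (s≤s z≤n))) $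
    exec-seq (exec-emitLoop (load 1 (reg 21)) (patternWord i) (m≤m+n (i * R) R′)
        (≤-<-trans (+-monoʳ-≤ (i * R) (n≤1+n R′)) iR+R<) (Building-setReg 22 ≤! ≤! (Building-setReg 21 ≤! ≤! bd)) refl refl
        (subst (λ z → length bx + z < 2 ^ w) (sym d≡) (≤-<-trans (+-monoʳ-≤ (length bx) (≤-trans (n≤1+n R′) (m≤m+n R M))) room′))
        (λ {j} {υ} a≤j j<b wd _ j≡ → trans (cong (mem υ 1) j≡) (trans (pat-≡ wd j) (word a≤j j<b))))
    λ σ₁ (bd₁ , s₁ , j₁) → exec-seq (exec-emitBoth (lastWord b i) bd₁ (last-≡ bd₁ s₁ j₁)
        (subst (λ z → suc z < 2 ^ w) (sym (len₁ bx)) (≤-<-trans (≤-trans (≤-reflexive (sym (+-suc (length bx) R′))) (+-monoʳ-≤ (length bx) (m≤m+n R M))) room′)))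
    λ σ₂ (bd₂ , s₂) →
    assigned (mod-small (2^>0 w)) $
    assigned (consts-≡ (world bd₂) ≤!) $
    exec-map (λ τ (bd′ , s′ , _) → subst₂ (λ x z → Building x z τ) (assemble bx) (assemble bz) bd′
        , λ r< → trans (s′ r<) (trans (Same-setReg {σ = setReg 21 0 σ₂} 22 ≤! r<) (trans (Same-setReg {σ = σ₂} 21 ≤-refl r<)
            (trans (s₂ (<-≤-trans r< ≤!)) (trans (s₁ r<) (trans (Same-setReg {σ = setReg 21 _ σ} 22 ≤! r<) (Same-setReg {σ = σ} 21 ≤-refl r<)))))))
      (exec-emitLoop (reg 20) (λ _ → replicate w b) z≤n M< (Building-setReg 22 ≤! ≤! (Building-setReg 21 ≤! ≤! bd₂)) refl refl
        (subst (λ z → z + M < 2 ^ w) (sym (trans (length-∷ʳ (bx ++ A) (lastWord b i)) (trans (cong suc (len₁ bx)) (sym (+-suc (length bx) R′)))))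
          (subst (_< 2 ^ w) (sym (+-assoc (length bx) R M)) room′))
        (λ _ _ wd s _ → trans (s ≤!) (trans (s₂ ≤!) (trans (s₁ ≤!) fill≡))))
    where
    R≡ : regs σ 4 ≡ R
    R≡ = consts-≡ (world bd) ≤!
    iR+R< : i * R + R < 2 ^ w
    iR+R< = ≤-<-trans (subst (_≤ k * R) (+-comm R (i * R)) (*-monoˡ-≤ R i<k)) k-room
    M< : M < 2 ^ w
    M< = ≤-<-trans (≤-trans (m≤n+m M R) (m≤n+m (R + M) (length bx))) room′
    d≡ : i * R + R′ ∸ i * R ≡ R′
    d≡ = m+n∸m≡n (i * R) R′
    word : ∀ {j} → i * R ≤ j → j < i * R + R′ → patMem j ≡ fromBits (patternWord i j)
    word {j} a≤j j<b with m≤n⇒∃[o]m+o≡n a≤j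
    ... | t , refl = trans (pat-seg i t i<k (m≤n⇒m≤1+n (+-cancelˡ-< (i * R) t R′ j<b)))
          (cong (λ z → fromBits (seg (bitAt (pat i)) (z * w) w)) (sym (m+n∸m≡n (i * R) t)))
    A = list (patternWord i) (i * R) (i * R + R′ ∸ i * R)
    len₁ : ∀ (xs : List (List Bool)) → length (xs ++ A) ≡ length xs + R′
    len₁ xs = trans (length-++ xs) (cong (length xs +_) (trans (length-list (patternWord i) (i * R) _) d≡))
    last-≡ : ∀ {σ₁ xs zs} → Building xs zs σ₁ → Same 21 (setReg 22 (i * R + R′) (setReg 21 (i * R) σ)) σ₁ → regs σ₁ 21 ≡ i * R + R′ →
      eval w σ₁ (op add (load 1 (reg 21)) (op shl (reg 20) (reg 10))) ≡ fromBits (lastWord b i)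
    last-≡ {σ₁} bd₁ s₁ j₁ = trans (mod-+ x≡ y≡ (subst (_< 2 ^ w) (sym fill) (subst (λ z → fromBits (lastWord b i) < 2 ^ z) (length-lastWord b i) (fromBits-< (lastWord b i))))) fill
      where
      x≡ : mem σ₁ 1 (regs σ₁ 21) ≡ fromBits (seg (bitAt (pat i)) (R′ * w) w)
      x≡ = trans (cong (mem σ₁ 1) j₁) (trans (pat-≡ (world bd₁) _) (pat-seg i R′ i<k ≤-refl))
      y≡ : (regs σ₁ 20 * 2 ^ regs σ₁ 10) mod (2 ^ w) ≡ (fromBits (replicate w b) * 2 ^ ℓ) mod (2 ^ w)
      y≡ = cong₂ (λ x y → (x * 2 ^ y) mod (2 ^ w)) (trans (s₁ ≤!) fill≡) (consts-≡ (world bd₁) ≤!)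
      fill = fromBits-seg-fill (pat i) (R′ * w) ℓ w b (trans (pat-length i) m≡) ℓ≤w
    assemble : ∀ (xs : List (List Bool)) → ((xs ++ A) ∷ʳ lastWord b i) ++ list (λ _ → replicate w b) 0 M ≡ xs ++ patternBlocks b i
    assemble xs = trans (∷ʳ-++ (xs ++ A) _ _) (trans (++-assoc xs A _)
      (cong (λ z → xs ++ list (patternWord i) (i * R) z ++ lastWord b i ∷ list (λ _ → replicate w b) 0 M) d≡))

  pairBlocks : ℕ → List (List Bool)
  pairBlocks i = patternBlocks false i ++ patternBlocks true i

  H : ℕ
  H = 2 * (R + M)

  length-pairBlocks : ∀ i → length (pairBlocks i) ≡ H
  length-pairBlocks i = trans (length-++ (patternBlocks false i))
    (cong₂ _+_ (length-patternBlocks false i) (trans (length-patternBlocks true i) (sym (+-identityʳ (R + M)))))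

  groupBlocks : ℕ → ℕ → List (List Bool)
  groupBlocks a d = concat (list pairBlocks a d)

  length-groupBlocks : ∀ a d → length (groupBlocks a d) ≡ d * H
  length-groupBlocks a zero    = refl
  length-groupBlocks a (suc d) = trans (length-++ (pairBlocks a)) (cong₂ _+_ (length-pairBlocks a) (length-groupBlocks (suc a) d))

  Blocks-groupBlocks : ∀ a d → Blocks w (groupBlocks a d)
  Blocks-groupBlocks a zero    = []
  Blocks-groupBlocks a (suc d) = Blocks-++ (Blocks-++ (Blocks-patternBlocks false a) (Blocks-patternBlocks true a)) (Blocks-groupBlocks (suc a) d)

  patternsBodyTime : ℕ
  patternsBodyTime = 2 + (blockTime + (2 + blockTime))

  module _ {a b : ℕ} {σ₀ : State} {bx bz : List (List Bool)}
    (a≤b : a ≤ b) (b≤k : b ≤ k) (bd₀ : Building bx bz σ₀) (start : regs σ₀ 19 ≡ a) (end : regs σ₀ 16 ≡ b)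
    (room′ : length bx + (b ∸ a) * H < 2 ^ w) where

    private
      record Inv (j : ℕ) (σ : State) : Set where
        field
          {xs zs} : List (List Bool)
          bd      : Building xs zs σ
          xs-≡    : xs ++ groupBlocks j (b ∸ j) ≡ bx ++ groupBlocks a (b ∸ a)
          zs-≡    : zs ++ groupBlocks j (b ∸ j) ≡ bz ++ groupBlocks a (b ∸ a)
          counter : regs σ 19 ≡ j
          same    : Same 19 σ₀ σ

      step : ∀ {j σ} → a ≤ j → j < b → Inv j σ →
        Exec w (assign 20 (const 0) ⨟ blockProg X Z ⨟ assign 20 (reg 9) ⨟ blockProg X Z) σ patternsBodyTime
          (λ τ → regs τ 19 ≡ j × Inv (suc j) (setReg 19 (suc j) τ))
      step {j} {σ} a≤j j<b I =
        assigned (trans (mod-small (2^>0 w)) (sym (fromBits-false w))) $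
        exec-seq (exec-block false j<k (Building-setReg 20 ≤! ≤! bd) counter refl (≤-<-trans (+-monoʳ-≤ (length xs) (m≤m+n (R + M) _)) room₁))
        λ σ₁ (bd₁ , s₁) →
        assigned (trans (consts-≡ (world bd₁) ≤!) (sym (fromBits-true w))) $
        exec-map (λ τ (bd₂ , s₂) → trans (s₂ ≤!) (trans (s₁ ≤!) counter) , record
            { bd = Building-setReg 19 ≤! ≤! bd₂ ; xs-≡ = moved xs-≡ ; zs-≡ = moved zs-≡ ; counter = refl
            ; same = λ r< → trans (Same-setReg {σ = τ} 19 ≤-refl r<) (trans (s₂ (<-≤-trans r< ≤!)) (trans (Same-setReg {σ = σ₁} 20 ≤! r<)
                (trans (s₁ (<-≤-trans r< ≤!)) (trans (Same-setReg {σ = σ} 20 ≤! r<) (same r<))))) })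
          (exec-block true j<k (Building-setReg 20 ≤! ≤! bd₁) (trans (s₁ ≤!) counter) refl
            (subst (_< 2 ^ w) (sym (trans (cong (_+ (R + M)) (trans (length-++ xs) (cong (length xs +_) (length-patternBlocks false j))))
              (trans (+-assoc (length xs) (R + M) (R + M)) (cong (λ z → length xs + (R + M + z)) (sym (+-identityʳ (R + M))))))) room₁))
        where
        open Inv I
        j<k = <-≤-trans j<b b≤k
        rest : groupBlocks j (b ∸ j) ≡ pairBlocks j ++ groupBlocks (suc j) (b ∸ suc j)
        rest = cong (groupBlocks j) (+-∸-assoc 1 j<b)
        moved : ∀ {ys ws : List (List Bool)} → ys ++ groupBlocks j (b ∸ j) ≡ ws →
          ((ys ++ patternBlocks false j) ++ patternBlocks true j) ++ groupBlocks (suc j) (b ∸ suc j) ≡ ws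
        moved {ys} h = trans (cong (_++ groupBlocks (suc j) (b ∸ suc j)) (++-assoc ys (patternBlocks false j) (patternBlocks true j)))
          (trans (++-assoc ys (pairBlocks j) _) (trans (cong (ys ++_) (sym rest)) h))
        room₁ : length xs + H < 2 ^ w
        room₁ = ≤-<-trans (begin
            length xs + H ≤⟨ +-monoʳ-≤ (length xs) (m≤m+n H ((b ∸ suc j) * H)) ⟩
            length xs + suc (b ∸ suc j) * H ≡⟨ cong (λ z → length xs + z * H) (sym (+-∸-assoc 1 j<b)) ⟩
            length xs + (b ∸ j) * H ≡⟨ cong (length xs +_) (sym (length-groupBlocks j (b ∸ j))) ⟩
            length xs + length (groupBlocks j (b ∸ j)) ≡⟨ sym (length-++ xs) ⟩
            length (xs ++ groupBlocks j (b ∸ j)) ≡⟨ cong length xs-≡ ⟩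
            length (bx ++ groupBlocks a (b ∸ a)) ≡⟨ length-++ bx ⟩
            length bx + length (groupBlocks a (b ∸ a)) ≡⟨ cong (length bx +_) (length-groupBlocks a (b ∸ a)) ⟩
            length bx + (b ∸ a) * H ∎) room′
          where open ≤-Reasoning

    exec-patterns : Exec w (patternsProg X Z) σ₀ ((b ∸ a) * (patternsBodyTime + 8) + 4)
      (λ τ → Building (bx ++ groupBlocks a (b ∸ a)) (bz ++ groupBlocks a (b ∸ a)) τ × Same 19 σ₀ τ)
    exec-patterns = exec-map (λ τ I → let open Inv I in
          subst₂ (λ x z → Building x z τ) (done xs-≡) (done zs-≡) bd , same)
        (Loop.exec-forUpTo 19 16 (<2^w (n≤ (≤-trans b≤k k≤n))) 1<2^w _ patternsBodyTime Inv Inv.counter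
          (λ I → trans (Inv.same I ≤!) end) a a≤b
          (record { bd = bd₀ ; xs-≡ = refl ; zs-≡ = refl ; counter = start ; same = λ _ → refl }) step)
      where
      done : ∀ {ys ws : List (List Bool)} → ys ++ groupBlocks b (b ∸ b) ≡ ws → ys ≡ ws
      done {ys} h = trans (sym (++-identityʳ ys)) (trans (cong (λ z → ys ++ groupBlocks b z) (sym (n∸n≡0 b))) h)

-- Preprocessing and queries in a copy

prepareProg : Structure → ℕ → Prog
prepareProg D X = assign (copy X 0) (reg 0) ⨟ assign (copy X 1) (reg 1) ⨟ rename (copy X) (Structure.preprocess D)

askProg : Structure → (X result : ℕ) → Prog
askProg D X result =
  assign (copy X 0) (reg 14) ⨟ rename (copy X) (Structure.query D) ⨟ assign result (reg (copy X 0))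

SA⁻¹-≤ : ∀ S j → SA⁻¹ S j ≤ suc (length S)
SA⁻¹-≤ S j = s≤s (≤-trans (length-filter (λ i → suffix S i <lex? suffix S j) (map suc (upTo (length S))))
  (≤-reflexive (trans (length-map suc (upTo (length S))) (length-upTo (length S)))))

module Calls {wf : ℕ → ℕ} {D : Structure} {P Q : ℕ → ℕ} (ans : AnswersSA⁻¹ wf D P Q) {n : ℕ} (2≤n : 2 ≤ n)
  (consts textMem patMem : ℕ → ℕ) (consts-n : consts 0 ≡ n) (consts-w : consts 1 ≡ wf n) (later : ℕ → Set) where

  open AnswersSA⁻¹ ans
  open Structure D
  open Worlds consts textMem patMem later

  module _ {X Z : ℕ} (X≢Z : X ≢ Z) (X-early : ∀ c → later c → c ≢ X) where

    open Copies X≢Z X-early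

    private
      40≤ : ∀ x → 40 ≤ copy X x
      40≤ x = m≤m+n 40 (tag X x)

    exec-prepare : ∀ {xs τZ σ} (S : Vec Bool n) → World X Z (textState xs) τZ σ → (∀ j → padded xs j ≡ padded (packed (wf n) (toList S)) j) →
      Exec (wf n) (prepareProg D X) σ (2 + (2 + P n))
        (λ τ → (∃[ ρ ] (World X Z ρ τZ τ × Reachable wf D S ρ)) × Same 40 σ τ)
    exec-prepare {xs} {τZ} {σ} S wd xs≡ with preprocess-correct n 2≤n S
    ... | ρ , t , s , run , t≤ =
      assigned (trans (consts-≡ wd ≤!) consts-n) $
      assigned (trans (consts-≡ wd {1} ≤!) consts-w) $
      exec-weaken t≤ (λ τ (wd′ , s′) → (ρ , wd′ , prepared run)
          , λ r< → trans (s′ r<) (trans (Same-setReg {40} {setReg (copy X 0) n σ} (copy X 1) (40≤ 1) r<) (Same-setReg {40} {σ} (copy X 0) (40≤ 0) r<)))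
        (exec-copy run (World-≈ input-≈ (World-setCopyReg 1 (wf n) (World-setCopyReg 0 n wd))))
      where
      input-≈ : setReg 1 (wf n) (setReg 0 n (textState xs)) ≈ textInput wf D S
      input-≈ = (λ { 0 → refl ; 1 → refl ; (suc (suc r)) → refl }) , λ { zero j → xs≡ j ; (suc a) j → refl }

    -- A query may alter its copy, so the state of the copy is tracked only as `Reachable`, which is
    -- what the correctness of the next query asks for. Registers below `result` survive; therefore
    -- successive answers go to ascending registers.
    exec-ask : ∀ {ρ τZ σ j} {S : Vec Bool n} result → 13 ≤ result → result < 40 → World X Z ρ τZ σ → Reachable wf D S ρ →
      regs σ 14 ≡ j → 1 ≤ j → j ≤ n →
      Exec (wf n) (askProg D X result) σ (2 + (Q n + 2))
        (λ τ → (∃[ ρ′ ] (World X Z ρ′ τZ τ × Reachable wf D S ρ′)) × regs τ result ≡ SA⁻¹ (toList S) j × Same result σ τ)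
    exec-ask {ρ} {τZ} {σ} {j} {S} result 13≤ <40 wd reach j≡ 1≤j j≤n with query-correct n 2≤n S ρ reach j 1≤j j≤n
    ... | ρ′ , t , s , run , t≤ , rank =
      assigned j≡ $
      exec-seq (exec-≤ t≤ (exec-copy run (World-setCopyReg 0 j wd)))
      λ σ₁ (wd₁ , s₁) → exec-assign (trans (Sim.regs-≡ (simX wd₁) 0) rank)
        ( (ρ′ , World-setReg result 13≤ <40 wd₁ , queried reach 1≤j j≤n run)
        , update-≡ {i = result} {f = regs σ₁}
        , λ r< → trans (Same-setReg {σ = σ₁} result ≤-refl r<)
            (trans (s₁ (<-trans r< <40)) (Same-setReg {40} {σ} (copy X 0) (40≤ 0) (<-trans r< <40))) )

-- Testing the patterns of a group

groupBody : Structure → (X Z : ℕ) → Prog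
groupBody D X Z =
  askProg D X 21 ⨟ askProg D Z 22 ⨟
  assign 14 (op add (reg 14) (reg 12)) ⨟
  askProg D X 23 ⨟ askProg D Z 24 ⨟
  assign 14 (op add (reg 14) (reg 12)) ⨟
  cond (op lt (op add (reg 24) (reg 21)) (op add (reg 23) (reg 22))) (assign 13 (const 1)) skip

groupBodyTime : ℕ → ℕ
groupBodyTime t = (2 + (t + 2)) + ((2 + (t + 2)) + (4 + ((2 + (t + 2)) + ((2 + (t + 2)) + (4 + 10)))))

module Group {wf : ℕ → ℕ} {D : Structure} {P Q : ℕ → ℕ} (ans : AnswersSA⁻¹ wf D P Q) {n : ℕ} (2≤n : 2 ≤ n)
  (consts textMem patMem : ℕ → ℕ) (consts-n : consts 0 ≡ n) (consts-w : consts 1 ≡ wf n) (later : ℕ → Set)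
  (room : 2 * n + 2 < 2 ^ wf n)
  {X Z : ℕ} (X≢Z : X ≢ Z) (X-early : ∀ c → later c → c ≢ X) (Z-early : ∀ c → later c → c ≢ Z)
  (SX SZ : Vec Bool n) {a b h : ℕ} (a≤b : a ≤ b) (b≤n : b ≤ n) (pos : ℕ → ℕ) (consts-h : consts 12 ≡ h)
  (1≤pos : ∀ i → 1 ≤ pos i) (pos≤ : ∀ i → a ≤ i → i < b → pos i + h ≤ n)
  (pos-suc : ∀ i → a ≤ i → pos (suc i) ≡ pos i + h + h)
  (Found Prior : Set) (Detect : ℕ → Set)
  where

  open Worlds consts textMem patMem later
  open Calls ans 2≤n consts textMem patMem consts-n consts-w later
  open Arithmetic (wf n)

  private
    w = wf n
    rankX rankZ : ℕ → ℕ
    rankX j = SA⁻¹ (toList SX) j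
    rankZ j = SA⁻¹ (toList SZ) j

    rank≤ : ∀ (S : Vec Bool n) j → SA⁻¹ (toList S) j ≤ suc n
    rank≤ S j = subst (λ z → SA⁻¹ (toList S) j ≤ suc z) (length-toList S) (SA⁻¹-≤ (toList S) j)

    -- Ranks are at most `n + 1`, so the sums compared by the test reach at most `2 * n + 2` and do
    -- not wrap around.
    sum< : ∀ {x y} → x ≤ suc n → y ≤ suc n → x + y < 2 ^ w
    sum< p q = ≤-<-trans (≤-trans (+-mono-≤ p q) (≤-reflexive (arith n))) room
      where
      arith : ∀ n → suc n + suc n ≡ 2 * n + 2
      arith = solve-∀

    1<2^w : 1 < 2 ^ w
    1<2^w = ≤-<-trans (≤-trans ≤! (m≤n+m 2 (2 * n))) room

  Test : ℕ → Set
  Test i = rankZ (pos i + h) + rankX (pos i) < rankX (pos i + h) + rankZ (pos i)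

  -- Register 13 is never reset, and once it is 1 nothing but `Found` has to be known. While it is
  -- 0, `Prior` carries along what earlier jobs have excluded.
  Flag : ℕ → State → Set
  Flag j σ = (regs σ 13 ≡ 1 × Found) ⊎ (regs σ 13 ≡ 0 × Prior × (∀ i → a ≤ i → i < j → ¬ Detect i))

  Prepared : State → Set
  Prepared σ = ∃[ ρX ] ∃[ ρZ ] (World X Z ρX ρZ σ × Reachable wf D SX ρX × Reachable wf D SZ ρZ)

  module _ (sound : ∀ i → a ≤ i → i < b → Test i → Found) (complete : ∀ i → a ≤ i → i < b → ¬ Test i → ¬ Detect i) where

    private
      record Inv (j : ℕ) (σ : State) : Set where
        field
          prep    : Prepared σ
          flag    : Flag j σ
          counter : regs σ 19 ≡ j
          last    : regs σ 16 ≡ b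
          pos-≡   : regs σ 14 ≡ pos j

      step : ∀ {j σ} → a ≤ j → j < b → Inv j σ →
        Exec w (groupBody D X Z) σ (groupBodyTime (Q n)) (λ τ → regs τ 19 ≡ j × Inv (suc j) (setReg 19 (suc j) τ))
      step {j} {σ} a≤j j<b I = body prep
        where
        open Inv I
        hi≤ : pos j + h ≤ n
        hi≤ = pos≤ j a≤j j<b
        lo≤ : pos j ≤ n
        lo≤ = ≤-trans (m≤m+n (pos j) h) hi≤
        n< : n < 2 ^ w
        n< = ≤-<-trans (≤-trans (m≤m+n n (n + 0)) (m≤m+n (2 * n) 2)) room
        next< : pos j + h + h < 2 ^ w
        next< = ≤-<-trans (≤-trans (+-mono-≤ hi≤ (≤-trans (m≤n+m h (pos j)) hi≤)) (≤-trans (≤-reflexive (cong (n +_) (sym (+-identityʳ n)))) (m≤m+n (2 * n) 2))) room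

        Post : State → Set
        Post τ = regs τ 19 ≡ j × Inv (suc j) (setReg 19 (suc j) τ)

        finish : ∀ {ρX ρZ σ₄} → World X Z ρX ρZ σ₄ → Reachable wf D SX ρX → Reachable wf D SZ ρZ →
          (∀ {r} → r < 21 → r ≢ 14 → regs σ₄ r ≡ regs σ r) →
          regs σ₄ 21 ≡ rankX (pos j) → regs σ₄ 22 ≡ rankZ (pos j) → regs σ₄ 23 ≡ rankX (pos j + h) → regs σ₄ 24 ≡ rankZ (pos j + h) →
          Exec w (cond (op lt (op add (reg 24) (reg 21)) (op add (reg 23) (reg 22))) (assign 13 (const 1)) skip) (setReg 14 (pos j + h + h) σ₄) 10 Post
        finish {ρX} {ρZ} {σ₄} wd reachX reachZ low loX loZ hiX hiZ with rankZ (pos j + h) + rankX (pos j) <? rankX (pos j + h) + rankZ (pos j)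
          | mod-+ hiZ loX (sum< (rank≤ SZ (pos j + h)) (rank≤ SX (pos j))) | mod-+ hiX loZ (sum< (rank≤ SX (pos j + h)) (rank≤ SZ (pos j)))
        ... | yes t | left | right = exec-cond-nonzero {T = 2} (bit-< (subst₂ _<_ (sym left) (sym right) t))
            (exec-assign (mod-small 1<2^w) (trans (low ≤! (λ ())) counter , record
              { prep = ρX , ρZ , World-setReg 19 ≤! ≤! (World-setReg 13 ≤! ≤! (World-setReg 14 ≤! ≤! wd)) , reachX , reachZ
              ; flag = inj₁ (refl , sound j a≤j j<b t)
              ; counter = refl ; last = trans (low ≤! (λ ())) last ; pos-≡ = sym (pos-suc j a≤j) }))
        ... | no ¬t | left | right = exec-cond-zero {T = 2} (bit-≮ (λ h′ → ¬t (subst₂ _<_ left right h′)))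
            (exec-≤ ≤! (exec-skip (trans (low ≤! (λ ())) counter , record
              { prep = ρX , ρZ , World-setReg 19 ≤! ≤! (World-setReg 14 ≤! ≤! wd) , reachX , reachZ
              ; flag = flag′ flag
              ; counter = refl ; last = trans (low ≤! (λ ())) last ; pos-≡ = sym (pos-suc j a≤j) })))
          where
          none′ : (∀ i → a ≤ i → i < j → ¬ Detect i) → ∀ i → a ≤ i → i < suc j → ¬ Detect i
          none′ none i a≤i i≤j with m≤n⇒m<n∨m≡n (s≤s⁻¹ i≤j)
          ... | inj₁ i<j  = none i a≤i i<j
          ... | inj₂ refl = complete j a≤j j<b ¬t
          flag′ : Flag j σ → Flag (suc j) (setReg 19 (suc j) (setReg 14 (pos j + h + h) σ₄))
          flag′ (inj₁ (f≡ , found))        = inj₁ (trans (low ≤! (λ ())) f≡ , found)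
          flag′ (inj₂ (f≡ , prior , none)) = inj₂ (trans (low ≤! (λ ())) f≡ , prior , none′ none)

        body : Prepared σ → Exec w (groupBody D X Z) σ (groupBodyTime (Q n)) Post
        body (ρX , ρZ , wd , reachX , reachZ) =
          exec-seq (exec-ask X≢Z X-early 21 ≤! ≤! wd reachX pos-≡ (1≤pos j) lo≤)
          λ σ₁ ((ρX₁ , wd₁ , reachX₁) , v₁ , s₁) →
          exec-seq (exec-ask (λ e → X≢Z (sym e)) Z-early 22 ≤! ≤! (World-swap wd₁) reachZ (trans (s₁ ≤!) pos-≡) (1≤pos j) lo≤)
          λ σ₂ ((ρZ₂ , wd₂ , reachZ₂) , v₂ , s₂) →
          assigned (mod-+ (trans (s₂ ≤!) (trans (s₁ ≤!) pos-≡)) (trans (consts-≡ wd₂ ≤!) consts-h) (≤-<-trans hi≤ n<)) $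
          exec-seq (exec-ask X≢Z X-early 23 ≤! ≤! (World-setReg 14 ≤! ≤! (World-swap wd₂)) reachX₁ refl (≤-trans (1≤pos j) (m≤m+n (pos j) h)) hi≤)
          λ σ₃ ((ρX₃ , wd₃ , reachX₃) , v₃ , s₃) →
          exec-seq (exec-ask (λ e → X≢Z (sym e)) Z-early 24 ≤! ≤! (World-swap wd₃) reachZ₂ (s₃ ≤!) (≤-trans (1≤pos j) (m≤m+n (pos j) h)) hi≤)
          λ σ₄ ((ρZ₄ , wd₄ , reachZ₄) , v₄ , s₄) →
          assigned (mod-+ (trans (s₄ ≤!) (s₃ ≤!)) (trans (consts-≡ wd₄ ≤!) consts-h) next<) $
          finish (World-swap wd₄) reachX₃ reachZ₄
            (λ r< r≢ → trans (s₄ (<-≤-trans r< ≤!)) (trans (s₃ (<-≤-trans r< ≤!)) (trans (update-≢ {f = regs σ₂} r≢) (trans (s₂ (<-≤-trans r< ≤!)) (s₁ r<)))))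
            (trans (s₄ ≤!) (trans (s₃ ≤!) (trans (s₂ ≤!) v₁))) (trans (s₄ ≤!) (trans (s₃ ≤!) v₂)) (trans (s₄ ≤!) v₃) v₄

    exec-group : ∀ {σ} → Prepared σ → Flag a σ → regs σ 19 ≡ a → regs σ 16 ≡ b → regs σ 14 ≡ pos a →
      Exec w (forUpTo 19 16 (groupBody D X Z)) σ ((b ∸ a) * (groupBodyTime (Q n) + 8) + 4) (λ τ → Prepared τ × Flag b τ)
    exec-group prep flag c e p = exec-map (λ τ I → Inv.prep I , Inv.flag I)
      (Loop.exec-forUpTo 19 16 (≤-<-trans b≤n (≤-<-trans (≤-trans (m≤m+n n (n + 0)) (m≤m+n (2 * n) 2)) room)) 1<2^w _ (groupBodyTime (Q n))
        Inv Inv.counter Inv.last a a≤b (record { prep = prep ; flag = flag ; counter = c ; last = e ; pos-≡ = p }) step)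

-- The second branch writes the register back to itself so that both branches end in a state of the
-- literal form `setReg r (x ⊓ y) σ`; after a `skip` the state would agree with it only pointwise.
minWith : ℕ → ℕ → Prog
minWith r s = cond (op lt (reg s) (reg r)) (assign r (reg s)) (assign r (reg r))

exec-minWith : ∀ {w σ r s x y q T} {Post : State → Set} → regs σ r ≡ x → regs σ s ≡ y →
  Exec w q (setReg r (x ⊓ y) σ) T Post → Exec w (minWith r s ⨟ q) σ (6 + T) Post
exec-minWith {w} {σ} {r} {s} {x} {y} {q} {T} {Post} r≡ s≡ rest = exec-seq {Mid = λ τ → Exec w q τ T Post} min (λ _ h → h)
  where
  min : Exec w (minWith r s) σ 6 (λ τ → Exec w q τ T Post)
  min with y <? x
  ... | yes y<x = exec-cond-nonzero {T = 2} (bit-< (subst₂ _<_ (sym s≡) (sym r≡) y<x))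
        (exec-assign (trans s≡ (sym (m≥n⇒m⊓n≡n (<⇒≤ y<x)))) rest)
  ... | no y≮x  = exec-cond-zero {T = 2} (bit-≮ (λ h → y≮x (subst₂ _<_ s≡ r≡ h)))
        (exec-assign (trans r≡ (sym (m≤n⇒m⊓n≡m (≮⇒≥ y≮x)))) rest)

-- One job: a chunk against a group

list-split : ∀ {A : Set} (B : ℕ → A) a d e → list B a (d + suc e) ≡ list B a d ++ B (a + d) ∷ list B (suc (a + d)) e
list-split B a zero    e = cong (λ z → B z ∷ list B (suc z) e) (sym (+-identityʳ a))
list-split B a (suc d) e = cong (B a ∷_) (trans (list-split B (suc a) d e)
  (cong (λ z → list B (suc a) d ++ B z ∷ list B (suc z) e) (sym (+-suc a d))))

concat-list-seg : ∀ (g : ℕ → Bool) W (o : ℕ → ℕ) a d → (∀ j → a ≤ j → o (suc j) ≡ o j + W) →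
  concat (list (λ j → seg g (o j) W) a d) ≡ seg g (o a) (d * W)
concat-list-seg g W o a zero    h = refl
concat-list-seg g W o a (suc d) h = trans (cong (seg g (o a) W ++_) (trans (concat-list-seg g W o (suc a) d (λ j a<j → h j (<⇒≤ a<j)))
  (cong (λ z → seg g z (d * W)) (h a ≤-refl)))) (sym (seg-+ g (o a) W (d * W)))

concat-list-replicate : ∀ W (b : Bool) a d → concat (list (λ _ → replicate W b) a d) ≡ replicate (d * W) b
concat-list-replicate W b a zero    = refl
concat-list-replicate W b a (suc d) = trans (cong (replicate W b ++_) (concat-list-replicate W b (suc a) d)) (sym (replicate-+ W (d * W) b))

concat-replicate : ∀ W (b : Bool) d → concat (replicate d (replicate W b)) ≡ replicate (d * W) b
concat-replicate W b zero    = refl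
concat-replicate W b (suc d) = trans (cong (replicate W b ++_) (concat-replicate W b d)) (sym (replicate-+ W (d * W) b))

toVec : ∀ {n} (l : List Bool) → length l ≡ n → ∃[ S ] toList {n = n} S ≡ l
toVec l refl = fromList l , toList∘fromList l

-- `z` selects the alignment at which the text is read, `b` the bit that `Z` repeats, `g` the chunk
-- and `h` the group. Since the bounds are cut off by `minWith`, a number beyond the last chunk or
-- group gives an empty range.
jobProg : Structure → (X Z : ℕ) (z b : Bool) (g h : ℕ) → Prog
jobProg D X Z z b g h =
  assign 17 (op mul (const (bit z)) (reg 6)) ⨟
  assign 18 (op mul (const (bit b)) (reg 9)) ⨟
  assign 21 (op mul (const g) (reg 7)) ⨟ minWith 21 5 ⨟
  assign 22 (op add (reg 21) (reg 7)) ⨟ minWith 22 5 ⨟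
  assign 23 (const 0) ⨟ assign 24 (const 0) ⨟ assign 28 (const 0) ⨟
  forUpTo 21 22 (emitText X Z) ⨟
  assign 22 (op add (reg 21) (reg 4)) ⨟
  forUpTo 21 22 (emitBoth X Z shiftedWord) ⨟
  (emitBoth X Z (reg 9) ⨟ emitBoth X Z (const 0)) ⨟
  assign 14 (op add (op mul (reg 28) (reg 1)) (const 1)) ⨟
  assign 15 (op mul (const h) (reg 8)) ⨟ minWith 15 2 ⨟
  assign 16 (op add (reg 15) (reg 8)) ⨟ minWith 16 2 ⨟
  assign 19 (reg 15) ⨟
  patternsProg X Z ⨟
  prepareProg D X ⨟ prepareProg D Z ⨟
  assign 19 (reg 15) ⨟
  forUpTo 19 16 (groupBody D X Z)

module Occurrences {w n : ℕ} (𝒮 : Setting w n) where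
  open Setting 𝒮

  Found : Set
  Found = ∃[ i ] ∃[ s ] (i < k × s + m ≤ n × seg f s m ≡ pat i)

  shiftOf : Bool → ℕ
  shiftOf z = bit z * r₁

  shiftOf-≤ : ∀ z → shiftOf z ≤ r₁
  shiftOf-≤ true  = ≤-reflexive (+-identityʳ r₁)
  shiftOf-≤ false = z≤n

  chunkStart chunkEnd groupStart groupEnd : ℕ → ℕ
  chunkStart g = g * L ⊓ q
  chunkEnd g   = (chunkStart g + L) ⊓ q
  groupStart h = h * G ⊓ k
  groupEnd h   = (groupStart h + G) ⊓ k

  -- What a job is bound to notice. The first bit `not b` guarantees that the pattern has no
  -- occurrence starting in `Z`. A positive answer, in contrast, always implies `Found`, whatever
  -- the first bit is.
  DetectAt : (z b : Bool) (g : ℕ) → ℕ → Set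
  DetectAt z b g i = ∃[ s ] (chunkStart g * w + shiftOf z ≤ s × s < chunkEnd g * w + shiftOf z
    × seg f s m ≡ pat i × (∃[ P ] pat i ≡ not b ∷ P))

  -- The summands are the costs of the successive instructions of `jobProg`, nested exactly as the
  -- rules for sequencing produce them; all arithmetic is postponed to `jobTime-≤`.
  jobTime : (p t : ℕ) → ℕ
  jobTime p t = 4 + (4 + (4 + (6 + (4 + (6 + (2 + (2 + (2 + ((L * 50 + 4) + (4 + ((R * 34 + 4) + (28 + (6 + (4 + (6 + (4 + (6 + (2 +
    ((G * (bodyTime + 8) + 4) + ((2 + (2 + p)) + ((2 + (2 + p)) + (2 + (G * (groupBodyTime t + 8) + 4)))))))))))))))))))))))
    where
    blockTime = 4 + (6 + (R′ * 23 + 4 + (19 + (2 + (2 + (M * 22 + 4))))))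
    bodyTime = 2 + (blockTime + (2 + blockTime))

jobFactor : ℕ → ℕ
jobFactor ρ = 120 + 50 + 34 * ρ + (94 + 46 * ρ + 44 * (2 * ρ + 4)) + 2 + 46

module _ {w n : ℕ} (𝒮 : Setting w n) where
  open Setting 𝒮
  open Occurrences 𝒮

  -- Here `p` and `t` are the times of preprocessing and of one query, and `v` is to be the number
  -- of words of the text. For bounded `R` and `M` the time is linear in 1, `L`, `G`, `p` and
  -- `G * (1 + t)`, and each of these is at most `p + (v + 1) * (1 + t)`.
  jobTime-≤ : ∀ {ρ v} → R ≤ ρ → L ≤ v → G ≤ v → ∀ p t → jobTime p t ≤ jobFactor ρ * (p + (v + 1) * (1 + t))
  jobTime-≤ {ρ} {v} R≤ρ L≤v G≤v p t = begin
    jobTime p t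
      ≡⟨ expand L R R′ M G p t ⟩
    120 + 50 * L + 34 * R + (94 + 46 * R′ + 44 * M) * G + 2 * p + G * (4 * t + 42)
      ≤⟨ +-mono-≤ (+-mono-≤ (+-mono-≤ (+-mono-≤ (+-mono-≤
           (≤-trans (≤-reflexive (sym (*-identityʳ 120))) (*-monoʳ-≤ 120 1≤E))
           (*-monoʳ-≤ 50 (≤-trans L≤v v≤E)))
           (≤-trans (*-monoʳ-≤ 34 R≤ρ) (≤-trans (≤-reflexive (sym (*-identityʳ (34 * ρ)))) (*-monoʳ-≤ (34 * ρ) 1≤E))))
           (*-mono-≤ (+-mono-≤ (+-monoʳ-≤ 94 (*-monoʳ-≤ 46 (<⇒≤ R≤ρ))) (*-monoʳ-≤ 44 (≤-trans (≤-reflexive M≡) (+-monoˡ-≤ 4 (*-monoʳ-≤ 2 R≤ρ))))) (≤-trans G≤v v≤E)))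
           (*-monoʳ-≤ 2 (m≤m+n p ((v + 1) * (1 + t)))))
           (≤-trans (*-mono-≤ (≤-trans G≤v (m≤m+n v 1)) (4t+42≤ t)) (≤-trans (≤-reflexive (swap (v + 1) (1 + t))) (*-monoʳ-≤ 46 (m≤n+m ((v + 1) * (1 + t)) p)))) ⟩
    120 * E + 50 * E + 34 * ρ * E + (94 + 46 * ρ + 44 * (2 * ρ + 4)) * E + 2 * E + 46 * E
      ≡⟨ collect 120 50 (34 * ρ) (94 + 46 * ρ + 44 * (2 * ρ + 4)) 2 46 E ⟩
    jobFactor ρ * E ∎
    where
    open ≤-Reasoning
    E = p + (v + 1) * (1 + t)
    1≤E : 1 ≤ E
    1≤E = ≤-trans (*-mono-≤ {1} {v + 1} {1} {1 + t} (m≤n+m 1 v) (s≤s z≤n)) (m≤n+m _ p)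
    v≤E : v ≤ E
    v≤E = ≤-trans (≤-trans (m≤m+n v 1) (≤-reflexive (sym (*-identityʳ (v + 1))))) (≤-trans (*-monoʳ-≤ (v + 1) {1} {1 + t} (s≤s z≤n)) (m≤n+m _ p))
    4t+42≤ : ∀ t → 4 * t + 42 ≤ 46 * (1 + t)
    4t+42≤ t = ≤-trans (m≤m+n (4 * t + 42) (4 + 42 * t)) (≤-reflexive (lem t))
      where
      lem : ∀ t → 4 * t + 42 + (4 + 42 * t) ≡ 46 * (1 + t)
      lem = solve-∀
    swap : ∀ a b → a * (46 * b) ≡ 46 * (a * b)
    swap = solve-∀
    collect : ∀ a b c d e f x → a * x + b * x + c * x + d * x + e * x + f * x ≡ (a + b + c + d + e + f) * x
    collect = solve-∀
    expand : ∀ L R R′ M G p t →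
      4 + (4 + (4 + (6 + (4 + (6 + (2 + (2 + (2 + ((L * 50 + 4) + (4 + ((R * 34 + 4) + (28 + (6 + (4 + (6 + (4 + (6 + (2 +
        ((G * ((2 + ((4 + (6 + (R′ * 23 + 4 + (19 + (2 + (2 + (M * 22 + 4))))))) + (2 + (4 + (6 + (R′ * 23 + 4 + (19 + (2 + (2 + (M * 22 + 4)))))))))) + 8) + 4)
          + ((2 + (2 + p)) + ((2 + (2 + p)) + (2 + (G * (((2 + (t + 2)) + ((2 + (t + 2)) + (4 + ((2 + (t + 2)) + ((2 + (t + 2)) + (4 + 10)))))) + 8) + 4)))))))))))))))))))))))
      ≡ 120 + 50 * L + 34 * R + (94 + 46 * R′ + 44 * M) * G + 2 * p + G * (4 * t + 42)
    expand = solve-∀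

module Job {wf : ℕ → ℕ} {D : Structure} {P Q : ℕ → ℕ} (ans : AnswersSA⁻¹ wf D P Q) {n : ℕ} (𝒮 : Setting (wf n) n) (later : ℕ → Set)
  {X Z : ℕ} (X≢Z : X ≢ Z) (X-early : ∀ c → later c → c ≢ X) (Z-early : ∀ c → later c → c ≢ Z)
  (z b : Bool) (g h : ℕ)
  (g< : g < 2 ^ wf n) (h< : h < 2 ^ wf n) (gL< : g * Setting.L 𝒮 < 2 ^ wf n) (hG< : h * Setting.G 𝒮 < 2 ^ wf n)
  (Prior : Set)
  where

  open Setting 𝒮
  open Occurrences 𝒮
  open Arithmetic (wf n)
  open Phases 𝒮 later X≢Z X-early Z-early

  private
    w = wf n
    r = shiftOf z
    a = chunkStart g
    e = chunkEnd g
    gs = groupStart h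
    ge = groupEnd h
    zb = replicate w b
    B  = textBlock R f text-seg refl refl r

    Λ = L + (R + 2) + G * H

    Λ≤n : Λ ≤ n
    Λ≤n = ≤-trans (subst (_≤ Λ * w) (*-identityʳ Λ) (*-monoʳ-≤ Λ 1≤w)) capacity

    L≤n : L ≤ n
    L≤n = ≤-trans (≤-trans (m≤m+n L (R + 2)) (m≤m+n _ (G * H))) Λ≤n

    R+2≤n : R + 2 ≤ n
    R+2≤n = ≤-trans (≤-trans (m≤n+m (R + 2) L) (m≤m+n _ (G * H))) Λ≤n

    G≤n : G ≤ n
    G≤n = ≤-trans (≤-trans (subst (_≤ G * H) (*-identityʳ G) (*-monoʳ-≤ G (s≤s z≤n))) (m≤n+m (G * H) (L + (R + 2)))) Λ≤n

    q≤n : q ≤ n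
    q≤n = ≤-trans (subst (_≤ q * w) (*-identityʳ q) (*-monoʳ-≤ q 1≤w))
      (≤-trans (m≤m+n (q * w) r₁) (≤-trans (≤-reflexive positions) (∸-monoʳ-≤ (suc n) 1≤m)))

    a≤q : a ≤ q
    a≤q = m⊓n≤n (g * L) q

    a≤e : a ≤ e
    a≤e = ⊓-glb (m≤m+n a L) a≤q

    e≤q : e ≤ q
    e≤q = m⊓n≤n (a + L) q

    e∸a≤L : e ∸ a ≤ L
    e∸a≤L = ≤-trans (∸-monoˡ-≤ a (m⊓n≤m (a + L) q)) (≤-reflexive (m+n∸m≡n a L))

    gs≤ge : gs ≤ ge
    gs≤ge = ⊓-glb (m≤m+n gs G) (m⊓n≤n (h * G) k)

    ge≤k : ge ≤ k
    ge≤k = m⊓n≤n (gs + G) k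

    ge∸gs≤G : ge ∸ gs ≤ G
    ge∸gs≤G = ≤-trans (∸-monoˡ-≤ gs (m⊓n≤m (gs + G) k)) (≤-reflexive (m+n∸m≡n gs G))

    r≤r₁ : r ≤ r₁
    r≤r₁ = shiftOf-≤ z

    r<w : r < w
    r<w = ≤-<-trans r≤r₁ r₁<w

    Xs Ys : List (List Bool)
    Xs = list B a (e ∸ a)
    Ys = list B e R

    bX : Blocks w Xs
    bX = Blocks-list B (λ j → length-seg f (j * w + r) w) a (e ∸ a)
    bY : Blocks w Ys
    bY = Blocks-list B (λ j → length-seg f (j * w + r) w) e R

    open Matching w R 1≤w Xs Ys bX bY (length-list B e R)

    D′ = ge ∸ gs
    group = groupBlocks gs D′

    text : List (List Bool) → List (List Bool)
    text b₀ = ((b₀ ++ Ys) ++ separators) ++ group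

    length-Ys++separators : length (Ys ++ separators) ≡ R + 2
    length-Ys++separators = trans (length-++ Ys) (cong (_+ 2) (length-list B e R))

    length-front : ∀ b₀ → length ((b₀ ++ Ys) ++ separators) ≡ length b₀ + (R + 2)
    length-front b₀ = trans (cong length (++-assoc b₀ Ys separators)) (trans (length-++ b₀) (cong (length b₀ +_) length-Ys++separators))

    length-text : ∀ b₀ → length (text b₀) ≡ length b₀ + (R + 2) + D′ * H
    length-text b₀ = trans (length-++ ((b₀ ++ Ys) ++ separators)) (cong₂ _+_ (length-front b₀) (length-groupBlocks gs D′))

    shortened≤L : length shortened ≤ L
    shortened≤L = ≤-trans (length-dedupe (suc R) zeroBlock 0 Xs) (≤-trans (≤-reflexive (length-list B a (e ∸ a))) e∸a≤L)

    length-text-≤ : length (text shortened) ≤ Λ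
    length-text-≤ = ≤-trans (≤-reflexive (length-text shortened)) (+-mono-≤ (+-monoˡ-≤ (R + 2) shortened≤L) (*-monoˡ-≤ H ge∸gs≤G))

    filler : List (List Bool)
    filler = replicate (length shortened) zb

    length-filler : length filler ≡ length shortened
    length-filler = length-replicate (length shortened)

    -- These zero bits bring the string to length exactly `n`. No instruction writes them: the array
    -- of the copy is still 0 behind the written words.
    pad : ℕ
    pad = n ∸ length (text shortened) * w

    bFront : Blocks w (Ys ++ separators)
    bFront = Blocks-++ bY (length-replicate w ∷ length-replicate w ∷ [])

    bText : ∀ {b₀} → Blocks w b₀ → Blocks w (text b₀)
    bText h = Blocks-++ (Blocks-++ (Blocks-++ h bY) (length-replicate w ∷ length-replicate w ∷ [])) (Blocks-groupBlocks gs D′)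

    bShortened : Blocks w shortened
    bShortened = Blocks-dedupe (suc R) zeroBlock 0 Xs bX

    bFiller : Blocks w filler
    bFiller = lem (length shortened)
      where
      lem : ∀ d → Blocks w (replicate d zb)
      lem zero    = []
      lem (suc d) = length-replicate w ∷ lem d

    length-padded : ∀ {b₀} → Blocks w b₀ → length b₀ ≡ length shortened → length (concat (text b₀) ++ replicate pad false) ≡ n
    length-padded {b₀} bb l = trans (length-++ (concat (text b₀))) (trans (cong₂ _+_
        (trans (length-concat-Blocks (bText bb)) (cong (_* w) (trans (length-text b₀) (trans (cong (λ z → z + (R + 2) + D′ * H) l) (sym (length-text shortened))))))
        (length-replicate pad))
      (m+[n∸m]≡n (≤-trans (*-monoˡ-≤ w length-text-≤) capacity)))

    padText : List (List Bool) → List Bool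
    padText b₀ = concat (text b₀) ++ replicate pad false

    V : List Bool
    V = concat group ++ replicate pad false

    text-split : ∀ b₀ → concat (text b₀) ++ replicate pad false ≡ concat b₀ ++ C V
    text-split b₀ = begin
      concat (((b₀ ++ Ys) ++ separators) ++ group) ++ tl ≡⟨ cong (λ y → concat (y ++ group) ++ tl) (++-assoc b₀ Ys separators) ⟩
      concat ((b₀ ++ (Ys ++ separators)) ++ group) ++ tl ≡⟨ cong (λ y → concat y ++ tl) (++-assoc b₀ (Ys ++ separators) group) ⟩
      concat (b₀ ++ ((Ys ++ separators) ++ group)) ++ tl ≡⟨ cong (_++ tl) (sym (concat-++ b₀ _)) ⟩
      (concat b₀ ++ concat ((Ys ++ separators) ++ group)) ++ tl ≡⟨ ++-assoc (concat b₀) _ tl ⟩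
      concat b₀ ++ (concat ((Ys ++ separators) ++ group) ++ tl) ≡⟨ cong (λ y → concat b₀ ++ (y ++ tl)) (sym (concat-++ (Ys ++ separators) group)) ⟩
      concat b₀ ++ ((concat (Ys ++ separators) ++ concat group) ++ tl) ≡⟨ cong (concat b₀ ++_) (++-assoc (concat (Ys ++ separators)) (concat group) tl) ⟩
      concat b₀ ++ C V ∎
      where
      open ≡-Reasoning
      tl = replicate pad false

    SX SZ : Vec Bool n
    SX = proj₁ (toVec (padText shortened) (length-padded bShortened refl))
    SZ = proj₁ (toVec (padText filler) (length-padded bFiller length-filler))

    SX≡ : toList SX ≡ U V ++ C V
    SX≡ = trans (proj₂ (toVec (padText shortened) (length-padded bShortened refl))) (text-split shortened)

    SZ≡ : toList SZ ≡ concat filler ++ C V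
    SZ≡ = trans (proj₂ (toVec (padText filler) (length-padded bFiller length-filler))) (text-split filler)

    padded-text : ∀ {b₀} (bb : Blocks w b₀) (l : length b₀ ≡ length shortened) j →
      padded (map fromBits (text b₀)) j ≡ padded (packed w (toList (proj₁ (toVec (padText b₀) (length-padded bb l))))) j
    padded-text {b₀} bb l j = trans (padded-Blocks (bText bb) j pad)
      (trans (cong (λ y → fromBits (take w (drop (j * w) y))) (sym (proj₂ (toVec (padText b₀) (length-padded bb l))))) (sym (padded-packed w _ j 1≤w)))

    lengths-UZ : length (concat filler) ≡ length (U V)
    lengths-UZ = trans (length-concat-Blocks bFiller) (trans (cong (_* w) length-filler) (sym (length-concat-Blocks bShortened)))

    offset : ℕ → ℕ
    offset i = ((R + 2) + (i ∸ gs) * H) * w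

    half = (R + M) * w

    N = (w ∸ ℓ) + M * w

    concat-patternBlocks : ∀ c i → concat (patternBlocks c i) ≡ pat i ++ replicate N c
    concat-patternBlocks c i = begin
      concat (patternBlocks c i)
        ≡⟨ sym (concat-++ (list (patternWord i) (i * R) R′) _) ⟩
      concat (list (patternWord i) (i * R) R′) ++ (lastWord c i ++ concat (list (λ _ → replicate w c) 0 M))
        ≡⟨ cong₂ (λ x y → x ++ (lastWord c i ++ y)) (trans (concat-list-seg g′ w (λ j → (j ∸ i * R) * w) (i * R) R′ next-offset)
             (cong (λ y → seg g′ (y * w) (R′ * w)) (n∸n≡0 (i * R)))) (concat-list-replicate w c 0 M) ⟩
      seg g′ 0 (R′ * w) ++ ((seg g′ (R′ * w) ℓ ++ replicate (w ∸ ℓ) c) ++ replicate (M * w) c)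
        ≡⟨ cong (seg g′ 0 (R′ * w) ++_) (trans (++-assoc (seg g′ (R′ * w) ℓ) _ _) (cong (seg g′ (R′ * w) ℓ ++_) (sym (replicate-+ (w ∸ ℓ) (M * w) c)))) ⟩
      seg g′ 0 (R′ * w) ++ (seg g′ (R′ * w) ℓ ++ replicate N c)
        ≡⟨ sym (++-assoc (seg g′ 0 (R′ * w)) _ _) ⟩
      (seg g′ 0 (R′ * w) ++ seg g′ (R′ * w) ℓ) ++ replicate N c
        ≡⟨ cong (_++ replicate N c) (trans (sym (seg-+ g′ 0 (R′ * w) ℓ)) (trans (cong (seg g′ 0) (sym (trans (pat-length i) m≡))) (seg-bitAt-all (pat i)))) ⟩
      pat i ++ replicate N c ∎
      where
      open ≡-Reasoning
      g′ = bitAt (pat i)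
      next-offset : ∀ j → i * R ≤ j → (suc j ∸ i * R) * w ≡ (j ∸ i * R) * w + w
      next-offset j h = trans (cong (_* w) (+-∸-assoc 1 h)) (+-comm w ((j ∸ i * R) * w))

    module _ (i : ℕ) (gs≤i : gs ≤ i) (i<ge : i < ge) where

      private
        d = i ∸ gs
        remaining = ge ∸ suc i

        group-split : group ≡ groupBlocks gs d ++ (pairBlocks i ++ groupBlocks (suc i) remaining)
        group-split = begin
          concat (list pairBlocks gs D′) ≡⟨ cong (λ y → concat (list pairBlocks gs y)) D′≡ ⟩
          concat (list pairBlocks gs (d + suc remaining)) ≡⟨ cong concat (list-split pairBlocks gs d remaining) ⟩
          concat (list pairBlocks gs d ++ pairBlocks (gs + d) ∷ list pairBlocks (suc (gs + d)) remaining) ≡⟨ sym (concat-++ (list pairBlocks gs d) _) ⟩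
          groupBlocks gs d ++ (pairBlocks (gs + d) ++ groupBlocks (suc (gs + d)) remaining) ≡⟨ cong (λ y → groupBlocks gs d ++ (pairBlocks y ++ groupBlocks (suc y) remaining)) (m+[n∸m]≡n gs≤i) ⟩
          groupBlocks gs d ++ (pairBlocks i ++ groupBlocks (suc i) remaining) ∎
          where
          open ≡-Reasoning
          D′≡ : D′ ≡ d + suc remaining
          D′≡ = +-cancelˡ-≡ gs _ _ (trans (m+[n∸m]≡n gs≤ge) (sym (begin
            gs + (d + suc remaining) ≡⟨ sym (+-assoc gs d (suc remaining)) ⟩
            gs + d + suc remaining ≡⟨ cong (_+ suc remaining) (m+[n∸m]≡n gs≤i) ⟩
            i + suc remaining ≡⟨ +-suc i remaining ⟩
            suc i + remaining ≡⟨ m+[n∸m]≡n i<ge ⟩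
            ge ∎)))

        tail′ = concat (groupBlocks (suc i) remaining) ++ replicate pad false
        rest₁ = concat (patternBlocks true i) ++ tail′
        before = (Ys ++ separators) ++ groupBlocks gs d

        C≡ : C V ≡ concat before ++ (concat (patternBlocks false i) ++ rest₁)
        C≡ = begin
          concat (Ys ++ separators) ++ (concat group ++ tl)
            ≡⟨ cong (λ y → concat (Ys ++ separators) ++ (concat y ++ tl)) group-split ⟩
          concat (Ys ++ separators) ++ (concat (gr ++ ((pf ++ pt) ++ gr′)) ++ tl)
            ≡⟨ cong (λ y → concat (Ys ++ separators) ++ (y ++ tl)) (trans (sym (concat-++ gr _)) (cong (concat gr ++_) (trans (sym (concat-++ (pf ++ pt) gr′)) (cong (_++ concat gr′) (sym (concat-++ pf pt)))))) ⟩
          concat (Ys ++ separators) ++ ((concat gr ++ ((concat pf ++ concat pt) ++ concat gr′)) ++ tl)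
            ≡⟨ cong (concat (Ys ++ separators) ++_) (trans (++-assoc (concat gr) _ tl) (cong (concat gr ++_) (trans (++-assoc (concat pf ++ concat pt) (concat gr′) tl) (++-assoc (concat pf) (concat pt) _)))) ⟩
          concat (Ys ++ separators) ++ (concat gr ++ (concat pf ++ rest₁))
            ≡⟨ sym (++-assoc (concat (Ys ++ separators)) (concat gr) _) ⟩
          (concat (Ys ++ separators) ++ concat gr) ++ (concat pf ++ rest₁)
            ≡⟨ cong (_++ (concat pf ++ rest₁)) (concat-++ (Ys ++ separators) gr) ⟩
          concat before ++ (concat pf ++ rest₁) ∎
          where
          open ≡-Reasoning
          tl = replicate pad false
          gr = groupBlocks gs d
          gr′ = groupBlocks (suc i) remaining
          pf = patternBlocks false i
          pt = patternBlocks true i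

        length-before : length (concat before) ≡ offset i
        length-before = trans (length-concat-Blocks (Blocks-++ bFront (Blocks-groupBlocks gs d)))
          (cong (_* w) (trans (length-++ (Ys ++ separators)) (cong₂ _+_ length-Ys++separators (length-groupBlocks gs d))))

        drop-low : drop (offset i) (C V) ≡ concat (patternBlocks false i) ++ rest₁
        drop-low = trans (cong₂ drop (sym length-before) C≡) (drop-length-++ (concat before) _)

      lo≡ : drop (offset i) (C V) ≡ pat i ++ replicate N false ++ rest₁
      lo≡ = trans drop-low (trans (cong (_++ rest₁) (concat-patternBlocks false i)) (++-assoc (pat i) _ _))

      hi≡ : drop (offset i + half) (C V) ≡ pat i ++ replicate N true ++ tail′
      hi≡ = trans (sym (drop-drop (offset i) half (C V))) (trans (cong (drop half) drop-low)
        (trans (trans (cong (λ y → drop y (concat (patternBlocks false i) ++ rest₁)) (sym (trans (length-concat-Blocks (Blocks-patternBlocks false i)) (cong (_* w) (length-patternBlocks false i)))))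
          (drop-length-++ (concat (patternBlocks false i)) rest₁))
        (trans (cong (_++ tail′) (concat-patternBlocks true i)) (++-assoc (pat i) _ _))))

      longN : (2 * R + 4) * w ≤ N
      longN = subst (λ y → y * w ≤ N) M≡ (m≤n+m (M * w) (w ∸ ℓ))

      short : length (pat i) ≤ R * w
      short = subst (_≤ R * w) (sym (trans (pat-length i) m≡)) (subst (R′ * w + ℓ ≤_) (+-comm (R′ * w) w) (+-monoʳ-≤ (R′ * w) ℓ≤w))

      private
        concat-XY : concat Xs ++ concat Ys ≡ seg f (a * w + r) ((e ∸ a) * w + R * w)
        concat-XY = trans (cong₂ _++_ (concat-list-seg f w (λ j → j * w + r) a (e ∸ a) next-offset) (concat-list-seg f w (λ j → j * w + r) e R next-offset))
          (trans (cong (λ y → seg f (a * w + r) ((e ∸ a) * w) ++ seg f y (R * w)) e-offset) (sym (seg-+ f (a * w + r) ((e ∸ a) * w) (R * w))))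
          where
          next-offset : ∀ {a} j → a ≤ j → suc j * w + r ≡ j * w + r + w
          next-offset j _ = arith w (j * w) r
            where
            arith : ∀ x y z → x + y + z ≡ y + z + x
            arith = solve-∀
          e-offset : e * w + r ≡ a * w + r + (e ∸ a) * w
          e-offset = trans (cong (λ y → y * w + r) (sym (m+[n∸m]≡n a≤e))) (arith a (e ∸ a) w r)
            where
            arith : ∀ a d w r → (a + d) * w + r ≡ a * w + r + d * w
            arith = solve-∀

        length-Xs : length (concat Xs) ≡ (e ∸ a) * w
        length-Xs = trans (length-concat-Blocks bX) (cong (_* w) (length-list B a (e ∸ a)))

        window : ∀ {o} → o < (e ∸ a) * w → take (length (pat i)) (drop o (concat Xs ++ concat Ys)) ≡ seg f (a * w + r + o) m
        window {o} o< = trans (cong₂ (λ x y → take x (drop o y)) (pat-length i) concat-XY)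
          (take-drop-seg f (a * w + r) ((e ∸ a) * w + R * w) o m (+-mono-≤ (<⇒≤ o<) (subst (_≤ R * w) (pat-length i) short)))

      occurs⇒found : Occurs (pat i) (concat Xs) (concat Ys) → Found
      occurs⇒found (o , o< , occ) = i , a * w + r + o , <-≤-trans i<ge ge≤k , fits , trans (sym (window o<′)) occ
        where
        o<′ = subst (o <_) length-Xs o<
        -- `Ys` may reach past the end of the text, where the memory is 0. The occurrence
        -- nevertheless lies within the text, because it starts before `q * w + r₁ = suc n ∸ m`.
        fits : a * w + r + o + m ≤ n
        fits = s≤s⁻¹ (begin
          suc (a * w + r + o) + m ≡⟨ cong (_+ m) (arith (a * w) r o) ⟩
          a * w + suc o + r + m ≤⟨ +-monoˡ-≤ m (+-mono-≤ (+-monoʳ-≤ (a * w) o<′) r≤r₁) ⟩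
          a * w + (e ∸ a) * w + r₁ + m ≡⟨ cong (λ y → y + r₁ + m) (trans (sym (*-distribʳ-+ w a (e ∸ a))) (cong (_* w) (m+[n∸m]≡n a≤e))) ⟩
          e * w + r₁ + m ≤⟨ +-monoˡ-≤ m (+-monoˡ-≤ r₁ (*-monoˡ-≤ w e≤q)) ⟩
          q * w + r₁ + m ≡⟨ cong (_+ m) positions ⟩
          suc n ∸ m + m ≡⟨ m∸n+n≡m (m≤n⇒m≤1+n m≤n) ⟩
          suc n ∎)
          where
          open ≤-Reasoning
          arith : ∀ x r o → suc (x + r + o) ≡ x + suc o + r
          arith = solve-∀

      detect⇒occurs : DetectAt z b g i → Occurs (pat i) (concat Xs) (concat Ys)
      detect⇒occurs (s , a≤s , s<e , seg≡ , _) with m≤n⇒∃[o]m+o≡n a≤s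
      ... | o , refl = o , subst (o <_) (sym length-Xs) o<′ , trans (window o<′) seg≡
        where
        o<′ : o < (e ∸ a) * w
        o<′ = +-cancelˡ-< (a * w + r) _ _ (subst (a * w + r + o <_) (trans (cong (λ y → y * w + r) (sym (m+[n∸m]≡n a≤e))) (arith a (e ∸ a) w r)) s<e)
          where
          arith : ∀ a d w r → (a + d) * w + r ≡ a * w + r + d * w
          arith = solve-∀

  private
    pos : ℕ → ℕ
    pos i = suc (length (U V) + offset i)

    length-U : length (U V) ≡ length shortened * w
    length-U = length-concat-Blocks bShortened

    half≥1 : 1 ≤ half
    half≥1 = *-mono-≤ {1} {R + M} {1} {w} (s≤s z≤n) 1≤w

    pos+half≤ : ∀ i → gs ≤ i → i < ge → pos i + half ≤ n
    pos+half≤ i gs≤i i<ge = begin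
      suc (length (U V) + offset i) + half ≡⟨ cong (λ y → suc (y + offset i) + half) length-U ⟩
      suc (u * w + ((R + 2) + d * H) * w) + half ≤⟨ +-monoˡ-≤ half (+-monoˡ-≤ _ half≥1) ⟩
      (half + (u * w + ((R + 2) + d * H) * w)) + half ≡⟨ arith (R + M) w u (R + 2) (d * H) ⟩
      (u + (R + 2) + (H + d * H)) * w ≤⟨ *-monoˡ-≤ w (+-mono-≤ (+-monoˡ-≤ (R + 2) shortened≤L) (*-monoˡ-≤ H (≤-trans (∸-monoˡ-< i<ge gs≤i) ge∸gs≤G))) ⟩
      Λ * w ≤⟨ capacity ⟩
      n ∎
      where
      open ≤-Reasoning
      u = length shortened
      d = i ∸ gs
      arith : ∀ s w u v x → (s * w + (u * w + (v + x) * w)) + s * w ≡ (u + v + ((s + (s + 0)) + x)) * w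
      arith = solve-∀

    pos-suc : ∀ i → gs ≤ i → pos (suc i) ≡ pos i + half + half
    pos-suc i gs≤i = trans (cong (λ y → suc (length (U V) + ((R + 2) + y * H) * w)) (+-∸-assoc 1 gs≤i)) (arith (length (U V)) (R + 2) (R + M) ((i ∸ gs) * H) w)
      where
      arith : ∀ u v s x w → suc (u + (v + ((s + (s + 0)) + x)) * w) ≡ suc (u + (v + x) * w) + s * w + s * w
      arith = solve-∀

    ge≤n : ge ≤ n
    ge≤n = ≤-trans ge≤k k≤n

    rank-split : ∀ {b₀} {S : Vec Bool n} → toList S ≡ concat b₀ ++ C V → ∀ i c →
      SA⁻¹ (toList S) (pos i + c) ≡ SA⁻¹ (concat b₀ ++ C V) (suc (length (U V) + (offset i + c)))
    rank-split S≡ i c = cong₂ SA⁻¹ S≡ (cong suc (+-assoc (length (U V)) (offset i) c))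

    rank-split₀ : ∀ {b₀} {S : Vec Bool n} → toList S ≡ concat b₀ ++ C V → ∀ i →
      SA⁻¹ (toList S) (pos i) ≡ SA⁻¹ (concat b₀ ++ C V) (suc (length (U V) + offset i))
    rank-split₀ S≡ i = cong (λ y → SA⁻¹ y (pos i)) S≡

    open Group ans 2≤n consts textMem patMem refl refl later room X≢Z X-early Z-early
      SX SZ gs≤ge ge≤n pos refl (λ _ → s≤s z≤n) pos+half≤ pos-suc Found Prior (DetectAt z b g)

    module _ (i : ℕ) (gs≤i : gs ≤ i) (i<ge : i < ge) where

      private
        Z′ = concat filler

        left : SA⁻¹ (toList SZ) (pos i + half) + SA⁻¹ (toList SX) (pos i)
          ≡ SA⁻¹ (Z′ ++ C V) (suc (length (U V) + (offset i + half))) + SA⁻¹ (U V ++ C V) (suc (length (U V) + offset i))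
        left = cong₂ _+_ (rank-split {filler} {SZ} SZ≡ i half) (rank-split₀ {shortened} {SX} SX≡ i)

        right : SA⁻¹ (toList SX) (pos i + half) + SA⁻¹ (toList SZ) (pos i)
          ≡ SA⁻¹ (U V ++ C V) (suc (length (U V) + (offset i + half))) + SA⁻¹ (Z′ ++ C V) (suc (length (U V) + offset i))
        right = cong₂ _+_ (rank-split {shortened} {SX} SX≡ i half) (rank-split₀ {filler} {SZ} SZ≡ i)

      sound : Test i → Found
      sound t = occurs⇒found i gs≤i i<ge (detect-sound V (pat i) (short i gs≤i i<ge) N (offset i) (offset i + half) _ _ (longN i gs≤i i<ge)
        (lo≡ i gs≤i i<ge) (hi≡ i gs≤i i<ge) Z′ lengths-UZ (subst₂ _<_ left right t))

      complete : ¬ Test i → ¬ DetectAt z b g i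
      complete ¬t det@(_ , _ , _ , _ , P′ , pat≡) = ¬t (subst₂ _<_ (sym left) (sym right)
        (detect-complete V (pat i) (short i gs≤i i<ge) N (offset i) (offset i + half) _ _ (longN i gs≤i i<ge)
          (lo≡ i gs≤i i<ge) (hi≡ i gs≤i i<ge) Z′ lengths-UZ
          (subst₂ (λ x y → ¬ Occurs x y (C V)) (sym pat≡)
            (trans (cong (replicate _) (Bool.not-involutive b)) (sym (concat-replicate w b (length shortened))))
            (¬Occurs-replicate (not b) P′ (length shortened * w) (C V)))
          (detect⇒occurs i gs≤i i<ge det)))

    fill-≡ : ∀ b → bit b * (2 ^ w ∸ 1) ≡ fromBits (replicate w b)
    fill-≡ true  = trans (+-identityʳ _) (sym (fromBits-true w))
    fill-≡ false = sym (fromBits-false w)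

    r₁<2^w : r₁ < 2 ^ w
    r₁<2^w = <-trans r₁<w (n<2^n w)

  exec-job : ∀ {σ} → World X Z zeroState zeroState σ → (regs σ 13 ≡ 1 × Found) ⊎ (regs σ 13 ≡ 0 × Prior) →
    Exec w (jobProg D X Z z b g h) σ (jobTime (P n) (Q n)) (λ τ → Prepared τ × Flag ge τ)
  exec-job {σ} wd₀ flag₀ =
    assigned {v = r} (mod-* (mod-small (<-trans (bit<2 z) 2<2^w)) (consts-≡ wd₀ {6} ≤!) (≤-<-trans r≤r₁ r₁<2^w)) $
    assigned {v = fromBits zb}
      (trans (mod-* (mod-small (<-trans (bit<2 b) 2<2^w)) (consts-≡ wd₀ {9} ≤!) (subst (_< 2 ^ w) (sym (fill-≡ b)) zb<)) (fill-≡ b)) $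
    assigned {v = g * L} (mod-* (mod-small g<) (consts-≡ wd₀ {7} ≤!) gL<) $
    exec-minWith refl (consts-≡ wd₀ {5} ≤!) $
    assigned {v = a + L} (mod-+ refl (consts-≡ wd₀ {7} ≤!) (<2^w (two (≤-trans a≤q q≤n) L≤n))) $
    exec-minWith refl (consts-≡ wd₀ {5} ≤!) $
    assigned (mod-small (2^>0 w)) $
    assigned (mod-small (2^>0 w)) $
    assigned (mod-small (2^>0 w)) $
    exec-seq (exec-≤ (+-monoˡ-≤ 4 (*-monoˡ-≤ 50 e∸a≤L))
      (exec-emitText R f text-seg refl refl zb a≤e r<w bd₁ refl refl refl refl refl refl (<2^w (≤-trans (s≤s (≤-trans e≤q q≤n)) 1+n≤))
        (<2^w (n≤ (≤-trans (subst (suc R ≤_) (+-comm 2 R) (s≤s (n≤1+n R))) R+2≤n)))))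
    λ σ₁ (bd₁′ , s₁ , e≡) →
    assigned {v = e + R} (mod-+ e≡ (consts-≡ (world bd₁′) {4} ≤!) e+R<) $
    exec-seq (exec-≤ (≤-reflexive (cong (λ y → y * 34 + 4) (m+n∸m≡n e R)))
      (exec-emitLoop shiftedWord B (m≤m+n e R) e+R< (Building-setReg 22 ≤! ≤! bd₁′) e≡ refl
        (subst (λ y → length shortened + y < 2 ^ w) (sym (m+n∸m≡n e R)) (<2^w (two (≤-trans shortened≤L L≤n) (≤-trans (m≤m+n R 2) R+2≤n))))
        (λ {j} _ j< wd s j≡ → eval-shiftedWord R f text-seg refl refl wd j≡ (trans (s {17} ≤!) (s₁ {17} ≤!)) r<w (≤-<-trans j< e+R<))))
    λ σ₂ (bd₂ , s₂ , _) →
    exec-seq (exec-separators {shortened ++ Ys} {filler ++ Ys} (subst (λ y → Building (shortened ++ list B e y) (filler ++ list B e y) σ₂) (m+n∸m≡n e R) bd₂)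
      (≤-<-trans (≤-trans (≤-reflexive (trans (cong (2 +_) (trans (length-++ shortened) (cong (length shortened +_) (length-list B e R)))) (arith (length shortened) R)))
        (≤-trans (m≤m+n _ (D′ * H)) (≤-reflexive (sym (length-text shortened))))) text<))
    λ σ₃ (bd₃ , s₃) →
    assigned {v = pos gs}
      (trans (mod-+ (mod-* (trans (pointer bd₃) (length-front shortened)) (consts-≡ (world bd₃) {1} ≤!) (<2^w (n≤ front≤))) (mod-small 1<2^w)
        (<2^w (≤-trans (+-monoˡ-≤ 1 front≤) (≤-trans (≤-reflexive (+-comm n 1)) 1+n≤)))) pos-start) $
    assigned {v = h * G} (mod-* (mod-small h<) (consts-≡ (world bd₃) {8} ≤!) hG<) $
    exec-minWith refl (consts-≡ (world bd₃) {2} ≤!) $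
    assigned {v = gs + G} (mod-+ refl (consts-≡ (world bd₃) {8} ≤!) (<2^w (two (≤-trans gs≤ge ge≤n) G≤n))) $
    exec-minWith refl (consts-≡ (world bd₃) {2} ≤!) $
    assigned {v = gs} refl $
    exec-seq (exec-≤ (+-monoˡ-≤ 4 (*-monoˡ-≤ _ ge∸gs≤G))
      (exec-patterns gs≤ge ge≤k (Building-setReg 19 ≤! ≤! (Building-setReg 16 ≤! ≤! (Building-setReg 16 ≤! ≤! (Building-setReg 15 ≤! ≤! (Building-setReg 15 ≤! ≤! (Building-setReg 14 ≤! ≤! bd₃))))))
        refl refl (subst (_< 2 ^ w) (length-++ᵍ shortened) text<)))
    λ σ₄ (bd₄ , s₄) →
    exec-seq (Calls.exec-prepare ans 2≤n consts textMem patMem refl refl later X≢Z X-early SX (world bd₄) (padded-text bShortened refl))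
    λ σ₅ ((ρX , wd₅ , reachX) , s₅) →
    exec-seq (Calls.exec-prepare ans 2≤n consts textMem patMem refl refl later (λ x → X≢Z (sym x)) Z-early SZ (World-swap wd₅) (padded-text bFiller length-filler))
    λ σ₆ ((ρZ , wd₆ , reachZ) , s₆) →
    assigned {v = gs} (trans (s₆ {15} ≤!) (trans (s₅ {15} ≤!) (s₄ {15} ≤!))) $
    exec-≤ (+-monoˡ-≤ 4 (*-monoˡ-≤ _ ge∸gs≤G))
      (exec-group sound complete (ρX , ρZ , World-setReg 19 ≤! ≤! (World-swap wd₆) , reachX , reachZ)
        (start-flag (trans (s₆ {13} ≤!) (trans (s₅ {13} ≤!) (trans (s₄ {13} ≤!) (trans (s₃ {13} ≤!) (trans (s₂ {13} ≤!) (s₁ {13} ≤!)))))) flag₀)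
        refl (trans (s₆ {16} ≤!) (trans (s₅ {16} ≤!) (s₄ {16} ≤!))) (trans (s₆ {14} ≤!) (trans (s₅ {14} ≤!) (s₄ {14} ≤!))))
    where
    zb< : fromBits zb < 2 ^ w
    zb< = subst (λ y → fromBits zb < 2 ^ y) (length-replicate w) (fromBits-< zb)
    two : ∀ {x y} → x ≤ n → y ≤ n → x + y ≤ 2 * n + 2
    two p q = ≤-trans (+-mono-≤ p q) (≤-trans (≤-reflexive (cong (n +_) (sym (+-identityʳ n)))) (m≤m+n (2 * n) 2))
    e+R< : e + R < 2 ^ w
    e+R< = <2^w (two (≤-trans e≤q q≤n) (≤-trans (m≤m+n R 2) R+2≤n))
    text< : length (text shortened) < 2 ^ w
    text< = <2^w (n≤ (≤-trans length-text-≤ Λ≤n))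
    arith : ∀ u R → 2 + (u + R) ≡ u + (R + 2)
    arith = solve-∀
    front≤ : (length shortened + (R + 2)) * w ≤ n
    front≤ = ≤-trans (*-monoˡ-≤ w (≤-trans (m≤m+n _ (D′ * H)) (≤-trans (≤-reflexive (sym (length-text shortened))) length-text-≤))) capacity
    pos-start : (length shortened + (R + 2)) * w + 1 ≡ pos gs
    pos-start = trans (+-comm _ 1) (cong suc (trans (*-distribʳ-+ w (length shortened) (R + 2)) (cong₂ _+_ (sym length-U)
      (cong (_* w) (trans (sym (+-identityʳ (R + 2))) (cong (λ y → R + 2 + y * H) (sym (n∸n≡0 gs))))))))
    length-++ᵍ : ∀ b₀ → length (text b₀) ≡ length ((b₀ ++ Ys) ++ separators) + D′ * H
    length-++ᵍ b₀ = trans (length-++ ((b₀ ++ Ys) ++ separators)) (cong (length ((b₀ ++ Ys) ++ separators) +_) (length-groupBlocks gs D′))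
    bd₁ = building {bx = []} {bz = []} (World-setReg 28 ≤! ≤! (World-setReg 24 ≤! ≤! (World-setReg 23 ≤! ≤! (World-setReg 22 {e} ≤! ≤! (World-setReg 22 {a + L} ≤! ≤!
      (World-setReg 21 {a} ≤! ≤! (World-setReg 21 {g * L} ≤! ≤! (World-setReg 18 {fromBits zb} ≤! ≤! (World-setReg 17 {r} ≤! ≤!
        (World-swap (CZ.World-≈ textState-[] (World-swap (CX.World-≈ textState-[] wd₀))))))))))))) refl refl
    start-flag : ∀ {x} → x ≡ regs σ 13 → (regs σ 13 ≡ 1 × Found) ⊎ (regs σ 13 ≡ 0 × Prior) →
      (x ≡ 1 × Found) ⊎ (x ≡ 0 × Prior × (∀ i → gs ≤ i → i < gs → ¬ DetectAt z b g i))
    start-flag x≡ (inj₁ (f≡ , found)) = inj₁ (trans x≡ f≡ , found)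
    start-flag x≡ (inj₂ (f≡ , prior)) = inj₂ (trans x≡ f≡ , prior , λ i gs≤i i<gs → contradiction i<gs (≤⇒≯ gs≤i))

-- All pairs of a chunk and a group

Task : Set
Task = Bool × Bool × ℕ × ℕ

-- The factors are the alignments, the bits of `Z`, the chunks and the groups. Their number depends
-- on `H` alone, so one finite program, with finitely many copies, serves all `n`.
tasks : ℕ → List Task
tasks H = cartesianProduct (false ∷ true ∷ []) (cartesianProduct (false ∷ true ∷ []) (cartesianProduct (upTo 8) (upTo H)))

∈-tasks⁺ : ∀ {H} z b {g h} → g < 8 → h < H → (z , b , g , h) ∈ tasks H
∈-tasks⁺ z b g<8 h<H = ∈-cartesianProduct⁺ (both z) (∈-cartesianProduct⁺ (both b) (∈-cartesianProduct⁺ (∈-upTo⁺ g<8) (∈-upTo⁺ h<H)))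
  where
  both : ∀ b → b ∈ false ∷ true ∷ []
  both false = here refl
  both true  = there (here refl)

∈-tasks⁻ : ∀ {H z b g h} → (z , b , g , h) ∈ tasks H → g < 8 × h < H
∈-tasks⁻ {H} t∈ with ∈-cartesianProduct⁻ (upTo 8) (upTo H) (proj₂ (∈-cartesianProduct⁻ (false ∷ true ∷ []) _
    (proj₂ (∈-cartesianProduct⁻ (false ∷ true ∷ []) _ t∈))))
... | g∈ , h∈ = ∈-upTo⁻ g∈ , ∈-upTo⁻ h∈

-- Each job needs two copies of the structure with untouched memory, numbered from c on.
jobs : Structure → (c : ℕ) → List Task → Prog
jobs D c []                     = skip
jobs D c ((z , b , g , h) ∷ ts) = jobProg D c (suc c) z b g h ⨟ jobs D (2 + c) ts

module Jobs {wf : ℕ → ℕ} {D : Structure} {P Q : ℕ → ℕ} (ans : AnswersSA⁻¹ wf D P Q) {n : ℕ} (𝒮 : Setting (wf n) n) where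

  open Setting 𝒮
  open Occurrences 𝒮

  private
    w = wf n

  record Base (c : ℕ) (σ : State) : Set where
    field
      consts-≡  : ∀ {r} → r < 13 → regs σ r ≡ consts r
      text-≡    : ∀ j → mem σ 0 j ≡ textMem j
      pat-≡     : ∀ j → mem σ 1 j ≡ patMem j
      untouched : ∀ {d} → c ≤ d → Sim (copy d) σ zeroState

  NoDetect : Task → Set
  NoDetect (z , b , g , h) = ∀ i → groupStart h ≤ i → i < groupEnd h → ¬ DetectAt z b g i

  Fits : Task → Set
  Fits (_ , _ , g , h) = g < 2 ^ w × h < 2 ^ w × g * L < 2 ^ w × h * G < 2 ^ w

  -- `Prior` is arbitrary so that the recursive call can take over what the first job has excluded.
  -- Each job uses up two blank copies.
  exec-jobs : ∀ ts → All Fits ts → (Prior : Set) → ∀ c {σ} → Base c σ → (regs σ 13 ≡ 1 × Found) ⊎ (regs σ 13 ≡ 0 × Prior) →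
    Exec w (jobs D c ts) σ (length ts * jobTime (P n) (Q n) + 1)
      (λ τ → (regs τ 13 ≡ 1 × Found) ⊎ (regs τ 13 ≡ 0 × Prior × All NoDetect ts))
  exec-jobs [] [] Prior c base flag = exec-skip (end flag)
    where
    end : ∀ {x} → (x ≡ 1 × Found) ⊎ (x ≡ 0 × Prior) → (x ≡ 1 × Found) ⊎ (x ≡ 0 × Prior × All NoDetect [])
    end (inj₁ p)       = inj₁ p
    end (inj₂ (p , q)) = inj₂ (p , q , [])
  exec-jobs (t@(z , b , g , h) ∷ ts) ((g< , h< , gL< , hG<) ∷ fits) Prior c {σ} base flag =
    exec-≤ (≤-reflexive (sym (+-assoc (jobTime (P n) (Q n)) _ 1))) $
    exec-seq (Job.exec-job ans 𝒮 later (λ e → 1+n≢n (sym e)) early early′ z b g h g< h< gL< hG< Prior start flag)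
    λ τ ((_ , _ , wd , _) , flag′) → exec-map (λ υ → finish)
      (exec-jobs ts fits (Prior × NoDetect t) (2 + c) (next-base wd) (next-flag flag′))
    where
    later : ℕ → Set
    later d = 2 + c ≤ d
    early : ∀ d → later d → d ≢ c
    early d l refl = <⇒≱ (n≤1+n (suc c)) l
    early′ : ∀ d → later d → d ≢ suc c
    early′ d l refl = <-irrefl refl l
    open Worlds consts textMem patMem later
    start : World c (suc c) zeroState zeroState σ
    start = record { consts-≡ = Base.consts-≡ base ; text-≡ = Base.text-≡ base ; pat-≡ = Base.pat-≡ base
      ; simX = Base.untouched base ≤-refl ; simZ = Base.untouched base (n≤1+n c) ; untouched = λ l → Base.untouched base (≤-trans (≤-trans (n≤1+n c) (n≤1+n (suc c))) l) }
    next-base : ∀ {ρX ρZ τ} → World c (suc c) ρX ρZ τ → Base (2 + c) τ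
    next-base wd = record { consts-≡ = World.consts-≡ wd ; text-≡ = World.text-≡ wd ; pat-≡ = World.pat-≡ wd ; untouched = World.untouched wd }
    next-flag : ∀ {x} → (x ≡ 1 × Found) ⊎ (x ≡ 0 × Prior × NoDetect t) → (x ≡ 1 × Found) ⊎ (x ≡ 0 × (Prior × NoDetect t))
    next-flag f = f
    finish : ∀ {x} → (x ≡ 1 × Found) ⊎ (x ≡ 0 × (Prior × NoDetect t) × All NoDetect ts) → (x ≡ 1 × Found) ⊎ (x ≡ 0 × Prior × All NoDetect (t ∷ ts))
    finish (inj₁ p)                   = inj₁ p
    finish (inj₂ (p , (q , nd) , al)) = inj₂ (p , q , nd ∷ al)

  module _ (H : ℕ) (q≤8L : q ≤ 8 * L) (1≤L : 1 ≤ L) (1≤G : 1 ≤ G) (k≤HG : k ≤ H * G) where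

    private
      instance
        L-nonZero : NonZero L
        L-nonZero = >-nonZero 1≤L
        G-nonZero : NonZero G
        G-nonZero = >-nonZero 1≤G
        w-nonZero : NonZero w
        w-nonZero = >-nonZero 1≤w

      quotient-< : ∀ i d .{{_ : NonZero d}} → i < (i / d) * d + d
      quotient-< i d = subst (_< (i / d) * d + d) (sym (m≡m%n+[m/n]*n i d)) (subst (_< (i / d) * d + d) (+-comm ((i / d) * d) (i % d)) (+-monoʳ-< ((i / d) * d) (m%n<n i d)))

      in-group : ∀ i → i < k → i / G < H × groupStart (i / G) ≤ i × i < groupEnd (i / G)
      in-group i i<k = *-cancelʳ-< G _ _ (≤-<-trans (m/n*n≤m i G) (<-≤-trans i<k k≤HG))
        , ≤-trans (m⊓n≤m _ k) (m/n*n≤m i G)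
        , ⊓-pres-m< (subst (λ x → i < x + G) (sym (m≤n⇒m⊓n≡m (≤-trans (m/n*n≤m i G) (<⇒≤ i<k)))) (quotient-< i G)) i<k

      in-chunk : ∀ s → s < q * w → ∃[ g ] (g < 8 × chunkStart g * w ≤ s × s < chunkEnd g * w)
      in-chunk s s<qw = g , *-cancelʳ-< L _ _ (≤-<-trans (m/n*n≤m j L) (<-≤-trans j<q q≤8L))
        , ≤-trans (*-monoˡ-≤ w (≤-trans (m⊓n≤m (g * L) q) (m/n*n≤m j L))) (m/n*n≤m s w)
        , <-≤-trans (subst (s <_) (+-comm (j * w) w) (quotient-< s w))
            (*-monoˡ-≤ w (⊓-pres-m< (subst (λ x → j < x + L) (sym (m≤n⇒m⊓n≡m (≤-trans (m/n*n≤m j L) (<⇒≤ j<q)))) (quotient-< j L)) j<q))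
        where
        j = s / w
        j<q : j < q
        j<q = *-cancelʳ-< w _ _ (≤-<-trans (m/n*n≤m s w) s<qw)
        g = j / L

      split-pat : ∀ i → ∃[ b ] ∃[ p ] pat i ≡ not b ∷ p
      split-pat i with pat i | pat-length i
      ... | []    | refl = contradiction 1≤m λ ()
      ... | x ∷ p | _    = not x , p , cong (_∷ p) (sym (Bool.not-involutive x))

      -- Positions below `q * w` are met when the text is read from 0. Any other position is at
      -- least `w`, hence above `r₁`, and lies less than `q * w` behind `r₁`, so it is met when the
      -- text is read from `r₁`.
      in-shifted : ∀ s → s + m ≤ n → ∃[ z ] ∃[ g ] (g < 8 × chunkStart g * w + shiftOf z ≤ s × s < chunkEnd g * w + shiftOf z)
      in-shifted s s+m≤n with s <? q * w
      ... | yes s<qw with in-chunk s s<qw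
      ...   | g , g<8 , lo , hi = false , g , g<8 , subst (_≤ s) (sym (+-identityʳ _)) lo , subst (s <_) (sym (+-identityʳ _)) hi
      in-shifted s s+m≤n | no s≮qw with m≤n⇒∃[o]m+o≡n r₁≤s
        where
        r₁≤s : r₁ ≤ s
        r₁≤s = ≤-trans (<⇒≤ r₁<w) (≤-trans (subst (_≤ q * w) (*-identityˡ w) (*-monoˡ-≤ w 1≤q)) (≮⇒≥ s≮qw))
      ... | s′ , refl with in-chunk s′ (+-cancelˡ-< r₁ _ _ (subst (r₁ + s′ <_) (trans (sym positions) (+-comm (q * w) r₁)) (m+n≤o⇒m≤o∸n (suc (r₁ + s′)) (s≤s s+m≤n))))
      ...   | g , g<8 , lo , hi = true , g , g<8
            , subst (_≤ r₁ + s′) (trans (+-comm r₁ _) (cong (chunkStart g * w +_) (sym (+-identityʳ r₁)))) (+-monoʳ-≤ r₁ lo)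
            , subst (r₁ + s′ <_) (trans (+-comm r₁ _) (cong (chunkEnd g * w +_) (sym (+-identityʳ r₁)))) (+-monoʳ-< r₁ hi)

    ¬Found : All NoDetect (tasks H) → ¬ Found
    ¬Found none (i , s , i<k , s+m≤n , seg≡) with in-group i i<k | in-shifted s s+m≤n | split-pat i
    ... | h<H , gs≤i , i<ge | z , g , g<8 , lo , hi | b , p , pat≡ =
      All.lookup none (∈-tasks⁺ z b g<8 h<H) i gs≤i i<ge (s , lo , hi , seg≡ , p , pat≡)

-- Division with remainder

div-mod : ∀ x y → x div y * y + x mod y ≤ x
div-mod x zero    = z≤n
div-mod x (suc y) = ≤-reflexive (trans (+-comm (x / suc y * suc y) (x % suc y)) (sym (m≡m%n+[m/n]*n x (suc y))))

div-mod-≡ : ∀ x {y} → 1 ≤ y → x div y * y + x mod y ≡ x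
div-mod-≡ x {suc y} _ = trans (+-comm (x / suc y * suc y) (x % suc y)) (sym (m≡m%n+[m/n]*n x (suc y)))

div-* : ∀ x y → x div y * y ≤ x
div-* x y = ≤-trans (m≤m+n (x div y * y) (x mod y)) (div-mod x y)

<-suc-div-* : ∀ x {y} → 1 ≤ y → x < suc (x div y) * y
<-suc-div-* x {y} 1≤y = subst (_< suc (x div y) * y) (div-mod-≡ x 1≤y)
  (subst (x div y * y + x mod y <_) (+-comm (x div y * y) y) (+-monoʳ-< (x div y * y) (mod-< x 1≤y)))

≤-div : ∀ {x y z} → 1 ≤ y → z * y ≤ x → z ≤ x div y
≤-div {x} {y} {z} 1≤y h = s≤s⁻¹ (*-cancelʳ-< y z (suc (x div y)) (≤-<-trans h (<-suc-div-* x 1≤y)))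

1≤packedLength : ∀ {w m} → 1 ≤ w → 1 ≤ m → 1 ≤ packedLength w m
1≤packedLength {w} {m} 1≤w 1≤m = ≤-div 1≤w (subst (_≤ m + (w ∸ 1)) (sym (+-identityʳ w))
  (subst (_≤ m + (w ∸ 1)) (m+[n∸m]≡n 1≤w) (+-monoˡ-≤ (w ∸ 1) 1≤m)))

-- Occurrences as infixes

module _ {A : Set} where

  infix⇒position : ∀ {P T : List A} → Infix _≡_ P T → ∃[ s ] (s + length P ≤ length T × take (length P) (drop s T) ≡ P)
  infix⇒position (here p) = 0 , prefix p
    where
    prefix : ∀ {P T : List A} → Prefix _≡_ P T → length P ≤ length T × take (length P) T ≡ P
    prefix []         = z≤n , refl
    prefix (refl ∷ p) with prefix p
    ... | h , e = s≤s h , cong (_ ∷_) e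
  infix⇒position (there i) with infix⇒position i
  ... | s , h , e = suc s , s≤s h , e

  position⇒infix : ∀ {P T : List A} s → take (length P) (drop s T) ≡ P → Infix _≡_ P T
  position⇒infix {[]}    {T}     s       e = here []
  position⇒infix {x ∷ P} {[]}    zero    ()
  position⇒infix {x ∷ P} {[]}    (suc s) ()
  position⇒infix {x ∷ P} {y ∷ T} zero    e = here (prefix (x ∷ P) (y ∷ T) e)
    where
    prefix : ∀ P (T : List A) → take (length P) T ≡ P → Prefix _≡_ P T
    prefix []      T       e    = []
    prefix (x ∷ P) (y ∷ T) e with ∷-injective e
    ... | y≡x , e′ = sym y≡x ∷ prefix P T e′
  position⇒infix {x ∷ P} {y ∷ T} (suc s) e = there (position⇒infix s e)

  any⇒nth : ∀ {P : A → Set} {k} d (xs : Vec A k) → Any P xs → ∃[ i ] (i < k × P (nth d (toList xs) i))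
  any⇒nth d (x ∷ xs) (here px) = 0 , s≤s z≤n , px
  any⇒nth d (x ∷ xs) (there a) with any⇒nth d xs a
  ... | i , i<k , p = suc i , s≤s i<k , p

  nth⇒any : ∀ {P : A → Set} {k} d (xs : Vec A k) i → i < k → P (nth d (toList xs) i) → Any P xs
  nth⇒any d (x ∷ xs) zero    _       p = here p
  nth⇒any d (x ∷ xs) (suc i) (s≤s h) p = there (nth⇒any d xs i h p)

-- The words of the input

module InputWords {wf : ℕ → ℕ} {κ μ n : ℕ} (I : Instance wf κ μ n) (1≤w : 1 ≤ wf n) where

  open Instance I

  private
    w = wf n

  defaultPattern : Vec Bool m
  defaultPattern = Vec.replicate m false

  patternAt : ℕ → Vec Bool m
  patternAt = nth defaultPattern (toList patterns)

  text-word : ∀ j → mem input 0 j ≡ fromBits (seg (bitAt (toList text)) (j * w) w)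
  text-word j = padded-packed-seg w (toList text) j 1≤w

  pattern-word : ∀ i t → i < k → t < packedLength w m →
    mem input 1 (i * packedLength w m + t) ≡ fromBits (seg (bitAt (toList (patternAt i))) (t * w) w)
  pattern-word i t i<k t<R = trans (padded-concatMap (λ P → packed w (toList P)) (packedLength w m) defaultPattern
      (λ P → trans (length-packed w (toList P)) (cong (packedLength w) (length-toList P)))
      (toList patterns) i t (subst (i <_) (sym (length-toList patterns)) i<k) t<R)
    (padded-packed-seg w (toList (patternAt i)) t 1≤w)

-- The reduction for long inputs

mainProg : Structure → ℕ → Prog
mainProg D H =
  assign 4 (op quo (op sub (op add (reg 3) (reg 1)) (const 1)) (reg 1)) ⨟
  assign 5 (op quo (op sub (op add (reg 0) (const 1)) (reg 3)) (reg 1)) ⨟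
  assign 6 (op rem (op sub (op add (reg 0) (const 1)) (reg 3)) (reg 1)) ⨟
  assign 7 (op quo (op quo (reg 0) (reg 1)) (const 4)) ⨟
  assign 11 (op add (op mul (const 2) (reg 4)) (const 4)) ⨟
  assign 8 (op quo (op quo (reg 0) (reg 1)) (op mul (const 4) (op add (reg 4) (reg 11)))) ⨟
  -- The difference wraps around to the word of ones.
  assign 9 (op sub (const 0) (const 1)) ⨟
  assign 10 (op sub (reg 3) (op mul (op sub (reg 4) (const 1)) (reg 1))) ⨟
  assign 12 (op mul (op add (reg 4) (reg 11)) (reg 1)) ⨟
  jobs D 0 (tasks H) ⨟
  assign 0 (reg 13)

Answered : {wf : ℕ → ℕ} {κ μ n : ℕ} → Instance wf κ μ n → State → Set
Answered I τ = (regs τ 0 ≡ 1 × Instance.IsYes I) ⊎ (regs τ 0 ≡ 0 × ¬ Instance.IsYes I)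

module Large {wf : ℕ → ℕ} {κ μ n : ℕ} (I : Instance wf κ μ n) where

  open Instance I

  w R′ R M : ℕ
  w  = wf n
  R′ = pred (packedLength w m)
  R  = suc R′
  M  = 2 * R + 4

  module _ (H : ℕ) (1≤w : 1 ≤ w) (n²≤2^w : n * n ≤ 2 ^ w) (H+8≤n : H + 8 ≤ n) (k≤n : k ≤ n)
    (long : 4 * (R + M) * w ≤ n) where

    private
      words ℓ L G q r₁ : ℕ
      words = n div w
      ℓ  = m ∸ R′ * w
      L  = words div 4
      G  = words div (4 * (R + M))
      q  = (suc n ∸ m) div w
      r₁ = (suc n ∸ m) mod w

      3≤n : 3 ≤ n
      3≤n = ≤-trans (≤-trans ≤! (m≤n+m 8 H)) H+8≤n

      2n+2<n² : 2 * n + 2 < n * n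
      2n+2<n² = <-≤-trans (subst (2 * n + 2 <_) (+-comm (2 * n) n) (+-monoʳ-< (2 * n) 3≤n)) (*-monoˡ-≤ n 3≤n)

      room : 2 * n + 2 < 2 ^ w
      room = <-≤-trans 2n+2<n² n²≤2^w

      R≡ : R ≡ packedLength w m
      R≡ = suc-pred (packedLength w m) {{>-nonZero (1≤packedLength 1≤w 1≤m)}}

      R′w<m : suc (R′ * w) ≤ m
      R′w<m = +-cancelʳ-≤ (w ∸ 1) _ _ (begin
        suc (R′ * w) + (w ∸ 1) ≡⟨ sym (+-suc (R′ * w) (w ∸ 1)) ⟩
        R′ * w + suc (w ∸ 1) ≡⟨ cong (R′ * w +_) (m+[n∸m]≡n 1≤w) ⟩
        R′ * w + w ≡⟨ +-comm (R′ * w) w ⟩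
        R * w ≡⟨ cong (_* w) R≡ ⟩
        packedLength w m * w ≤⟨ div-* (m + (w ∸ 1)) w ⟩
        m + (w ∸ 1) ∎)
        where open ≤-Reasoning

      m≤Rw : m ≤ R * w
      m≤Rw = subst (λ x → m ≤ x * w) (sym R≡) (packedLength-≥ w m 1≤w)

      [R+1]w≤n : R * w + w ≤ n
      [R+1]w≤n = ≤-trans (≤-trans (≤-reflexive (+-comm (R * w) w)) (*-monoˡ-≤ w R+1≤)) long
        where
        R+1≤ : suc R ≤ 4 * (R + M)
        R+1≤ = ≤-trans (≤-trans (≤-reflexive (+-comm 1 R)) (+-monoʳ-≤ R (≤-trans (s≤s z≤n) (m≤n+m 4 (2 * R))))) (m≤m+n (R + M) _)

      m+w≤n : m + w ≤ n
      m+w≤n = ≤-trans (+-monoˡ-≤ w m≤Rw) [R+1]w≤n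

      m≤n : m ≤ n
      m≤n = ≤-trans (m≤m+n m w) m+w≤n

      w≤n : w ≤ n
      w≤n = ≤-trans (m≤n+m w m) m+w≤n

      1≤4[R+M] : 1 ≤ 4 * (R + M)
      1≤4[R+M] = s≤s z≤n

      4[R+M]≤words : 4 * (R + M) ≤ words
      4[R+M]≤words = ≤-div 1≤w long

      4≤words : 4 ≤ words
      4≤words = ≤-trans (≤-trans (≤-reflexive (sym (*-identityʳ 4))) (*-monoʳ-≤ 4 (s≤s z≤n))) 4[R+M]≤words

      -- The chunk takes at most a quarter of the words of the text, the `R + 2` words after it
      -- another quarter by `4[R+M]≤words`, and the group, with `2 * (R + M)` words per pattern, at
      -- most a half.
      capacity : (L + (R + 2) + G * (2 * (R + M))) * w ≤ n
      capacity = ≤-trans (*-monoˡ-≤ w {L + (R + 2) + G * (2 * (R + M))} {words} (*-cancelˡ-≤ 4 (begin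
        4 * (L + (R + 2) + G * (2 * (R + M))) ≡⟨ arith L (R + 2) G (R + M) ⟩
        L * 4 + 4 * (R + 2) + 2 * (G * (4 * (R + M))) ≤⟨ +-mono-≤ (+-mono-≤ (div-* words 4) (≤-trans (*-monoʳ-≤ 4 (+-monoʳ-≤ R (≤-trans ≤! (m≤n+m 4 (2 * R))))) 4[R+M]≤words)) (*-monoʳ-≤ 2 (div-* words (4 * (R + M)))) ⟩
        words + words + 2 * words ≡⟨ arith′ words ⟩
        4 * words ∎))) (div-* n w)
        where
        open ≤-Reasoning
        arith : ∀ l s g t → 4 * (l + s + g * (2 * t)) ≡ l * 4 + 4 * s + 2 * (g * (4 * t))
        arith = solve-∀
        arith′ : ∀ x → x + x + 2 * x ≡ 4 * x
        arith′ = solve-∀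

      open InputWords I 1≤w

      setting : Setting w n
      setting = record
        { k = k ; m = m ; R′ = R′ ; q = q ; r₁ = r₁ ; L = L ; G = G ; ℓ = ℓ ; M = M
        ; f = bitAt (toList text) ; pat = λ i → toList (patternAt i)
        ; textMem = mem input 0 ; patMem = mem input 1
        ; text-seg = text-word
        ; pat-seg = λ i t i<k t<R → subst (λ x → mem input 1 (i * x + t) ≡ fromBits (seg (bitAt (toList (patternAt i))) (t * w) w)) (sym R≡) (pattern-word i t i<k (subst (t <_) R≡ t<R))
        ; pat-length = λ i → length-toList (patternAt i)
        ; 1≤w = 1≤w ; 1≤m = 1≤m ; 2≤n = 2≤n ; room = room ; k≤n = k≤n
        ; k-room = subst (λ x → k * x < 2 ^ w) (sym R≡) words-fit
        ; m≡ = sym (m+[n∸m]≡n (<⇒≤ R′w<m))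
        ; ℓ≤w = m≤n+o⇒m∸n≤o m (R′ * w) (subst (m ≤_) (+-comm w (R′ * w)) m≤Rw)
        ; M≡ = refl ; r₁<w = mod-< (suc n ∸ m) 1≤w ; positions = div-mod-≡ (suc n ∸ m) 1≤w
        ; m≤n = m≤n
        ; 1≤q = ≤-div 1≤w (m+n≤o⇒m≤o∸n (1 * w) (≤-trans (≤-reflexive (trans (cong (_+ m) (*-identityˡ w)) (+-comm w m))) (m≤n⇒m≤1+n m+w≤n)))
        ; capacity = capacity }

      open Setting setting using (consts; <2^w; n≤; 1+n≤)
      open Occurrences setting

      found⇒yes : Found → IsYes
      found⇒yes (i , s , i<k , s+m≤n , seg≡) = nth⇒any defaultPattern patterns i i<k (position⇒infix s
        (trans (cong (λ x → take x (drop s (toList text))) (length-toList (patternAt i)))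
          (trans (sym (seg-bitAt (toList text) s m (subst (s + m ≤_) (sym (length-toList text)) s+m≤n))) seg≡)))

      yes⇒found : IsYes → Found
      yes⇒found occurs with any⇒nth defaultPattern patterns occurs
      ... | i , i<k , inf with infix⇒position inf
      ... | s , h , e = i , s , i<k , fits
          , trans (seg-bitAt (toList text) s m (subst (s + m ≤_) (sym (length-toList text)) fits))
              (trans (cong (λ x → take x (drop s (toList text))) (sym (length-toList (patternAt i)))) e)
        where
        fits : s + m ≤ n
        fits = subst₂ (λ x y → s + x ≤ y) (length-toList (patternAt i)) (length-toList text) h

    -- 64 is the cost of the nine assignments of parameters; 3 is that of the `skip` that ends the
    -- jobs and of the final assignment.
    mainTime : (p t : ℕ) → ℕ
    mainTime p t = 64 + (length (tasks H) * jobTime p t + 3)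

    mainTime-≤ : R ≤ μ → ∀ p t → mainTime p t ≤ (67 + length (tasks H) * jobFactor μ) * (p + (n div w + 1) * (1 + t))
    mainTime-≤ R≤μ p t = begin
      64 + (N * jobTime p t + 3) ≡⟨ arith (N * jobTime p t) ⟩
      67 + N * jobTime p t ≤⟨ +-mono-≤ (≤-trans (≤-reflexive (sym (*-identityʳ 67))) (*-monoʳ-≤ 67 1≤E))
                                             (*-monoʳ-≤ N (jobTime-≤ setting R≤μ (≤-trans (m≤m*n L 4) (div-* words 4)) (≤-trans (m≤m*n G (4 * (R + M))) (div-* words (4 * (R + M)))) p t)) ⟩
      67 * E + N * (jobFactor μ * E) ≡⟨ cong (67 * E +_) (sym (*-assoc N (jobFactor μ) E)) ⟩
      67 * E + N * jobFactor μ * E ≡⟨ sym (*-distribʳ-+ E 67 (N * jobFactor μ)) ⟩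
      (67 + N * jobFactor μ) * E ∎
      where
      open ≤-Reasoning
      N = length (tasks H)
      E = p + (n div w + 1) * (1 + t)
      1≤E : 1 ≤ E
      1≤E = ≤-trans (*-mono-≤ {1} {n div w + 1} {1} {1 + t} (m≤n+m 1 (n div w)) (s≤s z≤n)) (m≤n+m _ p)
      arith : ∀ x → 64 + (x + 3) ≡ 67 + x
      arith = solve-∀

    module _ {D : Structure} {P Q : ℕ → ℕ} (ans : AnswersSA⁻¹ wf D P Q) (k≤HG : k ≤ H * G) where

      private
        open Jobs ans setting
        open Arithmetic w

        1≤G : 1 ≤ G
        1≤G = ≤-div 1≤4[R+M] (≤-trans (≤-reflexive (*-identityˡ _)) 4[R+M]≤words)

        1≤L : 1 ≤ L
        1≤L = ≤-div {words} {4} ≤! 4≤words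

        -- `L` is a quarter of the words rounded down, and at least 1, so the number of words is
        -- below `4 * (L + 1) ≤ 8 * L`. This is why eight chunks suffice.
        q≤8L : q ≤ 8 * L
        q≤8L = ≤-trans (≤-div 1≤w (≤-trans (div-* (suc n ∸ m) w) (∸-monoʳ-≤ (suc n) 1≤m)))
          (≤-trans (<⇒≤ (<-suc-div-* words {4} ≤!)) (≤-trans (≤-reflexive (arith L)) (≤-trans (+-monoˡ-≤ (4 * L) (*-monoʳ-≤ 4 1≤L)) (≤-reflexive (arith′ L)))))
          where
          arith : ∀ L → suc L * 4 ≡ 4 * 1 + 4 * L
          arith = solve-∀
          arith′ : ∀ L → 4 * L + 4 * L ≡ 8 * L
          arith′ = solve-∀

        words≤n : words ≤ n
        words≤n = ≤-trans (subst (_≤ words * w) (*-identityʳ words) (*-monoʳ-≤ words 1≤w)) (div-* n w)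

        x<n⇒x*y<2^w : ∀ {x y} → x < n → y ≤ n → x * y < 2 ^ w
        x<n⇒x*y<2^w {x} {y} x<n y≤n = <-≤-trans (≤-<-trans (*-monoʳ-≤ x y≤n) (*-monoˡ-< n {{>-nonZero (≤-trans ≤! 3≤n)}} x<n)) n²≤2^w

        L≤n : L ≤ n
        L≤n = ≤-trans (≤-trans (subst (_≤ L * 4) (*-identityʳ L) (*-monoʳ-≤ L {1} {4} ≤!)) (div-* words 4)) words≤n

        G≤n : G ≤ n
        G≤n = ≤-trans (≤-trans (subst (_≤ G * (4 * (R + M))) (*-identityʳ G) (*-monoʳ-≤ G 1≤4[R+M])) (div-* words (4 * (R + M)))) words≤n

        fits : All Fits (tasks H)
        fits = All.tabulate λ { {z , b , g , h} t∈ → let (g<8 , h<H) = ∈-tasks⁻ t∈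
                                                         g<n = <-≤-trans g<8 (≤-trans (m≤n+m 8 H) H+8≤n)
                                                         h<n = <-≤-trans h<H (≤-trans (m≤m+n H 8) H+8≤n)
          in <2^w (n≤ (<⇒≤ g<n)) , <2^w (n≤ (<⇒≤ h<n)) , x<n⇒x*y<2^w g<n L≤n , x<n⇒x*y<2^w h<n G≤n }

        small : ∀ {x} → x ≤ 8 → x < 2 ^ w
        small h = <2^w (n≤ (≤-trans h (≤-trans (m≤n+m 8 H) H+8≤n)))

        R≤n : R ≤ n
        R≤n = ≤-trans (≤-trans (≤-trans (m≤m+n R M) (m≤m+n (R + M) _)) 4[R+M]≤words) words≤n

        M≤n : M ≤ n
        M≤n = ≤-trans (≤-trans (≤-trans (m≤n+m M R) (m≤m+n (R + M) _)) 4[R+M]≤words) words≤n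

        R+M≤n : R + M ≤ n
        R+M≤n = ≤-trans (≤-trans (m≤m+n (R + M) _) 4[R+M]≤words) words≤n

        m+w<2^w : m + w < 2 ^ w
        m+w<2^w = <2^w (n≤ m+w≤n)

      exec-main : Exec w (mainProg D H) input (mainTime (P n) (Q n)) (Answered I)
      exec-main =
        assigned {v = R}
          (trans (cong (_div w) (trans (mod-∸ (mod-+ {m} {w} refl refl m+w<2^w) (mod-small (small ≤!)) (≤-trans 1≤w (m≤n+m w m)) m+w<2^w) (+-∸-assoc m 1≤w))) (sym R≡)) $
        assigned {v = q} (cong (_div w) n+1∸m) $
        assigned {v = r₁} (cong (_mod w) n+1∸m) $
        assigned {v = L} (cong (words div_) (mod-small (small ≤!))) $
        assigned {v = M}
          (mod-+ (mod-* {Y = R} (mod-small (small ≤!)) refl (≤-<-trans (m≤m+n (2 * R) 4) (<2^w (n≤ M≤n)))) (mod-small (small ≤!)) (<2^w (n≤ M≤n))) $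
        assigned {v = G}
          (cong (words div_) (mod-* (mod-small (small ≤!)) (mod-+ {R} {M} refl refl (<2^w (n≤ R+M≤n))) (<2^w (n≤ (≤-trans 4[R+M]≤words words≤n))))) $
        assigned {v = 2 ^ w ∸ 1} minus-one $
        assigned {v = ℓ}
          (mod-∸ {m} refl (mod-* {Y = w} (mod-∸ {R} refl (mod-small (small ≤!)) (s≤s z≤n) (<2^w (n≤ R≤n))) refl (≤-<-trans (<⇒≤ R′w<m) m<)) (<⇒≤ R′w<m) m<) $
        assigned {v = (R + M) * w}
          (mod-* {Y = w} (mod-+ {R} {M} refl refl (<2^w (n≤ R+M≤n))) refl (<2^w (n≤ (≤-trans (*-monoˡ-≤ w (m≤m+n (R + M) _)) long)))) $
        exec-≤ (≤-reflexive (+-assoc _ 1 2)) $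
        -- `0 ≡ 0` serves as truth: before the first job nothing has been excluded. Register 13 is 0
        -- because the input occupies only four registers.
        exec-seq (exec-jobs (tasks H) fits (0 ≡ 0) 0 base (inj₂ (refl , refl)))
        λ τ flag → exec-assign refl (answer flag)
        where
        m< : m < 2 ^ w
        m< = <2^w (n≤ m≤n)
        n+1∸m : ((n + 1 mod (2 ^ w)) mod (2 ^ w) + 2 ^ w ∸ m) mod (2 ^ w) ≡ suc n ∸ m
        n+1∸m = trans (mod-∸ {Y = m} (mod-+ {n} refl (mod-small (small ≤!)) n+1<) refl (≤-trans m≤n (m≤m+n n 1)) n+1<) (cong (_∸ m) (+-comm n 1))
          where
          n+1< : n + 1 < 2 ^ w
          n+1< = <2^w (subst (_≤ 2 * n + 2) (+-comm 1 n) 1+n≤)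
        minus-one : ((0 mod (2 ^ w)) + 2 ^ w ∸ 1 mod (2 ^ w)) mod (2 ^ w) ≡ 2 ^ w ∸ 1
        minus-one = trans (cong₂ (λ x y → (x + 2 ^ w ∸ y) mod (2 ^ w)) (mod-small (2^>0 w)) (mod-small (small ≤!)))
          (mod-small (∸-monoʳ-< {2 ^ w} (s≤s z≤n) (2^>0 w)))
        σ₀ : State
        σ₀ = setReg 12 ((R + M) * w) (setReg 10 ℓ (setReg 9 (2 ^ w ∸ 1) (setReg 8 G (setReg 11 M (setReg 7 L (setReg 6 r₁ (setReg 5 q (setReg 4 R input))))))))
        consts-≡₀ : ∀ r → r < 13 → regs σ₀ r ≡ consts r
        consts-≡₀ 0 _ = refl
        consts-≡₀ 1 _ = refl
        consts-≡₀ 2 _ = refl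
        consts-≡₀ 3 _ = refl
        consts-≡₀ 4 _ = refl
        consts-≡₀ 5 _ = refl
        consts-≡₀ 6 _ = refl
        consts-≡₀ 7 _ = refl
        consts-≡₀ 8 _ = refl
        consts-≡₀ 9 _ = refl
        consts-≡₀ 10 _ = refl
        consts-≡₀ 11 _ = refl
        consts-≡₀ 12 _ = refl
        consts-≡₀ (suc (suc (suc (suc (suc (suc (suc (suc (suc (suc (suc (suc (suc r))))))))))))) r< = contradiction r< (≤⇒≯ (m≤m+n 13 r))
        base : Base 0 σ₀
        base = record { consts-≡ = λ {r} → consts-≡₀ r ; text-≡ = λ _ → refl ; pat-≡ = λ _ → refl
          ; untouched = λ _ → (λ _ → refl) , λ _ _ → refl }
        answer : ∀ {x} → (x ≡ 1 × Found) ⊎ (x ≡ 0 × (0 ≡ 0) × All NoDetect (tasks H)) → (x ≡ 1 × IsYes) ⊎ (x ≡ 0 × ¬ IsYes)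
        answer (inj₁ (x≡ , found))    = inj₁ (x≡ , found⇒yes found)
        answer (inj₂ (x≡ , _ , none)) = inj₂ (x≡ , λ occurs → ¬Found H q≤8L 1≤L 1≤G k≤HG none (yes⇒found occurs))

-- Short inputs are answered by a decision tree

-- Constants are reduced modulo 2 ^ w, so the ascending order of the tests matters: no constant up to
-- the value of e is affected.
switch : Expr → (d a : ℕ) → (ℕ → Prog) → Prog → Prog
switch e zero    a f p = p
switch e (suc d) a f p = cond (op eq e (const a)) (f a) (switch e d (suc a) f p)

module _ {w : ℕ} {σ : State} (e : Expr) {x : ℕ} (e≡ : eval w σ e ≡ x) (x< : x < 2 ^ w) {f : ℕ → Prog} {p : Prog} {T : ℕ} {Post : State → Set} where

  private
    miss : ∀ d a → a < x → Exec w (switch e d (suc a) f p) σ (d * (cost e + 3) + T) Post → Exec w (switch e (suc d) a f p) σ (suc d * (cost e + 3) + T) Post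
    miss d a a<x rest = exec-≤ (≤-reflexive (arith (cost e) (d * (cost e + 3)) T))
      (exec-cond-zero (bit-≢ (λ h → <⇒≢ a<x (trans (sym (mod-small (<-trans a<x x<))) (trans (sym h) e≡)))) rest)
      where
      arith : ∀ c u t → 1 + (1 + c + 1) + (u + t) ≡ c + 3 + u + t
      arith = solve-∀

  exec-switch : ∀ d a → a ≤ x → x < a + d → Exec w (f x) σ T Post → Exec w (switch e d a f p) σ (d * (cost e + 3) + T) Post
  exec-switch zero    a a≤x x<a   run = contradiction a≤x (<⇒≱ (subst (x <_) (+-identityʳ a) x<a))
  exec-switch (suc d) a a≤x x<a+d run with m≤n⇒m<n∨m≡n a≤x
  ... | inj₁ a<x  = miss d a a<x (exec-switch d (suc a) a<x (subst (x <_) (+-suc a d) x<a+d) run)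
  ... | inj₂ refl = exec-≤ (≤-trans (≤-reflexive (cong (_+ T) (arith (cost e)))) (+-monoˡ-≤ T (m≤m+n (cost e + 3) (d * (cost e + 3)))))
        (exec-cond-nonzero (bit-≡ (trans e≡ (sym (mod-small x<)))) run)
    where
    arith : ∀ c → 1 + (1 + c + 1) ≡ c + 3
    arith = solve-∀

  exec-switch-default : ∀ d a → a + d ≤ x → Exec w p σ T Post → Exec w (switch e d a f p) σ (d * (cost e + 3) + T) Post
  exec-switch-default zero    a _    run = run
  exec-switch-default (suc d) a a+d≤ run = miss d a (<-≤-trans (≤-trans (s≤s (m≤m+n a d)) (≤-reflexive (sym (+-suc a d)))) a+d≤)
    (exec-switch-default d (suc a) (subst (_≤ x) (+-suc a d) a+d≤) run)

-- Branching over all values of a word makes the value known when the program is built: `f` receives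
-- it as a number, and the answer to each possible input becomes a constant in a leaf. The default
-- `skip` is never reached, as every word is below `2 ^ w`.
readWords : (w array i d : ℕ) → (List ℕ → Prog) → Prog
readWords w a i zero    f = f []
readWords w a i (suc d) f = switch (load a (const i)) (2 ^ w) 0 (λ v → readWords w a (suc i) d (λ vs → f (v ∷ vs))) skip

exec-readWords : ∀ {w σ T} {Post : State → Set} a i d f → (∀ j → mem σ a j < 2 ^ w) → i + d ≤ 2 ^ w →
  Exec w (f (list (mem σ a) i d)) σ T Post → Exec w (readWords w a i d f) σ (d * (2 ^ w * 5) + T) Post
exec-readWords a i zero    f words<  i+d≤ run = run
exec-readWords {w} {σ} {T} a i (suc d) f words< i+d≤ run = exec-≤ (≤-reflexive (sym (+-assoc (2 ^ w * 5) (d * (2 ^ w * 5)) T)))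
  (exec-switch (load a (const i)) (cong (mem σ a) (mod-small (≤-trans (≤-trans (s≤s (m≤m+n i d)) (≤-reflexive (sym (+-suc i d)))) i+d≤))) (words< i) (2 ^ w) 0 z≤n (words< i)
    (exec-readWords a (suc i) d _ words< (subst (_≤ 2 ^ w) (+-suc i d) i+d≤) run))

toBits : ℕ → ℕ → List Bool
toBits zero    v = []
toBits (suc l) v = odd v ∷ toBits l (v / 2)

toBits-fromBits : ∀ xs → toBits (length xs) (fromBits xs) ≡ xs
toBits-fromBits []       = refl
toBits-fromBits (x ∷ xs) = cong₂ _∷_ (odd-bit x) (trans (cong (toBits (length xs)) (div-+* (bit x) (fromBits xs) (bit<2 x))) (toBits-fromBits xs))
  where
  odd-bit : ∀ x → odd (bit x + 2 * fromBits xs) ≡ x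
  odd-bit x = trans (cong (_≡ᵇ 1) (trans (cong (λ z → (bit x + z) % 2) (*-comm 2 (fromBits xs))) (trans ([m+kn]%n≡m%n (bit x) (fromBits xs) 2) (m<n⇒m%n≡m (bit<2 x))))) (lem x)
    where
    lem : ∀ x → (bit x ≡ᵇ 1) ≡ x
    lem true  = refl
    lem false = refl

list-cong : ∀ {A : Set} {B B′ : ℕ → A} a d → (∀ t → t < d → B (a + t) ≡ B′ (a + t)) → list B a d ≡ list B′ a d
list-cong         a zero    h = refl
list-cong {B = B} {B′} a (suc d) h = cong₂ _∷_ (subst (λ z → B z ≡ B′ z) (+-identityʳ a) (h 0 (s≤s z≤n)))
  (list-cong (suc a) d (λ t t<d → subst (λ z → B z ≡ B′ z) (+-suc a t) (h (suc t) (s≤s t<d))))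

padded-list : ∀ (g : ℕ → ℕ) a d {t} → t < d → padded (list g a d) t ≡ g (a + t)
padded-list g a (suc d) {zero}  _       = cong g (sym (+-identityʳ a))
padded-list g a (suc d) {suc t} (s≤s h) = trans (padded-list g (suc a) d h) (cong g (sym (+-suc a t)))

decode : (w : ℕ) → (ℕ → ℕ) → (l a d : ℕ) → List Bool
decode w g l a d = take l (concat (list (toBits w ∘ g) a d))

decode-seg : ∀ w g f l a d → l ≤ d * w → (∀ t → t < d → g (a + t) ≡ fromBits (seg f (t * w) w)) → decode w g l a d ≡ seg f 0 l
decode-seg w g f l a d l≤ words = begin
  take l (concat (list (toBits w ∘ g) a d)) ≡⟨ cong (take l ∘ concat) (list-cong a d block) ⟩
  take l (concat (list (λ j → seg f ((j ∸ a) * w) w) a d)) ≡⟨ cong (take l) (concat-list-seg f w (λ j → (j ∸ a) * w) a d next-offset) ⟩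
  take l (seg f ((a ∸ a) * w) (d * w)) ≡⟨ cong (λ z → take l (seg f (z * w) (d * w))) (n∸n≡0 a) ⟩
  take l (seg f 0 (d * w)) ≡⟨ take-drop-seg f 0 (d * w) 0 l l≤ ⟩
  seg f 0 l ∎
  where
  open ≡-Reasoning
  block : ∀ t → t < d → toBits w (g (a + t)) ≡ seg f ((a + t ∸ a) * w) w
  block t t<d = begin
    toBits w (g (a + t)) ≡⟨ cong (toBits w) (words t t<d) ⟩
    toBits w (fromBits (seg f (t * w) w)) ≡⟨ cong (λ z → toBits z (fromBits (seg f (t * w) w))) (sym (length-seg f (t * w) w)) ⟩
    toBits (length (seg f (t * w) w)) (fromBits (seg f (t * w) w)) ≡⟨ toBits-fromBits (seg f (t * w) w) ⟩
    seg f (t * w) w ≡⟨ cong (λ z → seg f (z * w) w) (sym (m+n∸m≡n a t)) ⟩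
    seg f ((a + t ∸ a) * w) w ∎
  next-offset : ∀ j → a ≤ j → (suc j ∸ a) * w ≡ (j ∸ a) * w + w
  next-offset j h = trans (cong (_* w) (+-∸-assoc 1 h)) (+-comm w ((j ∸ a) * w))

module _ (w n k m : ℕ) (ts ps : List ℕ) where

  decodedText : List Bool
  decodedText = decode w (padded ts) n 0 (packedLength w n)

  decodedPattern : ℕ → List Bool
  decodedPattern i = decode w (padded ps) m (i * packedLength w m) (packedLength w m)

  occurs? : Dec (∃[ i ] (i < k × Infix _≡_ (decodedPattern i) decodedText))
  occurs? = anyUpTo? (λ i → infix? Bool._≟_ (decodedPattern i) decodedText) k

treeProg : (w n : ℕ) → Prog
treeProg w n =
  switch (reg 2) (2 ^ w) 0 (λ k → switch (reg 3) (2 ^ w) 0 (λ m →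
    readWords w 0 0 (packedLength w n) λ ts → readWords w 1 0 (k * packedLength w m) λ ps →
    assign 0 (const (bit (does (occurs? w n k m ts ps))))) skip) skip

treeTime : (w n : ℕ) → ℕ
treeTime w n = 2 ^ w * 4 + (2 ^ w * 4 + (packedLength w n * (2 ^ w * 5) + (2 ^ w * (2 ^ w * 5) + 2)))

module _ {wf : ℕ → ℕ} {κ μ n : ℕ} (I : Instance wf κ μ n) (1≤w : 1 ≤ wf n) (n<2^w : n < 2 ^ wf n) where

  open Instance I
  open InputWords I 1≤w

  private
    w = wf n
    R = packedLength w m
    1≤R : 1 ≤ R
    1≤R = 1≤packedLength 1≤w 1≤m

    k<2^w : k < 2 ^ w
    k<2^w = ≤-<-trans (subst (_≤ k * R) (*-identityʳ k) (*-monoʳ-≤ k 1≤R)) words-fit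

    packedLength≤n : packedLength w n ≤ n
    packedLength≤n = s≤s⁻¹ (*-cancelʳ-< w _ _ (≤-<-trans (div-* (n + (w ∸ 1)) w) (begin-strict
      n + (w ∸ 1) <⟨ +-monoʳ-< n (∸-monoʳ-< {w} (s≤s z≤n) 1≤w) ⟩
      n + w ≤⟨ +-monoˡ-≤ w (subst (_≤ n * w) (*-identityʳ n) (*-monoʳ-≤ n 1≤w)) ⟩
      n * w + w ≡⟨ +-comm (n * w) w ⟩
      suc n * w ∎)))
      where open ≤-Reasoning

    seg<2^w : ∀ f i → fromBits (seg f i w) < 2 ^ w
    seg<2^w f i = subst (λ z → fromBits (seg f i w) < 2 ^ z) (length-seg f i w) (fromBits-< (seg f i w))

    pattern-word< : ∀ j → mem input 1 j < 2 ^ w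
    pattern-word< j = all<⇒padded< (concatMap (λ P → packed w (toList P)) (toList patterns)) (concatMap-< (toList patterns)) j
      where
      all<⇒padded< : ∀ xs → All (_< 2 ^ w) xs → ∀ j → padded xs j < 2 ^ w
      all<⇒padded< []       []         j       = 2^>0 w
      all<⇒padded< (x ∷ xs) (x< ∷ xs<) zero    = x<
      all<⇒padded< (x ∷ xs) (x< ∷ xs<) (suc j) = all<⇒padded< xs xs< j
      packed-< : ∀ (P : Vec Bool m) → All (_< 2 ^ w) (packed w (toList P))
      packed-< P = map⁺ (All.universal (λ i → subst (_< 2 ^ w) (sym (fromBits-take-drop (toList P) (i * w) w)) (seg<2^w (bitAt (toList P)) (i * w))) _)
      concatMap-< : ∀ (Ps : List (Vec Bool m)) → All (_< 2 ^ w) (concatMap (λ P → packed w (toList P)) Ps)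
      concatMap-< []       = []
      concatMap-< (P ∷ Ps) = ++⁺ (packed-< P) (concatMap-< Ps)

    ts ps : List ℕ
    ts = list (mem input 0) 0 (packedLength w n)
    ps = list (mem input 1) 0 (k * R)

    decodedText≡ : decodedText w n k m ts ps ≡ toList text
    decodedText≡ = trans (decode-seg w (padded ts) (bitAt (toList text)) n 0 (packedLength w n) (packedLength-≥ w n 1≤w)
        (λ t t< → trans (padded-list (mem input 0) 0 (packedLength w n) t<) (text-word t)))
      (trans (cong (seg (bitAt (toList text)) 0) (sym (length-toList text))) (seg-bitAt-all (toList text)))

    decodedPattern≡ : ∀ i → i < k → decodedPattern w n k m ts ps i ≡ toList (patternAt i)
    decodedPattern≡ i i<k = trans (decode-seg w (padded ps) (bitAt (toList (patternAt i))) m (i * R) R (packedLength-≥ w m 1≤w)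
        (λ t t<R → trans (padded-list (mem input 1) 0 (k * R) (<-≤-trans (+-monoʳ-< (i * R) t<R) (subst (_≤ k * R) (+-comm R (i * R)) (*-monoˡ-≤ R i<k)))) (pattern-word i t i<k t<R)))
      (trans (cong (seg (bitAt (toList (patternAt i))) 0) (sym (length-toList (patternAt i)))) (seg-bitAt-all (toList (patternAt i))))

    answer : (d : Dec (∃[ i ] (i < k × Infix _≡_ (decodedPattern w n k m ts ps i) (decodedText w n k m ts ps)))) →
      Answered I (setReg 0 (bit (does d)) input)
    answer (yes (i , i<k , inf)) = inj₁ (refl , nth⇒any defaultPattern patterns i i<k (subst₂ (Infix _≡_) (decodedPattern≡ i i<k) decodedText≡ inf))
    answer (no none) = inj₂ (refl , λ occurs → case any⇒nth defaultPattern patterns occurs of λ where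
      (i , i<k , inf) → none (i , i<k , subst₂ (Infix _≡_) (sym (decodedPattern≡ i i<k)) (sym decodedText≡) inf))

  exec-tree : Exec w (treeProg w n) input (treeTime w n) (Answered I)
  exec-tree =
    exec-switch (reg 2) refl k<2^w (2 ^ w) 0 z≤n k<2^w $
    exec-switch (reg 3) refl m-fits (2 ^ w) 0 z≤n m-fits $
    exec-readWords 0 0 (packedLength w n) _ (λ j → subst (_< 2 ^ w) (sym (text-word j)) (seg<2^w (bitAt (toList text)) (j * w))) (≤-trans packedLength≤n (<⇒≤ n<2^w)) $
    exec-≤ (+-monoˡ-≤ 2 (*-monoˡ-≤ (2 ^ w * 5) (<⇒≤ words-fit))) $
    exec-readWords 1 0 (k * R) _ pattern-word< (<⇒≤ words-fit) $
    exec-assign (mod-small (<-≤-trans (bit<2 (does (occurs? w n k m ts ps))) (≤-trans 2≤n (<⇒≤ n<2^w)))) (answer (occurs? w n k m ts ps))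

-- Growth

module _ {n : ℕ} (1≤n : 1 ≤ n) where

  private
    instance
      n-nonZero : NonZero n
      n-nonZero = >-nonZero 1≤n

  ·√log-mono : ∀ {x x′ y} → x ≤ x′ → x′ ·√log n ≤ y → x ·√log n ≤ y
  ·√log-mono x≤x′ h = ≤-trans (^-monoʳ-≤ n (^-monoˡ-≤ 2 x≤x′)) h

  x+y≤2*[x⊔y] : ∀ x y → x + y ≤ 2 * (x ⊔ y)
  x+y≤2*[x⊔y] x y = ≤-trans (+-mono-≤ (m≤m⊔n x y) (m≤n⊔m x y)) (≤-reflexive (cong (x ⊔ y +_) (sym (+-identityʳ (x ⊔ y)))))

  -- The relation puts squares into an exponent, where a sum does not split. Instead the sum is
  -- bounded by twice the maximum, and the maximum is one of the two; this costs a factor 2, which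
  -- the arbitrary `e` of little-o absorbs.
  ·√log-+ : ∀ {x z y} → (2 * x) ·√log n ≤ y → (2 * z) ·√log n ≤ y → (x + z) ·√log n ≤ y
  ·√log-+ {x} {z} {y} h h′ = ·√log-mono {y = y} (x+y≤2*[x⊔y] x z) (max (⊔-sel x z))
    where
    max : x ⊔ z ≡ x ⊎ x ⊔ z ≡ z → (2 * (x ⊔ z)) ·√log n ≤ y
    max (inj₁ e) = subst (λ u → (2 * u) ·√log n ≤ y) (sym e) h
    max (inj₂ e) = subst (λ u → (2 * u) ·√log n ≤ y) (sym e) h′

o-≤ : ∀ {f g} → o[n/√logn] g → Eventually (λ n → f n ≤ g n) → o[n/√logn] f
o-≤ {f} {g} og (n₁ , f≤g) e with og e
... | n₂ , h = suc (n₁ + n₂) , λ n n≥ → ·√log-mono {n} (≤-trans (s≤s z≤n) n≥) {y = n}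
  (*-monoʳ-≤ e (f≤g n (≤-trans (m≤m+n n₁ n₂) (<⇒≤ n≥)))) (h n (≤-trans (m≤n+m n₂ n₁) (<⇒≤ n≥)))

o-+ : ∀ {f g} → o[n/√logn] f → o[n/√logn] g → o[n/√logn] (λ n → f n + g n)
o-+ {f} {g} of og e with of (2 * e) | og (2 * e)
... | n₁ , h | n₂ , h′ = suc (n₁ + n₂) , λ n n≥ → subst (λ u → u ·√log n ≤ n) (sym (*-distribˡ-+ e (f n) (g n)))
  (·√log-+ {n} (≤-trans (s≤s z≤n) n≥) {e * f n} {e * g n} {n}
    (subst (λ u → u ·√log n ≤ n) (*-assoc 2 e (f n)) (h n (≤-trans (m≤m+n n₁ n₂) (<⇒≤ n≥))))
    (subst (λ u → u ·√log n ≤ n) (*-assoc 2 e (g n)) (h′ n (≤-trans (m≤n+m n₂ n₁) (<⇒≤ n≥)))))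

o-* : ∀ {f} K → o[n/√logn] f → o[n/√logn] (λ n → K * f n)
o-* {f} K of e with of (e * K)
... | n₁ , h = n₁ , λ n n≥ → subst (λ u → u ·√log n ≤ n) (*-assoc e K (f n)) (h n n≥)

-- Even the crude bound `log n ≤ n` is enough: `(e * K) ^ 2 * n ≤ n ^ 2` as soon as `n` reaches
-- `(e * K) ^ 2`.
o-const : ∀ K → o[n/√logn] (λ _ → K)
o-const K e = (e * K) ^ 2 , λ n n≥ → begin
  n ^ ((e * K) ^ 2) ≤⟨ ^-monoˡ-≤ ((e * K) ^ 2) (<⇒≤ (n<2^n n)) ⟩
  (2 ^ n) ^ ((e * K) ^ 2) ≡⟨ ^-*-assoc 2 n ((e * K) ^ 2) ⟩
  2 ^ (n * (e * K) ^ 2) ≤⟨ ^-monoʳ-≤ 2 (*-monoʳ-≤ n (≤-trans n≥ (≤-reflexive (sym (*-identityʳ n))))) ⟩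
  2 ^ (n ^ 2) ∎
  where open ≤-Reasoning

O[1]⇒o[√logn] : ∀ {f} → O[1] f → o[√logn] f
O[1]⇒o[√logn] {f} (C , n₁ , h) e = n₁ + 2 ^ ((e * C) ^ 2) , λ n n≥ → begin
  2 ^ ((e * f n) ^ 2) ≤⟨ ^-monoʳ-≤ 2 (^-monoˡ-≤ 2 (*-monoʳ-≤ e (h n (≤-trans (m≤m+n n₁ _) n≥)))) ⟩
  2 ^ ((e * C) ^ 2) ≤⟨ ≤-trans (m≤n+m _ n₁) n≥ ⟩
  n ≡⟨ sym (*-identityʳ n) ⟩
  n ^ 1 ∎
  where open ≤-Reasoning

-- n / w is at most n / log n, since log n ≤ w.
o-words : ∀ {w Q : ℕ → ℕ} → (∀ n → 2 ≤ n → n * n ≤ 2 ^ w n) → Eventually (λ n → w n ≤ n) → o[√logn] Q →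
  o[n/√logn] (λ n → (n div w n + 1) * (1 + Q n))
-- One factor 2 pays for `v + 1 ≤ 2 * v` with `v = n div w n`, the other for `1 + Q n ≤ 2 * Q n`.
-- Where `Q n = 0` the latter fails, and the last summand of the threshold makes `n` large enough
-- instead.
o-words {w} {Q} n²≤ (n₁ , w≤n) oQ e with oQ (2 * (2 * e))
... | n₂ , h = 2 + n₁ + n₂ + 2 ^ ((2 * (2 * e)) ^ 2) , λ n n≥ →
  let
    2≤n : 2 ≤ n
    2≤n = ≤-trans (≤-trans (≤-trans (m≤m+n 2 n₁) (m≤m+n _ n₂)) (m≤m+n _ _)) n≥
    n₁≤ = ≤-trans (≤-trans (≤-trans (m≤n+m n₁ 2) (m≤m+n _ n₂)) (m≤m+n _ _)) n≥
    n₂≤ = ≤-trans (≤-trans (m≤n+m n₂ (2 + n₁)) (m≤m+n _ _)) n≥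
    big = ≤-trans (m≤n+m (2 ^ ((2 * (2 * e)) ^ 2)) (2 + n₁ + n₂)) n≥
  in bound n 2≤n (w≤n n n₁≤) (h n n₂≤) big
  where
  bound : ∀ n → 2 ≤ n → w n ≤ n → (2 * (2 * e) * Q n) ≤√log n → 2 ^ ((2 * (2 * e)) ^ 2) ≤ n →
    (e * ((n div w n + 1) * (1 + Q n))) ·√log n ≤ n
  bound n 2≤n w≤n h big = begin
    n ^ ((e * ((v + 1) * (1 + Q n))) ^ 2) ≤⟨ ^-monoʳ-≤ n {{>-nonZero (≤-trans (s≤s z≤n) 2≤n)}} (^-monoˡ-≤ 2 regroup) ⟩
    n ^ ((v * x) ^ 2) ≤⟨ ^-monoˡ-≤ ((v * x) ^ 2) n≤2^w ⟩
    (2 ^ w n) ^ ((v * x) ^ 2) ≡⟨ ^-*-assoc 2 (w n) ((v * x) ^ 2) ⟩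
    2 ^ (w n * (v * x) ^ 2) ≡⟨ cong (2 ^_) (arith (w n) v x) ⟩
    2 ^ ((v * v) * w n * (x ^ 2)) ≤⟨ ^-monoʳ-≤ 2 (*-monoʳ-≤ ((v * v) * w n) x²≤w) ⟩
    2 ^ ((v * v) * w n * w n) ≡⟨ cong (2 ^_) (arith′ (w n) v) ⟩
    2 ^ ((v * w n) ^ 2) ≤⟨ ^-monoʳ-≤ 2 (^-monoˡ-≤ 2 (div-* n (w n))) ⟩
    2 ^ (n ^ 2) ∎
    where
    open ≤-Reasoning
    v = n div w n
    x = 2 * e * (1 + Q n)
    arith : ∀ w v x → w * (v * x) ^ 2 ≡ (v * v) * w * (x ^ 2)
    arith w v x = trans (cong (w *_) (cong (v * x *_) (*-identityʳ (v * x)))) (trans (lem w v x) (cong ((v * v) * w *_) (cong (x *_) (sym (*-identityʳ x)))))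
      where
      lem : ∀ w v x → w * ((v * x) * (v * x)) ≡ (v * v) * w * (x * x)
      lem = solve-∀
    arith′ : ∀ w v → (v * v) * w * w ≡ (v * w) ^ 2
    arith′ w v = trans (lem w v) (cong (v * w *_) (sym (*-identityʳ (v * w))))
      where
      lem : ∀ w v → (v * v) * w * w ≡ (v * w) * (v * w)
      lem = solve-∀
    n≤2^w : n ≤ 2 ^ w n
    n≤2^w = ≤-trans (subst (_≤ n * n) (*-identityʳ n) (*-monoʳ-≤ n (≤-trans (s≤s z≤n) 2≤n))) (n²≤ n 2≤n)
    1≤w : 1 ≤ w n
    1≤w with w n | n≤2^w
    ... | zero  | n≤1 = contradiction 2≤n (<⇒≱ (s≤s n≤1))
    ... | suc _ | _   = s≤s z≤n
    1≤v : 1 ≤ v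
    1≤v = ≤-div 1≤w (subst (_≤ n) (sym (*-identityˡ (w n))) w≤n)
    regroup : e * ((v + 1) * (1 + Q n)) ≤ v * x
    regroup = ≤-trans (*-monoʳ-≤ e (*-monoˡ-≤ (1 + Q n) (+-monoʳ-≤ v 1≤v))) (≤-reflexive (lem e v (Q n)))
      where
      lem : ∀ e v q → e * ((v + v) * (1 + q)) ≡ v * (2 * e * (1 + q))
      lem = solve-∀
    2^x²≤n : 2 ^ (x ^ 2) ≤ n
    2^x²≤n with 1 ≤? Q n
    ... | yes 1≤Q = ≤-trans (^-monoʳ-≤ 2 (^-monoˡ-≤ 2 (≤-trans (*-monoʳ-≤ (2 * e) (+-monoˡ-≤ (Q n) 1≤Q)) (≤-reflexive (lem e (Q n))))))
        (≤-trans h (≤-reflexive (*-identityʳ n)))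
      where
      lem : ∀ e q → 2 * e * (q + q) ≡ 2 * (2 * e) * q
      lem = solve-∀
    ... | no Q≱1  = ≤-trans (^-monoʳ-≤ 2 (^-monoˡ-≤ 2 (≤-trans (*-monoʳ-≤ (2 * e) (+-monoʳ-≤ 1 (s≤s⁻¹ (≰⇒> Q≱1)))) (≤-trans (≤-reflexive (*-identityʳ (2 * e))) (m≤m+n (2 * e) _))))) big
    x²≤w : x ^ 2 ≤ w n
    x²≤w = ≮⇒≥ λ w<x² → <⇒≱ (^-monoʳ-< 2 (s≤s (s≤s z≤n)) w<x²) (≤-trans 2^x²≤n n≤2^w)

-- Bounds on the word size

2^-cancel-≤ : ∀ {x y} → 2 ^ x ≤ 2 ^ y → x ≤ y
2^-cancel-≤ h = ≮⇒≥ λ y<x → <⇒≱ (^-monoʳ-< 2 (s≤s (s≤s z≤n)) y<x) h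

⌈log₂⌉ : ∀ n → 1 ≤ n → ∃[ l ] (n ≤ 2 ^ l × 2 ^ l ≤ 2 * n)
⌈log₂⌉ (suc zero)    _ = 0 , ≤-refl , s≤s z≤n
⌈log₂⌉ (suc (suc n)) _ with ⌈log₂⌉ (suc n) (s≤s z≤n)
... | l , lo , hi with m≤n⇒m<n∨m≡n lo
...   | inj₁ n<  = l , n< , ≤-trans hi (*-monoʳ-≤ 2 (n≤1+n (suc n)))
...   | inj₂ n≡  = suc l
      , subst (λ x → suc (suc n) ≤ 2 * x) n≡ (subst (suc (suc n) ≤_) (cong (suc n +_) (sym (+-identityʳ (suc n)))) (+-monoˡ-≤ (suc n) (s≤s z≤n)))
      , *-monoʳ-≤ 2 (subst (_≤ suc (suc n)) n≡ (n≤1+n (suc n)))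

-- Up to rounding, this is the square of `h < 2 ^ h` for `h` equal to half of `n`.
n²≤8*2^n : ∀ n → n * n ≤ 8 * 2 ^ n
n²≤8*2^n n = begin
  n * n ≤⟨ *-mono-≤ n≤2h n≤2h ⟩
  (2 * h) * (2 * h) ≡⟨ arith h ⟩
  4 * (h * h) ≤⟨ *-monoʳ-≤ 4 (*-mono-≤ (<⇒≤ (n<2^n h)) (<⇒≤ (n<2^n h))) ⟩
  4 * (2 ^ h * 2 ^ h) ≡⟨ cong (4 *_) (sym (^-distribˡ-+-* 2 h h)) ⟩
  4 * 2 ^ (h + h) ≤⟨ *-monoʳ-≤ 4 (^-monoʳ-≤ 2 h+h≤1+n) ⟩
  4 * (2 * 2 ^ n) ≡⟨ sym (*-assoc 4 2 (2 ^ n)) ⟩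
  8 * 2 ^ n ∎
  where
  open ≤-Reasoning
  h = ⌈ n /2⌉
  arith : ∀ h → (2 * h) * (2 * h) ≡ 4 * (h * h)
  arith = solve-∀
  n≤2h : n ≤ 2 * h
  n≤2h = subst₂ _≤_ (⌊n/2⌋+⌈n/2⌉≡n n) (cong (h +_) (sym (+-identityʳ h))) (+-monoˡ-≤ h (⌊n/2⌋≤⌈n/2⌉ n))
  h+h≤1+n : h + h ≤ suc n
  h+h≤1+n = subst (h + h ≤_) (cong suc (⌊n/2⌋+⌈n/2⌉≡n n)) (+-monoˡ-≤ h (lem n))
    where
    lem : ∀ n → ⌈ n /2⌉ ≤ suc ⌊ n /2⌋
    lem zero          = z≤n
    lem (suc zero)    = s≤s z≤n
    lem (suc (suc n)) = s≤s (lem n)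

module WordSize (c : Real≥2) (w : ℕ → ℕ) (isWordSize : IsWordSize c w) where

  open Real≥2 c

  -- The bound `c ≥ 2` enters here. It lets the products formed by the reduction, and for `n ≥ 3`
  -- the sums of two ranks, fit into a word.
  n²≤2^w : ∀ n → 2 ≤ n → n * n ≤ 2 ^ w n
  n²≤2^w n 2≤n = subst₂ _≤_ (cong (n *_) (*-identityʳ n)) (cong (2 ^_) (*-identityˡ (w n))) (proj₁ (isWordSize n 2≤n) 2 1 has-2)

  -- `w n` is the least admissible value, so it is enough that `bound * l` is admissible, where `l`
  -- is an upper bound for the logarithm.
  w≤bound*log : ∀ n l → 2 ≤ n → n ≤ 2 ^ l → w n ≤ bound * l
  w≤bound*log n l 2≤n n≤2^l = proj₂ (isWordSize n 2≤n) (bound * l) λ p q fr → begin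
    n ^ p ≤⟨ ^-monoˡ-≤ p n≤2^l ⟩
    (2 ^ l) ^ p ≡⟨ ^-*-assoc 2 l p ⟩
    2 ^ (l * p) ≤⟨ ^-monoʳ-≤ 2 (≤-trans (*-monoʳ-≤ l (bounded p q fr)) (≤-reflexive (arith l bound q))) ⟩
    2 ^ (q * (bound * l)) ∎
    where
    open ≤-Reasoning
    arith : ∀ l b q → l * (b * q) ≡ q * (b * l)
    arith = solve-∀

  -- Rounding the logarithm up to `l` costs only `2 ^ l ≤ 2 * n ≤ n ^ 2`, which doubles the
  -- exponent.
  w≤n^ : ∀ n → 2 ≤ n → 2 ^ w n ≤ n ^ (2 * bound)
  w≤n^ n 2≤n with ⌈log₂⌉ n (≤-trans (s≤s z≤n) 2≤n)
  ... | l , lo , hi = begin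
    2 ^ w n ≤⟨ ^-monoʳ-≤ 2 (≤-trans (w≤bound*log n l 2≤n lo) (≤-reflexive (*-comm bound l))) ⟩
    2 ^ (l * bound) ≡⟨ sym (^-*-assoc 2 l bound) ⟩
    (2 ^ l) ^ bound ≤⟨ ^-monoˡ-≤ bound (≤-trans hi (*-mono-≤ 2≤n (≤-reflexive (sym (*-identityʳ n))))) ⟩
    (n ^ 2) ^ bound ≡⟨ ^-*-assoc n 2 bound ⟩
    n ^ (2 * bound) ∎
    where open ≤-Reasoning

  -- With `B = A * bound` it suffices that `B * l ≤ n` for the rounded logarithm `l`. If `l` is at
  -- least `16 * B`, then `16 * B * l ≤ l * l ≤ 16 * n`; otherwise `B * l` is at most
  -- `16 * (B * B)`, which the threshold covers.
  A*w≤n : ∀ A n → 2 ≤ n → 16 * ((A * bound) * (A * bound)) ≤ n → A * w n ≤ n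
  A*w≤n A n 2≤n big with ⌈log₂⌉ n (≤-trans (s≤s z≤n) 2≤n)
  ... | l , lo , hi = ≤-trans (≤-trans (*-monoʳ-≤ A (w≤bound*log n l 2≤n lo)) (≤-reflexive (sym (*-assoc A bound l)))) Bl≤n
    where
    B = A * bound
    Bl≤n : B * l ≤ n
    Bl≤n with 16 * B ≤? l
    ... | yes 16B≤l = *-cancelˡ-≤ 16 (begin
          16 * (B * l) ≡⟨ sym (*-assoc 16 B l) ⟩
          16 * B * l ≤⟨ *-monoˡ-≤ l 16B≤l ⟩
          l * l ≤⟨ n²≤8*2^n l ⟩
          8 * 2 ^ l ≤⟨ *-monoʳ-≤ 8 hi ⟩
          8 * (2 * n) ≡⟨ sym (*-assoc 8 2 n) ⟩
          16 * n ∎)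
      where open ≤-Reasoning
    ... | no 16B≰l  = ≤-trans (*-monoʳ-≤ B (<⇒≤ (≰⇒> 16B≰l))) (≤-trans (≤-reflexive (arith B)) big)
      where
      arith : ∀ B → B * (16 * B) ≡ 16 * (B * B)
      arith = solve-∀

-- The reduction

module Reduction (c : Real≥2) (w : ℕ → ℕ) (isWordSize : IsWordSize c w) (κ μ : ℕ) (D : Structure) where

  open Real≥2 c using (bound)
  open WordSize c w isWordSize

  private
    -- `B` bounds `R + M`; `A` is such that `A * w n ≤ n` gives a group room for at least one
    -- pattern; `K` satisfies `k * w n ≤ K * n`; and `H` groups hold all patterns. From `n₀` on,
    -- `H + 8 ≤ n`, `2 ^ K ≤ n` (whence `K ≤ w n` and `k ≤ n`) and `A * w n ≤ n`.
    B A K H n₀ C : ℕ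
    B  = 3 * μ + 4
    A  = 4 * B
    K  = 2 * bound * κ
    H  = K * (8 * B)
    n₀ = (H + 8) + 2 ^ K + 16 * ((A * bound) * (A * bound))
    C  = 67 + length (tasks H) * jobFactor μ

    H+8≤ : ∀ {n} → n₀ ≤ n → H + 8 ≤ n
    H+8≤ h = ≤-trans (≤-trans (m≤m+n (H + 8) (2 ^ K)) (m≤m+n _ _)) h

    2^K≤ : ∀ {n} → n₀ ≤ n → 2 ^ K ≤ n
    2^K≤ h = ≤-trans (≤-trans (m≤n+m (2 ^ K) (H + 8)) (m≤m+n _ _)) h

    2≤ : ∀ {n} → n₀ ≤ n → 2 ≤ n
    2≤ h = ≤-trans (≤-trans ≤! (m≤n+m 8 H)) (H+8≤ h)

    A*w≤ : ∀ {n} → n₀ ≤ n → A * w n ≤ n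
    A*w≤ {n} h = A*w≤n A n (2≤ h) (≤-trans (m≤n+m _ ((H + 8) + 2 ^ K)) h)

    w≤n : ∀ {n} → n₀ ≤ n → w n ≤ n
    w≤n {n} h = ≤-trans (subst (_≤ A * w n) (*-identityˡ (w n)) (*-monoˡ-≤ (w n) {1} {A} (≤-trans (≤-trans ≤! (m≤n+m 4 (3 * μ))) (m≤m+n B _)))) (A*w≤ h)

    n<2^w : ∀ {n} → 2 ≤ n → n < 2 ^ w n
    n<2^w {n} 2≤n = <-≤-trans (subst (_< n * n) (*-identityʳ n) (*-monoʳ-< n {{>-nonZero (≤-trans (s≤s z≤n) 2≤n)}} 2≤n)) (n²≤2^w n 2≤n)

    1≤w : ∀ {n} → 2 ≤ n → 1 ≤ w n
    1≤w {n} 2≤n with w n | n<2^w 2≤n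
    ... | zero  | n<1 = contradiction 2≤n (<⇒≱ (<-trans n<1 (s≤s (s≤s z≤n))))
    ... | suc _ | _   = s≤s z≤n

  -- The decision trees involve the values `w n` of finitely many `n < n₀` only; these are constants
  -- of the program.
  program : Prog
  program = switch (reg 0) n₀ 0 (λ n → treeProg (w n) n) (mainProg D H)

  time : (P Q : ℕ → ℕ) → ℕ → ℕ
  -- The cost of the trees is counted only below `n₀`, so it is eventually 0 and its size does not
  -- matter.
  time P Q n = n₀ * 4 + (if n <ᵇ n₀ then treeTime (w n) n else 0) + C * (P n + (n div w n + 1) * (1 + Q n))

  time-o : ∀ {P Q} → o[n/√logn] P → o[√logn] Q → o[n/√logn] (time P Q)
  time-o oP oQ = o-+ (o-+ (o-const (n₀ * 4)) (o-≤ (o-const 0) (n₀ , λ n n₀≤n →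
      ≤-reflexive (cong (λ b → if b then treeTime (w n) n else 0) (≮⇒<ᵇ≡false (≤⇒≯ n₀≤n))))))
    (o-* C (o-+ oP (o-words {w} n²≤2^w (n₀ , λ n → w≤n) oQ)))

  module _ {n : ℕ} (I : Instance w κ μ n) (n₀≤n : n₀ ≤ n) where

    open Instance I

    private
      open Large I using (R; M)
      v = n div w n

      -- The exponential form of combining `k * log n ≤ κ * n` with `w n ≤ 2 * bound * log n`.
      kw≤Kn : k * w n ≤ K * n
      kw≤Kn = 2^-cancel-≤ (begin
        2 ^ (k * w n) ≡⟨ cong (2 ^_) (*-comm k (w n)) ⟩
        2 ^ (w n * k) ≡⟨ sym (^-*-assoc 2 (w n) k) ⟩
        (2 ^ w n) ^ k ≤⟨ ^-monoˡ-≤ k (w≤n^ n 2≤n) ⟩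
        (n ^ (2 * bound)) ^ k ≡⟨ ^-*-assoc n (2 * bound) k ⟩
        n ^ (2 * bound * k) ≡⟨ cong (n ^_) (*-comm (2 * bound) k) ⟩
        n ^ (k * (2 * bound)) ≡⟨ sym (^-*-assoc n k (2 * bound)) ⟩
        (n ^ k) ^ (2 * bound) ≤⟨ ^-monoˡ-≤ (2 * bound) (proj₁ k-Θ) ⟩
        (2 ^ (κ * n)) ^ (2 * bound) ≡⟨ ^-*-assoc 2 (κ * n) (2 * bound) ⟩
        2 ^ (κ * n * (2 * bound)) ≡⟨ cong (2 ^_) (arith κ n (2 * bound)) ⟩
        2 ^ (K * n) ∎)
        where
        open ≤-Reasoning
        arith : ∀ x n y → x * n * y ≡ y * x * n
        arith = solve-∀

      K≤w : K ≤ w n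
      K≤w = 2^-cancel-≤ (≤-trans (2^K≤ n₀≤n) (<⇒≤ (n<2^w 2≤n)))

      k≤n : k ≤ n
      k≤n = *-cancelʳ-≤ k n (w n) {{>-nonZero (1≤w 2≤n)}} (≤-trans kw≤Kn (≤-trans (*-monoˡ-≤ n K≤w) (≤-reflexive (*-comm (w n) n))))

      R≤μ : R ≤ μ
      R≤μ = subst (_≤ μ) (sym (suc-pred (packedLength (w n) m) {{>-nonZero (1≤packedLength (1≤w 2≤n) 1≤m)}}))
        (s≤s⁻¹ (*-cancelʳ-< (w n) _ _ (≤-<-trans (div-* (m + (w n ∸ 1)) (w n)) (begin-strict
          m + (w n ∸ 1) <⟨ +-monoʳ-< m (∸-monoʳ-< {w n} (s≤s z≤n) (1≤w 2≤n)) ⟩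
          m + w n ≤⟨ +-monoˡ-≤ (w n) m≤ ⟩
          μ * w n + w n ≡⟨ +-comm (μ * w n) (w n) ⟩
          suc μ * w n ∎))))
        where
        open ≤-Reasoning
        m≤ : m ≤ μ * w n
        m≤ = 2^-cancel-≤ (≤-trans (proj₁ m-Θ) (≤-trans (^-monoˡ-≤ μ (<⇒≤ (n<2^w 2≤n)))
          (≤-reflexive (trans (^-*-assoc 2 (w n) μ) (cong (2 ^_) (*-comm (w n) μ))))))

      R+M≤B : R + M ≤ B
      R+M≤B = ≤-trans (≤-reflexive (arith R)) (+-monoˡ-≤ 4 (*-monoʳ-≤ 3 R≤μ))
        where
        arith : ∀ R → R + (2 * R + 4) ≡ 3 * R + 4
        arith = solve-∀

      long : 4 * (R + M) * w n ≤ n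
      long = ≤-trans (*-monoˡ-≤ (w n) (*-monoʳ-≤ 4 R+M≤B)) (A*w≤ n₀≤n)

      -- The text has fewer than `v + 1` words' worth of bits, and `v + 1 ≤ (G + 1) * 4 * (R + M) ≤
      -- 8 * B * G` because `G` is at least 1. Inserting this into `k * w n ≤ K *
      -- n` and cancelling `w n` yields `H = K * (8 * B)`.
      k≤HG : k ≤ H * (v div (4 * (R + M)))
      k≤HG = *-cancelʳ-≤ k _ (w n) {{>-nonZero (1≤w 2≤n)}} (begin
        k * w n ≤⟨ kw≤Kn ⟩
        K * n ≤⟨ *-monoʳ-≤ K (<⇒≤ (<-suc-div-* n (1≤w 2≤n))) ⟩
        K * (suc v * w n) ≤⟨ *-monoʳ-≤ K (*-monoˡ-≤ (w n) (≤-trans (<-suc-div-* v {4 * (R + M)} (s≤s z≤n)) (*-mono-≤ (+-monoˡ-≤ G 1≤G) (*-monoʳ-≤ 4 R+M≤B)))) ⟩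
        K * ((G + G) * (4 * B) * w n) ≡⟨ arith K G B (w n) ⟩
        K * (8 * B) * G * w n ∎)
        where
        open ≤-Reasoning
        G = v div (4 * (R + M))
        1≤G : 1 ≤ G
        1≤G = ≤-div {v} {4 * (R + M)} (s≤s z≤n) (≤-trans (≤-reflexive (*-identityˡ (4 * (R + M)))) (≤-div (1≤w 2≤n) long))
        arith : ∀ k g b w → k * ((g + g) * (4 * b) * w) ≡ k * (8 * b) * g * w
        arith = solve-∀

    exec-large : ∀ {P Q} → AnswersSA⁻¹ w D P Q →
      Exec (w n) (mainProg D H) input (C * (P n + (n div w n + 1) * (1 + Q n))) (Answered I)
    exec-large {P} {Q} ans = exec-≤ (Large.mainTime-≤ I H (1≤w 2≤n) (n²≤2^w n 2≤n) (H+8≤ n₀≤n) k≤n long R≤μ (P n) (Q n))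
      (Large.exec-main I H (1≤w 2≤n) (n²≤2^w n 2≤n) (H+8≤ n₀≤n) k≤n long ans k≤HG)

  solves : ∀ {P Q} → AnswersSA⁻¹ w D P Q → SolvesDictionaryMatching w κ μ program (time P Q)
  solves {P} {Q} ans n I = exec
    where
    open Instance I
    large = C * (P n + (n div w n + 1) * (1 + Q n))
    exec : Exec (w n) program input (time P Q n) (Answered I)
    exec with n <? n₀
    ... | yes n<n₀ = exec-≤ (≤-trans (+-monoʳ-≤ (n₀ * 4) (≤-reflexive (cong (λ b → if b then treeTime (w n) n else 0) (sym (<⇒<ᵇ≡true n<n₀))))) (m≤m+n _ large))
        (exec-switch (reg 0) refl (n<2^w 2≤n) n₀ 0 z≤n n<n₀ (exec-tree I (1≤w 2≤n) (n<2^w 2≤n)))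
    ... | no n≮n₀  = exec-≤ (+-monoˡ-≤ large (m≤m+n (n₀ * 4) _))
        (exec-switch-default (reg 0) refl (n<2^w 2≤n) n₀ 0 (≮⇒≥ n≮n₀) (exec-large I (≮⇒≥ n≮n₀) ans))

corollary8p3 : (c : Real≥2) (w : ℕ → ℕ) → IsWordSize c w →
    (κ μ : ℕ) →
    ¬ (∃[ A ] ∃[ t ] (SolvesDictionaryMatching w κ μ A t × o[n/√logn] t)) →
    ¬ (∃[ D ] ∃[ P ] ∃[ Q ] (AnswersSA⁻¹ w D P Q × o[n/√logn] P × o[√logn] Q))
    ×
    ((D : Structure) (P Q size space : ℕ → ℕ) →
    AnswersSA⁻¹ w D P Q →
    StructureSpace w D size → O[n] (λ N → w N * size N) →
    O[n/√logn] P →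
    PreprocessSpace w D space → O[n] (λ N → w N * space N) →
    O[1] Q →
    ¬ o[n/√logn] P)
corollary8p3 c w isWordSize κ μ hard = trade-off , λ D P Q _ _ ans _ _ _ _ _ Q-O oP →
    trade-off (D , P , Q , ans , oP , O[1]⇒o[√logn] Q-O)
  where
  trade-off : ¬ (∃[ D ] ∃[ P ] ∃[ Q ] (AnswersSA⁻¹ w D P Q × o[n/√logn] P × o[√logn] Q))
  trade-off (D , P , Q , ans , oP , oQ) = hard (program , time P Q , solves ans , time-o oP oQ)
    where open Reduction c w isWordSize κ μ D
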